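{- There exists an oracle $O\subseteq\{0,1\}^*$ such that, relative to $O$, all of the following hold: (i) $\mathrm{NP}^O\cap\mathrm{coNP}^O=\mathrm{P}^O$; (ii) no pair in $\mathrm{DisjNP}^O$ is $\leq_\mathrm{m}^{\mathrm{pp},O}$-hard for $\mathrm{DisjUP}^O$ (in particular, $\mathrm{DisjNP}^O$ has no $\leq_\mathrm{m}^{\mathrm{pp},O}$-complete pair); (iii) no language in $\mathrm{UP}^O$ is $\leq_\mathrm{m}^{\mathrm{p},O}$-complete for $\mathrm{UP}^O$; (iv) no pair in $\mathrm{DisjCoNP}^O$ is $\leq_\mathrm{m}^{\mathrm{pp},O}$-hard for $\mathrm{DisjCoUP}^O$ (in particular, $\mathrm{DisjCoNP}^O$ has no $\leq_\mathrm{m}^{\mathrm{pp},O}$-complete pair).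
   Context: All classes are relativized to $O$ by giving the corresponding machines oracle access to $O$. $\mathrm{UP}$ is the class of languages accepted by nondeterministic polynomial-time machines that on every input have at most one accepting computation path. $\mathrm{DisjNP}$ (resp. $\mathrm{DisjUP}$, $\mathrm{DisjCoNP}$, $\mathrm{DisjCoUP}$) is the class of pairs $(A,B)$ of disjoint sets $A,B$ both in $\mathrm{NP}$ (resp. $\mathrm{UP}$, $\mathrm{coNP}$, $\mathrm{coUP}$). For sets, $A\leq_\mathrm{m}^{\mathrm{p},O} B$ means there is $f\in\mathrm{FP}^O$ (total function computable in deterministic polynomial time with oracle $O$) with $x\in A\iff f(x)\in B$ for all $x$; $B$ is complete for a class $\mathcal C$ if $B\in\mathcal C$ and every $A\in\mathcal C$ reduces to $B$. For disjoint pairs, $(A,B)\leq_\mathrm{m}^{\mathrm{pp},O}(C,D)$ means there is $h\in\mathrm{FP}^O$ with $h(A)\subseteq C$ and $h(B)\subseteq D$; a pair is hard for a class of pairs if every pair of that class reduces to it. -}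

module Defs where

open import Data.Bool using (Bool; true; false; not; if_then_else_)
open import Data.Nat using (ℕ; _+_; _*_; _^_)
open import Data.Fin using (Fin)
open import Data.List using (List; []; _∷_; length; map; replicate)
open import Data.Product using (Σ; _×_; _,_; ∃)
open import Data.Sum using (_⊎_; inj₁; inj₂)
open import Data.Empty using (⊥)
open import Relation.Nullary using (¬_)
open import Relation.Binary.PropositionalEquality using (_≡_)

Word : Set
Word = List Bool

Lang : Set
Lang = Word → Bool

_∈L_ : Word → Lang → Set
x ∈L A = A x ≡ true

complement : Lang → Lang
complement A x = not (A x)

data Sym : Set where
  s0 s1 blank : Sym

data Move : Set where
  left right stay : Move

record Tape : Set where
  constructor tape
  field
    lft  : List Sym   -- cells to the left of the head (nearest first)
    hd   : Sym
    rgt  : List Sym   -- cells to the right of the head (nearest first)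

blankTape : Tape
blankTape = tape [] blank []

write : Sym → Tape → Tape
write a (tape l _ r) = tape l a r

moveT : Move → Tape → Tape
moveT left  (tape []      h r) = tape [] blank (h ∷ r)
moveT left  (tape (a ∷ l) h r) = tape l a (h ∷ r)
moveT right (tape l h [])      = tape (h ∷ l) blank []
moveT right (tape l h (a ∷ r)) = tape (h ∷ l) a r
moveT stay  t                  = t

bit : Bool → Sym
bit false = s0
bit true  = s1

readBits : List Sym → Word
readBits []          = []
readBits (s0 ∷ xs)   = false ∷ readBits xs
readBits (s1 ∷ xs)   = true ∷ readBits xs
readBits (blank ∷ _) = []

readWord : Tape → Word
readWord (tape _ h r) = readBits (h ∷ r)

inputTape : Word → Tape
inputTape []      = blankTape
inputTape (b ∷ w) = tape [] (bit b) (map bit w)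

data Action (Q : Set) : Set where
  -- go to state q, write/move on work tape, write/move on query tape
  go   : Q → Sym → Move → Sym → Move → Action Q
  -- query the oracle on the query tape word; go to qyes / qno; erase query tape
  ask  : Q → Q → Action Q
  halt : Bool → Action Q

-- nondeterministic oracle machine: two choices (indexed by a bit) per step
record NOTM : Set where
  field
    states : ℕ
    start  : Fin states
    δ      : Fin states → Sym → Sym → Bool → Action (Fin states)

record DOTM : Set where
  field
    states : ℕ
    start  : Fin states
    δ      : Fin states → Sym → Sym → Action (Fin states)

toN : DOTM → NOTM
toN M = record { states = DOTM.states M ; start = DOTM.start M
               ; δ = λ q a b _ → DOTM.δ M q a b }

record Config (n : ℕ) : Set where
  constructor cfg
  field
    state : Fin n
    work  : Tape
    qtape : Tape

initCfg : (M : NOTM) → Word → Config (NOTM.states M)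
initCfg M x = cfg (NOTM.start M) (inputTape x) blankTape

step : Lang → (M : NOTM) → Bool → Config (NOTM.states M)
     → Config (NOTM.states M) ⊎ (Bool × Config (NOTM.states M))
step O M c (cfg q w t) with NOTM.δ M q (Tape.hd w) (Tape.hd t) c
... | go q' a m b m' = inj₁ (cfg q' (moveT m (write a w)) (moveT m' (write b t)))
... | ask qy qn      = inj₁ (cfg (if O (readWord t) then qy else qn) w blankTape)
... | halt r         = inj₂ (r , cfg q w t)

exec : Lang → (M : NOTM) → List Bool → Config (NOTM.states M)
     → Config (NOTM.states M) ⊎ (Bool × Config (NOTM.states M))
exec O M []       c = inj₁ c
exec O M (b ∷ bs) c with step O M b c
... | inj₁ c' = exec O M bs c'
... | inj₂ h  = inj₂ h

-- verdict of the computation path given by the choice sequence cs,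
-- defined only when the machine halts exactly at the last choice
-- (so distinct such choice sequences are distinct computation paths)
pathResult : Lang → (M : NOTM) → List Bool → Config (NOTM.states M) → Bool → Set
pathResultStep : Lang → (M : NOTM) → List Bool
  → Config (NOTM.states M) ⊎ (Bool × Config (NOTM.states M)) → Bool → Set

pathResult O M []       c r = ⊥
pathResult O M (b ∷ bs) c r = pathResultStep O M bs (step O M b c) r

pathResultStep O M []       (inj₁ _)        r = ⊥
pathResultStep O M []       (inj₂ (r' , _)) r = r' ≡ r
pathResultStep O M (b ∷ bs) (inj₁ c')       r = pathResult O M (b ∷ bs) c' r
pathResultStep O M (b ∷ bs) (inj₂ _)        r = ⊥

AcceptingPath : Lang → (M : NOTM) → Word → List Bool → Set
AcceptingPath O M x cs = pathResult O M cs (initCfg M x) true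

record Poly : Set where
  constructor poly
  field
    c k : ℕ

evalP : Poly → ℕ → ℕ
evalP (poly c k) n = c * n ^ k + c

Halted : {n : ℕ} → Config n ⊎ (Bool × Config n) → Set
Halted (inj₁ _) = ⊥
Halted (inj₂ _) = Data.Unit.⊤
  where import Data.Unit

PolyTime : Lang → NOTM → Poly → Set
PolyTime O M p = ∀ (x : Word) (cs : List Bool) → length cs ≡ evalP p (length x)
               → Halted (exec O M cs (initCfg M x))

dexec : Lang → (M : DOTM) → ℕ → Word
      → Config (DOTM.states M) ⊎ (Bool × Config (DOTM.states M))
dexec O M t x = exec O (toN M) (replicate t false) (initCfg (toN M) x)

InP : Lang → Lang → Set
InP O L = Σ DOTM λ M → Σ Poly λ p → ∀ x →
  Σ Bool λ r → Σ (Config (DOTM.states M)) λ c →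
    dexec O M (evalP p (length x)) x ≡ inj₂ (r , c) × r ≡ L x

InFP : Lang → (Word → Word) → Set
InFP O f = Σ DOTM λ M → Σ Poly λ p → ∀ x →
  Σ Bool λ r → Σ (Config (DOTM.states M)) λ c →
    dexec O M (evalP p (length x)) x ≡ inj₂ (r , c) × readWord (Config.work c) ≡ f x

InNP : Lang → Lang → Set
InNP O L = Σ NOTM λ M → Σ Poly λ p → PolyTime O M p ×
  (∀ x → (x ∈L L → ∃ λ cs → AcceptingPath O M x cs)
       × ((∃ λ cs → AcceptingPath O M x cs) → x ∈L L))

InUP : Lang → Lang → Set
InUP O L = Σ NOTM λ M → Σ Poly λ p → PolyTime O M p ×
  (∀ x → (x ∈L L → ∃ λ cs → AcceptingPath O M x cs)
       × ((∃ λ cs → AcceptingPath O M x cs) → x ∈L L)) ×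
  (∀ x cs cs' → AcceptingPath O M x cs → AcceptingPath O M x cs' → cs ≡ cs')

InCoNP : Lang → Lang → Set
InCoNP O L = InNP O (complement L)

InCoUP : Lang → Lang → Set
InCoUP O L = InUP O (complement L)

_≤m[_]_ : Lang → Lang → Lang → Set
A ≤m[ O ] B = Σ (Word → Word) λ f → InFP O f ×
  (∀ x → (x ∈L A → f x ∈L B) × (f x ∈L B → x ∈L A))

Disjoint : Lang → Lang → Set
Disjoint A B = ∀ x → x ∈L A → x ∈L B → ⊥

DisjPairs : (Lang → Set) → Lang → Lang → Set
DisjPairs C A B = C A × C B × Disjoint A B

DisjNP DisjUP DisjCoNP DisjCoUP : Lang → Lang → Lang → Set
DisjNP   O = DisjPairs (InNP O)
DisjUP   O = DisjPairs (InUP O)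
DisjCoNP O = DisjPairs (InCoNP O)
DisjCoUP O = DisjPairs (InCoUP O)

ppReduces : Lang → Lang → Lang → Lang → Lang → Set
ppReduces O A B C D = Σ (Word → Word) λ h → InFP O h ×
  (∀ x → (x ∈L A → h x ∈L C) × (x ∈L B → h x ∈L D))

PairHard : Lang → (Lang → Lang → Set) → Lang → Lang → Set
PairHard O 𝒞 C D = ∀ A B → 𝒞 A B → ppReduces O A B C D

Complete : Lang → (Lang → Set) → Lang → Set
Complete O 𝒞 L = 𝒞 L × (∀ A → 𝒞 A → A ≤m[ O ] L)

{-# OPTIONS --safe #-}
-- Besides slot words, which carry the witnesses of the diagonal languages, the oracle contains code
-- words: for a pair of clocked machines (N₁ , N₂) and an input x, padded beyond the square of the running
-- time, the code word answers whether N₁ accepts x as soon as exactly one of N₁, N₂ does.  A deterministic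
-- machine lengthens the padding until the oracle declares it sufficient and then asks, so NP ∩ coNP = P.
--
-- The oracle is computable.  At each stage one looks, among the legal choices of slot words of a suitable
-- length n, for one that makes both or neither of the machines of some active pair accept some input; such a
-- choice kills the pair.  Only finitely many pairs are active, so eventually no kill is possible.  Then
-- every code word has, under every legal choice, a certificate of polynomial size (an accepting path of N₁
-- or of N₂ and, recursively, certificates for its queries), and since there are 2^n slot words the current
-- requirement can be met: either a legal choice defeats the reduction, or an illegal one breaks the promise
-- of the pair, respectively of the UP machine, diagonalised against.  In the illegal choice the values of
-- code words with both or no machine accepting are free.  For two slot words w, w′ they are taken as the
-- exclusive or of the values under {w}, {w′} and ∅, which preserves the accepting paths found under {w} and
-- under {w′}; for the empty choice (disjoint coNP pairs) they are the majority of the values under single words.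
module Submission where

open import Defs
open import Data.Bool using (Bool; true; false; if_then_else_; not; _∨_; _xor_)
open import Data.Bool.ListAction using (and)
open import Data.Bool.Properties using (not-involutive; ∨-identityʳ) renaming (_≟_ to _≟ᵇ_)
open import Data.Empty using (⊥; ⊥-elim)
open import Data.Fin using (Fin; zero; suc; toℕ; fromℕ; inject₁)
open import Data.Fin.Patterns
open import Data.Fin.Properties using (toℕ-fromℕ; toℕ-inject₁)
open import Data.List using (List; []; _∷_; _++_; _ʳ++_; length; map; replicate; filter; concatMap; reverse; upTo; cartesianProductWith)
open import Data.List.Membership.Propositional using (_∈_; _∉_; find; lose)
open import Data.List.Membership.Propositional.Properties using (∈-++⁺ˡ; ∈-++⁺ʳ; ∈-++⁻; ∈-map⁺; ∈-map⁻; ∈-filter⁺; ∈-filter⁻; ∈-upTo⁺; ∈-cartesianProductWith⁺; ∈-cartesianProductWith⁻)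
open import Data.List.Properties using (length-map; length-++; length-replicate; length-reverse; length-upTo; filter-none; ≡-dec; ∷-injectiveˡ; ∷-injectiveʳ; ++-cancelˡ; ++-identityʳ; reverse-involutive; ʳ++-defn; map-ʳ++)
open import Data.List.Relation.Unary.All as All using (All; []; _∷_)
open import Data.List.Relation.Unary.All.Properties using (++⁺; ++⁻ˡ; ++⁻ʳ)
open import Data.List.Relation.Unary.AllPairs using ([]; _∷_)
open import Data.List.Relation.Unary.Any using (Any; here; there; any?)
open import Data.List.Relation.Unary.Unique.Propositional using (Unique)
open import Data.List.Relation.Unary.Unique.Propositional.Properties as Unique using ()
open import Data.Maybe using (Maybe; just; nothing)
open import Data.Nat using (ℕ; zero; suc; _+_; _*_; _^_; _∸_; _≤_; _<_; z≤n; s≤s)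
open import Data.Nat.Properties
open import Data.List.Membership.DecPropositional _≟_ using (_∈?_)
open import Data.Nat.Solver using (module +-*-Solver)
open import Data.Product using (Σ; _×_; _,_; ∃; ∃₂; proj₁; proj₂)
open import Data.Sum using (_⊎_; inj₁; inj₂; [_,_]′)
open import Data.Unit using (⊤; tt)
open import Function using (_∘_)
open import Relation.Binary.PropositionalEquality
open import Relation.Nullary using (¬_; ¬?; Dec; yes; no; does)
open import Relation.Nullary.Decidable using (map′; _×-dec_; _⊎-dec_; dec-true; dec-false)

-- Oracle computations and the words they query

-- The obstacle is that a code word asks for the outcome of whole computations, so its value might
-- depend on exponentially many slot words, and a change of one slot word could have uncontrollable
-- effects. A certificate removes this dependence: one accepting path of length t asks at most t
-- words of length at most t, whose certificates have by induction at most t + 1 words each, and a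
-- padding beyond t(t + 1) keeps the certificate of a code word w within length w + 1 words. But
-- certificates exist only where exactly one of the two machines accepts. Once no kill is possible
-- this holds for the legal choices; nothing is known about illegal ones, since a kill has to commit
-- the oracle to a choice that keeps the promises of the languages under construction. Hence the
-- free values need a definition of their own there. A kill does no harm: the two machines have
-- equal verdicts on some input, so they are not complementary and NP ∩ coNP demands nothing of
-- them. A broken promise likewise releases the oracle from the legality conditions of the target.

Agree : Lang → Lang → List Word → Set
Agree O O′ = All (λ w → O w ≡ O′ w)

actionQueries : ∀ {Q} → Action Q → Tape → List Word
actionQueries (go _ _ _ _ _) t = []
actionQueries (ask _ _)      t = readWord t ∷ []
actionQueries (halt _)       t = []

stepQueries : (M : NOTM) → Bool → Config (NOTM.states M) → List Word
stepQueries M b (cfg q w t) = actionQueries (NOTM.δ M q (Tape.hd w) (Tape.hd t) b) t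

queries     : Lang → (M : NOTM) → List Bool → Config (NOTM.states M) → List Word
queriesFrom : Lang → (M : NOTM) → List Bool
            → Config (NOTM.states M) ⊎ (Bool × Config (NOTM.states M)) → List Word
queries O M []       c = []
queries O M (b ∷ bs) c = stepQueries M b c ++ queriesFrom O M bs (step O M b c)
queriesFrom O M bs (inj₁ c) = queries O M bs c
queriesFrom O M bs (inj₂ _) = []

module _ {O O′ : Lang} (M : NOTM) where

  step-agree : ∀ b c → Agree O O′ (stepQueries M b c) → step O M b c ≡ step O′ M b c
  step-agree b (cfg q w t) ag with NOTM.δ M q (Tape.hd w) (Tape.hd t) b
  ... | go _ _ _ _ _ = refl
  ... | ask qy qn    = cong (λ v → inj₁ (cfg (if v then qy else qn) w blankTape)) (All.head ag)
  ... | halt _       = refl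

  exec-agree : ∀ cs c → Agree O O′ (queries O M cs c) → exec O M cs c ≡ exec O′ M cs c
  exec-agree []       c ag = refl
  exec-agree (b ∷ bs) c ag
    with step O M b c | step O′ M b c | step-agree b c (++⁻ˡ (stepQueries M b c) ag)
       | ++⁻ʳ (stepQueries M b c) ag
  ... | inj₁ c′ | _ | refl | ag′ = exec-agree bs c′ ag′
  ... | inj₂ _  | _ | refl | _   = refl

  path-agree     : ∀ cs c r → Agree O O′ (queries O M cs c)
                 → pathResult O M cs c r ≡ pathResult O′ M cs c r
  pathStep-agree : ∀ cs s r → Agree O O′ (queriesFrom O M cs s)
                 → pathResultStep O M cs s r ≡ pathResultStep O′ M cs s r
  path-agree []       c r ag = refl
  path-agree (b ∷ bs) c r ag = trans
    (pathStep-agree bs (step O M b c) r (++⁻ʳ (stepQueries M b c) ag))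
    (cong (λ s → pathResultStep O′ M bs s r) (step-agree b c (++⁻ˡ (stepQueries M b c) ag)))
  pathStep-agree []       (inj₁ _) r ag = refl
  pathStep-agree []       (inj₂ _) r ag = refl
  pathStep-agree (b ∷ bs) (inj₁ c) r ag = path-agree (b ∷ bs) c r ag
  pathStep-agree (b ∷ bs) (inj₂ _) r ag = refl

-- The cells to the left of the head are left out because `readWord` never sees them; a left move
-- lengthens the counted part by one cell.
tapeSize : Tape → ℕ
tapeSize (tape _ _ r) = suc (length r)

length-readBits : ∀ xs → length (readBits xs) ≤ length xs
length-readBits []          = z≤n
length-readBits (s0 ∷ xs)   = s≤s (length-readBits xs)
length-readBits (s1 ∷ xs)   = s≤s (length-readBits xs)
length-readBits (blank ∷ _) = z≤n

length-readWord : ∀ t → length (readWord t) ≤ tapeSize t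
length-readWord (tape _ h r) = length-readBits (h ∷ r)

tapeSize-move : ∀ m a t → tapeSize (moveT m (write a t)) ≤ suc (tapeSize t)
tapeSize-move left  a (tape []      h r)       = ≤-refl
tapeSize-move left  a (tape (_ ∷ _) h r)       = ≤-refl
tapeSize-move right a (tape l       h [])      = n≤1+n _
tapeSize-move right a (tape l       h (_ ∷ r)) = ≤-trans (n≤1+n _) (n≤1+n _)
tapeSize-move stay  a (tape l       h r)       = n≤1+n _

StepBound : ∀ {n} → ℕ → ℕ → Config n ⊎ (Bool × Config n) → Set
StepBound i j (inj₁ c)       = tapeSize (Config.work c) ≤ i × tapeSize (Config.qtape c) ≤ j
StepBound i j (inj₂ (_ , c)) = tapeSize (Config.work c) ≤ i

module _ (O : Lang) (M : NOTM) where

  step-bound : ∀ {i j} b c → tapeSize (Config.work c) ≤ i → tapeSize (Config.qtape c) ≤ j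
             → StepBound (suc i) (suc j) (step O M b c)
  step-bound b (cfg q w t) wi tj with NOTM.δ M q (Tape.hd w) (Tape.hd t) b
  ... | go _ a m a′ m′ = ≤-trans (tapeSize-move m a w) (s≤s wi) , ≤-trans (tapeSize-move m′ a′ t) (s≤s tj)
  ... | ask _ _        = m≤n⇒m≤1+n wi , s≤s z≤n
  ... | halt _         = m≤n⇒m≤1+n wi

  length-queries : ∀ cs c → length (queries O M cs c) ≤ length cs
  length-queries []       c = z≤n
  length-queries (b ∷ bs) c@(cfg q w t) with NOTM.δ M q (Tape.hd w) (Tape.hd t) b
  ... | go _ _ _ _ _ = m≤n⇒m≤1+n (length-queries bs _)
  ... | ask _ _      = s≤s (length-queries bs _)
  ... | halt _       = z≤n

  -- The asking step writes nothing, so its own choice pays for the extra cell in `suc j`. With the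
  -- blank tape, j is 0 and a query is no longer than the path.
  queries-short : ∀ {j} cs c → tapeSize (Config.qtape c) ≤ suc j
                → All (λ w → length w ≤ j + length cs) (queries O M cs c)
  queries-short []       c tj = []
  queries-short {j} (b ∷ bs) c@(cfg q w t) tj
    with NOTM.δ M q (Tape.hd w) (Tape.hd t) b | step-bound b c ≤-refl tj
  ... | go _ _ _ _ _ | _ , tj′ = All.map (λ p → ≤-trans p (≤-reflexive (sym (+-suc j _)))) (queries-short bs _ tj′)
  ... | ask _ _      | _ , tj′ =
    ≤-trans (length-readWord t) (≤-trans tj (≤-trans (s≤s (m≤m+n j _)) (≤-reflexive (sym (+-suc j _)))))
    ∷ All.map (λ p → ≤-trans p (≤-reflexive (sym (+-suc j _)))) (queries-short bs _ tj′)
  ... | halt _       | _ = []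

  output-bound : ∀ {i} cs c {r c′} → tapeSize (Config.work c) ≤ i → exec O M cs c ≡ inj₂ (r , c′)
               → tapeSize (Config.work c′) ≤ i + length cs
  output-bound (b ∷ bs) c wi eq with step O M b c | step-bound b c wi ≤-refl
  output-bound {i} (b ∷ bs) c wi eq | inj₁ c′ | wi′ , _ =
    ≤-trans (output-bound bs c′ wi′ eq) (≤-reflexive (sym (+-suc i _)))
  output-bound {i} (b ∷ bs) c wi refl | inj₂ _ | wi′ =
    ≤-trans wi′ (≤-trans (s≤s (m≤m+n i _)) (≤-reflexive (sym (+-suc i _))))

  initQueries-short : ∀ cs x → All (λ w → length w ≤ length cs) (queries O M cs (initCfg M x))
  initQueries-short cs x = queries-short cs (initCfg M x) ≤-refl

  output-short : ∀ cs x {r c} → exec O M cs (initCfg M x) ≡ inj₂ (r , c)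
               → length (readWord (Config.work c)) ≤ suc (length x) + length cs
  output-short cs x {c = c} eq =
    ≤-trans (length-readWord (Config.work c)) (output-bound cs (initCfg M x) (size x) eq)
    where
    size : ∀ x → tapeSize (inputTape x) ≤ suc (length x)
    size []      = ≤-refl
    size (b ∷ w) = s≤s (≤-trans (≤-reflexive (length-map bit w)) (n≤1+n _))

  path?     : ∀ cs c r → Dec (pathResult O M cs c r)
  pathStep? : ∀ cs s r → Dec (pathResultStep O M cs s r)
  path? []       c r = no λ ()
  path? (b ∷ bs) c r = pathStep? bs (step O M b c) r
  pathStep? []       (inj₁ _)        r = no λ ()
  pathStep? []       (inj₂ (r′ , _)) r = r′ ≟ᵇ r
  pathStep? (b ∷ bs) (inj₁ c)        r = path? (b ∷ bs) c r
  pathStep? (b ∷ bs) (inj₂ _)        r = no λ ()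

  path-exec : ∀ cs c {r} → pathResult O M cs c r → ∀ bs → ∃ λ c′ → exec O M (cs ++ bs) c ≡ inj₂ (r , c′)
  path-exec (b ∷ cs) c p bs with step O M b c
  ... | inj₁ c′ = path-exec cs c′ (resume cs p) bs
    where
    resume : ∀ cs {r} → pathResultStep O M cs (inj₁ c′) r → pathResult O M cs c′ r
    resume (_ ∷ _) p = p
  path-exec (b ∷ []) c refl bs | inj₂ (_ , c′) = c′ , refl

  -- Ties the paths of unrestricted length in the definitions of NP and UP to the clocked search of
  -- `AcceptsWithin`.
  path-length : ∀ t c → (∀ cs → length cs ≡ t → Halted (exec O M cs c))
              → ∀ cs {r} → pathResult O M cs c r → length cs ≤ t
  path-length zero c h cs p = ⊥-elim (h [] refl)
  path-length (suc t) c h (b ∷ []) p = s≤s z≤n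
  path-length (suc t) c h (b ∷ b′ ∷ bs) p with step O M b c | (λ cs q → h (b ∷ cs) (cong suc q))
  ... | inj₁ c′ | h′ = s≤s (path-length t c′ h′ (b′ ∷ bs) p)

wordUpTo? : ∀ t {P : Word → Set} → (∀ w → Dec (P w)) → Dec (∃ λ w → length w ≤ t × P w)
wordUpTo? zero P? with P? []
... | yes p = yes ([] , z≤n , p)
... | no ¬p = no λ { ([] , _ , p) → ¬p p }
wordUpTo? (suc t) {P} P? =
  map′ to from (P? [] ⊎-dec (wordUpTo? t (λ w → P? (false ∷ w)) ⊎-dec wordUpTo? t (λ w → P? (true ∷ w))))
  where
  to : _ → ∃ λ w → length w ≤ suc t × P w
  to (inj₁ p)                  = [] , z≤n , p
  to (inj₂ (inj₁ (w , l , p))) = false ∷ w , s≤s l , p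
  to (inj₂ (inj₂ (w , l , p))) = true ∷ w , s≤s l , p
  from : (∃ λ w → length w ≤ suc t × P w) → _
  from ([] , _ , p)             = inj₁ p
  from (false ∷ w , s≤s l , p) = inj₂ (inj₁ (w , l , p))
  from (true ∷ w , s≤s l , p)  = inj₂ (inj₂ (w , l , p))

AcceptsWithin : Lang → NOTM → ℕ → Word → Set
AcceptsWithin O M t x = ∃ λ cs → length cs ≤ t × AcceptingPath O M x cs

acceptsWithin? : ∀ O M t x → Dec (AcceptsWithin O M t x)
acceptsWithin? O M t x = wordUpTo? t (λ cs → path? O M cs (initCfg M x) true)

accepts : Lang → NOTM → ℕ → Word → Bool
accepts O M t x = does (acceptsWithin? O M t x)

accepts-complete : ∀ {O M t x} → AcceptsWithin O M t x → accepts O M t x ≡ true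
accepts-complete {O} {M} {t} {x} = dec-true (acceptsWithin? O M t x)

accepts-sound : ∀ {O M t x} → accepts O M t x ≡ true → AcceptsWithin O M t x
accepts-sound {O} {M} {t} {x} eq with acceptsWithin? O M t x
... | yes a = a

AgreeUpTo : ℕ → Lang → Lang → Set
AgreeUpTo t O O′ = ∀ w → length w ≤ t → O w ≡ O′ w

agreeUpTo-sym : ∀ {t O O′} → AgreeUpTo t O O′ → AgreeUpTo t O′ O
agreeUpTo-sym ag w l = sym (ag w l)

-- The words asked are no longer than the path, so one number serves both as clock and as range of
-- agreement.
acceptingPath-agree : ∀ {O O′ t} M x cs → AgreeUpTo t O O′ → length cs ≤ t
                    → AcceptingPath O M x cs → AcceptingPath O′ M x cs
acceptingPath-agree {O} M x cs ag l =
  subst (λ A → A) (path-agree M cs _ true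
    (All.map (λ {w} q → ag w (≤-trans q l)) (initQueries-short O M cs x)))

acceptsWithin-agree : ∀ {O O′ t} M x → AgreeUpTo t O O′ → AcceptsWithin O M t x → AcceptsWithin O′ M t x
acceptsWithin-agree M x ag (cs , l , p) = cs , l , acceptingPath-agree M x cs ag l p

bool-iff : ∀ {a b} → (a ≡ true → b ≡ true) → (b ≡ true → a ≡ true) → a ≡ b
bool-iff {false} {false} f g = refl
bool-iff {false} {true}  f g = g refl
bool-iff {true}  {false} f g = sym (f refl)
bool-iff {true}  {true}  f g = refl

accepts-agree : ∀ {O O′ t} M x → AgreeUpTo t O O′ → accepts O M t x ≡ accepts O′ M t x
accepts-agree {O} {O′} M x ag = bool-iff
  (λ e → accepts-complete {O′} (acceptsWithin-agree M x ag (accepts-sound {O} e)))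
  (λ e → accepts-complete {O} (acceptsWithin-agree M x (agreeUpTo-sym ag) (accepts-sound {O′} e)))

-- Finite sets of words

_≟ʷ_ : (v w : Word) → Dec (v ≡ w)
_≟ʷ_ = ≡-dec _≟ᵇ_

_∈ʷ?_ : (w : Word) (ws : List Word) → Dec (w ∈ ws)
w ∈ʷ? ws = any? (w ≟ʷ_) ws

delete : ∀ {A : Set} {x : A} ys → x ∈ ys →
  Σ (List A) λ zs → suc (length zs) ≡ length ys × (∀ {y} → y ∈ ys → y ≡ x ⊎ y ∈ zs)
delete (y ∷ ys) (here refl) = ys , refl , λ { (here e) → inj₁ e ; (there m) → inj₂ m }
delete (y ∷ ys) (there x∈) with delete ys x∈
... | zs , len , split = y ∷ zs , cong suc len , split′
  where
  split′ : ∀ {v} → v ∈ y ∷ ys → v ≡ _ ⊎ v ∈ y ∷ zs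
  split′ (here e) = inj₂ (here e)
  split′ (there m) with split m
  ... | inj₁ e = inj₁ e
  ... | inj₂ m′ = inj₂ (there m′)

module _ {A : Set} (_≟_ : (x y : A) → Dec (x ≡ y)) where

  pigeonholeᴬ : ∀ (X L : List A) → Unique X → length L < length X → ∃ λ x → x ∈ X × x ∉ L
  pigeonholeᴬ (x ∷ X) L (x∉X ∷ uX) lt with any? (x ≟_) L
  ... | no x∉L = x , here refl , x∉L
  ... | yes x∈L with delete L x∈L
  ... | L′ , len , split with pigeonholeᴬ X L′ uX (≤-pred (subst (_< suc (length X)) (sym len) lt))
  ... | y , y∈X , y∉L′ = y , there y∈X , y∉L
    where
    y∉L : y ∉ L
    y∉L m with split m
    ... | inj₁ refl = All.lookup x∉X y∈X refl
    ... | inj₂ m′   = y∉L′ m′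

pigeonhole : ∀ (X L : List Word) → Unique X → length L < length X → ∃ λ x → x ∈ X × x ∉ L
pigeonhole = pigeonholeᴬ _≟ʷ_

length-concatMap : ∀ {A B : Set} (f : A → List B) q xs → (∀ {x} → x ∈ xs → length (f x) ≤ q)
                 → length (concatMap f xs) ≤ length xs * q
length-concatMap f q []       h = z≤n
length-concatMap f q (x ∷ xs) h =
  ≤-trans (≤-reflexive (length-++ (f x))) (+-mono-≤ (h (here refl)) (length-concatMap f q xs (h ∘ there)))

∈-concatMap : ∀ {A B : Set} (f : A → List B) {x y} xs → x ∈ xs → y ∈ f x → y ∈ concatMap f xs
∈-concatMap f (x ∷ xs) (here refl) m = ∈-++⁺ˡ m
∈-concatMap f (x ∷ xs) (there x∈)  m = ∈-++⁺ʳ (f x) (∈-concatMap f xs x∈ m)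

prefix : ∀ k (X : List Word) → Unique X → k ≤ length X
       → Σ (List Word) λ Z → length Z ≡ k × Unique Z × (∀ {z} → z ∈ Z → z ∈ X)
prefix zero    X       uX         l       = [] , refl , [] , λ ()
prefix (suc k) (x ∷ X) (x∉X ∷ uX) (s≤s l) with prefix k X uX l
... | Z , len , uZ , sub =
  x ∷ Z , cong suc len , All.tabulate (λ m → All.lookup x∉X (sub m)) ∷ uZ ,
  λ { (here e) → here e ; (there m) → there (sub m) }

-- Fix q + 1 elements of X; some x′ ∈ X′ lies outside all their lists,
-- and since the list of x′ has only q elements it misses one of them.
opaque
  independentPair : ∀ {A B : Word → Set} (X X′ : List Word) q
    (Q : ∀ {x} → A x → List Word) (R : ∀ {x} → B x → List Word) → Unique X → Unique X′
    → (∀ {x} (a : A x) → length (Q a) ≤ q) → (∀ {x} (b : B x) → length (R b) ≤ q)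
    → suc q * q < length X → suc q * q < length X′
    → (∀ x → x ∈ X → A x) → (∀ x → x ∈ X′ → B x)
    → ∃ λ x → ∃ λ x′ → x ∈ X × x′ ∈ X′ × Σ (A x) λ a → Σ (B x′) λ b → x′ ∉ Q a × x ∉ R b
  independentPair {A} {B} X X′ q Q R uX uX′ Q≤ R≤ X> X′> fA fB
    with prefix (suc q) X uX (≤-<-trans (m≤m+n q (q * q)) X>)
  ... | Z , lenZ , uZ , Z⊆X with pigeonhole X′ (concatMap lists Z) uX′
          (≤-<-trans (≤-trans (length-concatMap lists q Z (λ {x} _ → lists≤ x)) (≤-reflexive (cong (_* q) lenZ))) X′>)
    where
    lists : Word → List Word
    lists x with x ∈ʷ? X
    ... | yes m = Q (fA x m)
    ... | no _  = []
    lists≤ : ∀ x → length (lists x) ≤ q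
    lists≤ x with x ∈ʷ? X
    ... | yes m = Q≤ (fA x m)
    ... | no _  = z≤n
  ... | x′ , x′∈ , x′∉ with pigeonhole Z (R (fB x′ x′∈)) uZ (≤-<-trans (R≤ (fB x′ x′∈)) (≤-reflexive (sym lenZ)))
  -- Repeating the membership test lets `lists x` reduce, so that the witness returned is the very
  -- one whose list was avoided.
  ... | x , x∈ , x∉ with x ∈ʷ? X | (λ m → x′∉ (∈-concatMap _ Z x∈ m))
  ... | yes m | h = x , x′ , m , x′∈ , fA x m , fB x′ x′∈ , h , x∉
  ... | no ¬m | _ = ⊥-elim (¬m (Z⊆X x∈))

allWords : ℕ → List Word
allWords zero    = [] ∷ []
allWords (suc n) = map (false ∷_) (allWords n) ++ map (true ∷_) (allWords n)

length-allWords : ∀ n → length (allWords n) ≡ 2 ^ n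
length-allWords zero    = refl
length-allWords (suc n) = begin
  length (map (false ∷_) (allWords n) ++ map (true ∷_) (allWords n)) ≡⟨ length-++ (map (false ∷_) (allWords n)) ⟩
  length (map (false ∷_) (allWords n)) + length (map (true ∷_) (allWords n))
    ≡⟨ cong₂ _+_ (length-map _ (allWords n)) (length-map _ (allWords n)) ⟩
  length (allWords n) + length (allWords n) ≡⟨ cong₂ _+_ (length-allWords n) (length-allWords n) ⟩
  2 ^ n + 2 ^ n ≡⟨ cong (2 ^ n +_) (sym (+-identityʳ _)) ⟩
  2 ^ suc n ∎
  where open ≡-Reasoning

allWords-unique : ∀ n → Unique (allWords n)
allWords-unique zero    = [] ∷ []
allWords-unique (suc n) = Unique.++⁺
  (Unique.map⁺ ∷-injectiveʳ (allWords-unique n)) (Unique.map⁺ ∷-injectiveʳ (allWords-unique n))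
  λ { (m , m′) → apart (∈-map⁻ _ m) (∈-map⁻ _ m′) }
  where
  apart : ∀ {w} → (∃ λ v → v ∈ allWords n × w ≡ false ∷ v) → (∃ λ v → v ∈ allWords n × w ≡ true ∷ v) → ⊥
  apart (_ , _ , refl) (_ , _ , ())

∈-allWords : ∀ w → w ∈ allWords (length w)
∈-allWords []          = here refl
∈-allWords (false ∷ w) = ∈-++⁺ˡ (∈-map⁺ _ (∈-allWords w))
∈-allWords (true ∷ w)  = ∈-++⁺ʳ _ (∈-map⁺ _ (∈-allWords w))

allWords-length : ∀ n {w} → w ∈ allWords n → length w ≡ n
allWords-length zero    (here refl) = refl
allWords-length (suc n) m with ∈-++⁻ (map (false ∷_) (allWords n)) m
... | inj₁ m′ with ∈-map⁻ _ m′
... | _ , v∈ , refl = cong suc (allWords-length n v∈)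
allWords-length (suc n) m | inj₂ m′ with ∈-map⁻ _ m′
... | _ , v∈ , refl = cong suc (allWords-length n v∈)

findOrAll : ∀ {A : Set} {B : Word → Set} X → (∀ x → x ∈ X → A ⊎ B x) → A ⊎ (∀ x → x ∈ X → B x)
findOrAll []      f = inj₂ λ _ ()
findOrAll (x ∷ X) f with f x (here refl)
... | inj₁ a = inj₁ a
... | inj₂ b with findOrAll X (λ y m → f y (there m))
... | inj₁ a = inj₁ a
... | inj₂ g = inj₂ λ { y (here refl) → b ; y (there m) → g y m }

-- Oracles determined by a choice of slot words

-- Only `slot` and `coded` words react to the choice at the current stage; `fixed` covers what
-- earlier stages settled, default values, padding answers and inactive code words.
data Class : Set where
  fixed : Bool → Class
  slot  : Class
  coded : ℕ → Word → Class

-- The value of a code word, given the verdicts of its two machines; d is a free parameter.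
codeValue : Bool → Bool → Bool → Bool
codeValue true  false _ = true
codeValue false true  _ = false
codeValue true  true  d = d
codeValue false false d = d

n≤n*suc : ∀ n → n ≤ n * suc n
n≤n*suc n = m≤m*n n (suc n)

module Extension
  (mach : ℕ → Bool → NOTM) (time : ℕ → Word → ℕ) (class : Word → Class)
  (class-bound : ∀ {w e x} → class w ≡ coded e x → suc (time e x * suc (time e x)) ≤ length w)
  where

  acc : Lang → Bool → ℕ → Word → Bool
  acc O b e x = accepts O (mach e b) (time e x) x

  time< : ∀ {w e x} → class w ≡ coded e x → time e x < length w
  time< {w} {e} {x} eq = ≤-trans (s≤s (n≤n*suc (time e x))) (class-bound eq)

  value : Lang → Lang → Lang → Word → Class → Bool
  value S d O w (fixed b)   = b
  value S d O w slot        = S w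
  value S d O w (coded e x) = codeValue (acc O true e x) (acc O false e x) (d w)

  value-local : ∀ {S d O O′} w → (∀ v → length v < length w → O v ≡ O′ v)
              → value S d O w (class w) ≡ value S d O′ w (class w)
  value-local {S} {d} {O} {O′} w ag with class w in eq
  ... | fixed _   = refl
  ... | slot      = refl
  ... | coded e x = cong₂ (λ a a′ → codeValue a a′ (d w)) (same true) (same false)
    where
    same : ∀ b → acc O b e x ≡ acc O′ b e x
    same b = accepts-agree (mach e b) x λ v l → ag v (≤-<-trans l (time< eq))

  -- A code word refers only to shorter words. Fuel replaces recursion on the length, and the value
  -- is stable once the fuel exceeds it.
  iter : Lang → Lang → ℕ → Lang
  iter S d zero    w = false
  iter S d (suc k) w = value S d (iter S d k) w (class w)

  iter-stable : ∀ {S d} k k′ w → length w < k → length w < k′ → iter S d k w ≡ iter S d k′ w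
  iter-stable (suc k) (suc k′) w (s≤s l) (s≤s l′) =
    value-local w λ v m → iter-stable k k′ v (<-≤-trans m l) (<-≤-trans m l′)

  opaque
    ext : Lang → Lang → Lang
    ext S d w = iter S d (suc (length w)) w

    ext-unfold : ∀ {S d} w → ext S d w ≡ value S d (ext S d) w (class w)
    ext-unfold {S} {d} w = value-local w λ v m → iter-stable (length w) (suc (length v)) v m ≤-refl

  module _ {S d : Lang} where

    ext-fixed : ∀ {w b} → class w ≡ fixed b → ext S d w ≡ b
    ext-fixed {w} eq = trans (ext-unfold w) (cong (value S d _ w) eq)

    ext-slot : ∀ {w} → class w ≡ slot → ext S d w ≡ S w
    ext-slot {w} eq = trans (ext-unfold w) (cong (value S d _ w) eq)

    ext-coded : ∀ {w e x} → class w ≡ coded e x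
              → ext S d w ≡ codeValue (acc (ext S d) true e x) (acc (ext S d) false e x) (d w)
    ext-coded {w} eq = trans (ext-unfold w) (cong (value S d _ w) eq)

  Violated : Lang → Word → Set
  Violated O w = ∃₂ λ e x → class w ≡ coded e x × acc O true e x ≡ acc O false e x

  violated? : ∀ O w → Dec (Violated O w)
  violated? O w with class w
  ... | fixed _ = no λ ()
  ... | slot    = no λ ()
  ... | coded e x with acc O true e x ≟ᵇ acc O false e x
  ... | yes p = yes (e , x , refl , p)
  ... | no ¬p = no λ { (_ , _ , refl , p) → ¬p p }

  Clean : ℕ → Lang → Set
  Clean H O = ∀ w → length w ≤ H → ¬ Violated O w

  -- The answer `O w` itself selects the machine: where exactly one machine accepts, it is the one
  -- named by the answer, so one form of certificate covers both answers.
  Certificate : Lang → List Word → Word → ℕ → Word → Set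
  Certificate O K w e x = ∃ λ cs → length cs ≤ time e x × AcceptingPath O (mach e (O w)) x cs
    × All (_∈ K) (queries O (mach e (O w)) cs (initCfg (mach e (O w)) x))

  Closed : Lang → List Word → Set
  Closed O K = ∀ {w e x} → w ∈ K → class w ≡ coded e x → Certificate O K w e x

  closed-++ : ∀ {O} K K′ → Closed O K → Closed O K′ → Closed O (K ++ K′)
  closed-++ K K′ cl cl′ m eq with ∈-++⁻ K m
  ... | inj₁ m₁ with cl m₁ eq
  ... | cs , l , p , q = cs , l , p , All.map ∈-++⁺ˡ q
  closed-++ K K′ cl cl′ m eq | inj₂ m₂ with cl′ m₂ eq
  ... | cs , l , p , q = cs , l , p , All.map (∈-++⁺ʳ K) q

  coded-path : ∀ {S d w e x} → class w ≡ coded e x → ¬ Violated (ext S d) w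
             → AcceptsWithin (ext S d) (mach e (ext S d w)) (time e x) x
  coded-path {S} {d} {w} {e} {x} eq clean
    with acc (ext S d) true e x in eq₁ | acc (ext S d) false e x in eq₂ | ext-coded {S} {d} eq
  ... | true  | false | v rewrite v = accepts-sound {ext S d} eq₁
  ... | false | true  | v rewrite v = accepts-sound {ext S d} eq₂
  ... | true  | true  | _ = ⊥-elim (clean (e , x , eq , trans eq₁ (sym eq₂)))
  ... | false | false | _ = ⊥-elim (clean (e , x , eq , trans eq₁ (sym eq₂)))

  module _ {S d : Lang} {H : ℕ} (clean : Clean H (ext S d)) where

    -- The size bound reproduces itself: at most `time e x` queries contribute at most
    -- `suc (time e x)` words each, which by `class-bound` is less than `length w`, and w adds one
    -- more.
    closureWord  : ∀ f w → length w ≤ f → length w ≤ H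
                 → Σ (List Word) λ K → w ∈ K × length K ≤ suc (length w)
                   × All (λ v → length v ≤ length w) K × Closed (ext S d) K
    closureWords : ∀ f t ws → t ≤ f → t ≤ H → All (λ v → length v ≤ t) ws
                 → Σ (List Word) λ K → All (_∈ K) ws × length K ≤ length ws * suc t
                   × All (λ v → length v ≤ t) K × Closed (ext S d) K
    closureWord f w wf wH with class w in eq
    ... | fixed _ = w ∷ [] , here refl , s≤s z≤n , ≤-refl ∷ [] ,
                    λ { (here refl) eq′ → ⊥-elim (absurd (trans (sym eq) eq′)) }
      where absurd : ∀ {b e x} → ¬ (fixed b ≡ coded e x)
            absurd ()
    ... | slot    = w ∷ [] , here refl , s≤s z≤n , ≤-refl ∷ [] ,
                    λ { (here refl) eq′ → ⊥-elim (absurd (trans (sym eq) eq′)) }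
      where absurd : ∀ {e x} → ¬ (slot ≡ coded e x)
            absurd ()
    closureWord zero    w wf wH | coded e x = ⊥-elim (n≮0 (<-≤-trans (time< eq) wf))
    closureWord (suc f) w wf wH | coded e x
      with coded-path eq (clean w wH)
    ... | cs , l , p
      with closureWords f (time e x) (queries (ext S d) M cs (initCfg M x))
             (≤-pred (<-≤-trans (time< eq) wf)) (≤-trans (<⇒≤ (time< eq)) wH)
             (All.map (λ h → ≤-trans h l) (initQueries-short (ext S d) M cs x))
      where M = mach e (ext S d w)
    ... | K , sub , len , short , cl =
      w ∷ K , here refl ,
      s≤s (≤-trans len (≤-trans (*-monoˡ-≤ _ (≤-trans (length-queries (ext S d) M cs _) l))
                                (≤-trans (n≤1+n _) (class-bound eq)))) ,
      ≤-refl ∷ All.map (λ h → ≤-trans h (<⇒≤ (time< eq))) short ,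
      cl′
      where
      M = mach e (ext S d w)
      cl′ : Closed (ext S d) (w ∷ K)
      cl′ (here refl) eq′ with trans (sym eq) eq′
      ... | refl = cs , l , p , All.map there sub
      cl′ (there m) eq′ with cl m eq′
      ... | cs′ , l′ , p′ , q′ = cs′ , l′ , p′ , All.map there q′
    closureWords f t []       tf tH []        = [] , [] , z≤n , [] , λ ()
    closureWords f t (w ∷ ws) tf tH (h ∷ hs)
      with closureWord f w (≤-trans h tf) (≤-trans h tH) | closureWords f t ws tf tH hs
    ... | K , m , len , short , cl | K′ , m′ , len′ , short′ , cl′ =
      K ++ K′ , ∈-++⁺ˡ m ∷ All.map (∈-++⁺ʳ K) m′ ,
      ≤-trans (≤-reflexive (length-++ K)) (+-mono-≤ (≤-trans len (s≤s h)) len′) ,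
      ++⁺ (All.map (λ l → ≤-trans l h) short) short′ , closed-++ K K′ cl cl′

    closure : ∀ t ws → t ≤ H → All (λ v → length v ≤ t) ws
            → Σ (List Word) λ K → All (_∈ K) ws × length K ≤ length ws * suc t
              × All (λ v → length v ≤ t) K × Closed (ext S d) K
    closure t ws = closureWords t t ws ≤-refl

  codeValue-≡ : ∀ {a₁ a₂ d v} → (if v then a₁ else a₂) ≡ true → (a₁ ≡ a₂ → d ≡ v) → v ≡ codeValue a₁ a₂ d
  codeValue-≡ {true}  {true}  {v = true}  p h = sym (h refl)
  codeValue-≡ {true}  {true}  {v = false} p h = sym (h refl)
  codeValue-≡ {true}  {false} {v = true}  p h = refl
  codeValue-≡ {false} {true}  {v = false} p h = refl

  -- Induction on the length. The queries of a certificate are shorter members of K, so its path is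
  -- still accepting in the second oracle. The code word can then change only if the other machine
  -- accepts there too, and at such a violated word `d′` is required to return the old value.
  closed-agree : ∀ {S d S′ d′ K} → Closed (ext S d) K
    → (∀ {w} → w ∈ K → class w ≡ slot → S w ≡ S′ w)
    → (∀ {w} → w ∈ K → Violated (ext S′ d′) w → d′ w ≡ ext S d w)
    → ∀ {w} → w ∈ K → ext S d w ≡ ext S′ d′ w
  closed-agree {S} {d} {S′} {d′} {K} cl slots viol {w} m = agree (length w) ≤-refl m
    where
    O O′ : Lang
    O  = ext S d
    O′ = ext S′ d′
    agree : ∀ f {w} → length w ≤ f → w ∈ K → O w ≡ O′ w
    agree f {w} wf m with class w in eq
    ... | fixed b = trans (ext-fixed eq) (sym (ext-fixed eq))
    ... | slot    = trans (ext-slot eq) (trans (slots m eq) (sym (ext-slot eq)))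
    agree zero    {w} wf m | coded e x = ⊥-elim (n≮0 (<-≤-trans (time< eq) wf))
    agree (suc f) {w} wf m | coded e x with cl m eq
    ... | cs , l , p , q = trans (codeValue-≡ (branch (O w) accepted) λ a → viol m (e , x , eq , a)) (sym (ext-coded eq))
      where
      M = mach e (O w)
      short : All (λ v → length v ≤ f × v ∈ K) (queries O M cs (initCfg M x))
      short = All.zip (All.map (λ h → ≤-pred (<-≤-trans (≤-<-trans (≤-trans h l) (time< eq)) wf)) (initQueries-short O M cs x) , q)
      accepted : acc O′ (O w) e x ≡ true
      accepted = accepts-complete {O′}
        (cs , l , subst (λ A → A) (path-agree M cs _ true (All.map (λ (h , m) → agree f h m) short)) p)
      branch : ∀ b → acc O′ b e x ≡ true → (if b then acc O′ true e x else acc O′ false e x) ≡ true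
      branch true  h = h
      branch false h = h

-- Diagonalisation at one length

none : Lang
none _ = false

single : Word → Lang
single w v = does (v ≟ʷ w)

pair : Word → Word → Lang
pair w w′ v = single w v ∨ single w′ v

single-self : ∀ w → single w w ≡ true
single-self w = dec-true (w ≟ʷ w) refl

single-other : ∀ {v w} → v ≢ w → single w v ≡ false
single-other {v} {w} = dec-false (v ≟ʷ w)

pair-otherʳ : ∀ {v w w′} → v ≢ w′ → pair w w′ v ≡ single w v
pair-otherʳ {v} {w} h = trans (cong (single w v ∨_) (single-other h)) (∨-identityʳ _)

pair-otherˡ : ∀ {v w w′} → v ≢ w → pair w w′ v ≡ single w′ v
pair-otherˡ {v} {w} {w′} h = cong (_∨ single w′ v) (single-other h)

xor-cancelʳ : ∀ a b → a xor (b xor b) ≡ a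
xor-cancelʳ false false = refl
xor-cancelʳ false true  = refl
xor-cancelʳ true  false = refl
xor-cancelʳ true  true  = refl

xor-swap : ∀ a b → b xor (a xor b) ≡ a
xor-swap false false = refl
xor-swap false true  = refl
xor-swap true  false = refl
xor-swap true  true  = refl

member-≢ : ∀ {v w : Word} {K} → v ∈ K → w ∉ K → v ≢ w
member-≢ m n refl = n m

filter-≟-split : ∀ (f : Word → Bool) v (X : List Word)
  → length (filter (λ w → f w ≟ᵇ v) X) + length (filter (λ w → f w ≟ᵇ not v) X) ≡ length X
filter-≟-split f v []      = refl
filter-≟-split f v (x ∷ X) with f x | v
... | false | false = cong suc (filter-≟-split f false X)
... | true  | true  = cong suc (filter-≟-split f true X)
... | false | true  = trans (+-suc _ _) (cong suc (filter-≟-split f true X))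
... | true  | false = trans (+-suc _ _) (cong suc (filter-≟-split f false X))

≢⇒≡not : ∀ {a b : Bool} → a ≢ b → a ≡ not b
≢⇒≡not {false} {false} h = ⊥-elim (h refl)
≢⇒≡not {false} {true}  h = refl
≢⇒≡not {true}  {false} h = refl
≢⇒≡not {true}  {true}  h = ⊥-elim (h refl)

not≢ : ∀ {b} → not b ≢ b
not≢ {false} ()
not≢ {true}  ()

-- The bound for `infoList`: B for the closure of the reducer's queries, `B + B * suc T` for the
-- list of `survives`, and B for the closure of a path rerun under the empty choice.
infoBound : ℕ → ℕ
infoBound T = let B = T * suc T in B + ((B + B * suc T) + B)

pairBound : ℕ → ℕ
pairBound q = suc (suc q * q)

-- The first summand serves `independentPair` on the lists of size `infoBound T`. The second serves
-- the majority argument, where up to `suc T + suc T` words each rule out fewer than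
-- `pairBound (suc T)` slot words.
slotBound : ℕ → ℕ
slotBound T = pairBound (infoBound T) + suc ((suc T + suc T) * pairBound (suc T))

-- `XA` and `XB` are to be the slot words of the two tags, `F` the reducer run on `x₀`, and `T` a
-- bound for that run and for the verdicts of `N₁` and `N₂` on its output. Everything up to length
-- `H` is committed by the stage.
module Diagonalise
  (mach : ℕ → Bool → NOTM) (time : ℕ → Word → ℕ) (class : Word → Class)
  (class-bound : ∀ {w e x} → class w ≡ coded e x → suc (time e x * suc (time e x)) ≤ length w)
  (XA XB : List Word) (XA-unique : Unique XA) (XB-unique : Unique XB)
  (T H : ℕ) (T≤H : T ≤ H) (XA-large : slotBound T ≤ length XA) (XB-large : slotBound T ≤ length XB)
  (F N₁ N₂ : NOTM) (x₀ : Word) (csF : List Bool) (csF-short : length csF ≤ T) (clock : Word → ℕ)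
  where

  open Extension mach time class class-bound

  Output : Lang → Word → Set
  Output O u = ∃₂ λ r c → exec O F csF (initCfg F x₀) ≡ inj₂ (r , c) × readWord (Config.work c) ≡ u

  O₀ : Lang
  O₀ = ext none none

  O₁ : Word → Lang
  O₁ w = ext (single w) none

  merged : Word → Word → Lang
  merged w w′ v = O₁ w v xor (O₁ w′ v xor O₀ v)

  O₂ : Word → Word → Lang
  O₂ w w′ = ext (pair w w′) (merged w w′)

  queriesF : Lang → List Word
  queriesF O = queries O F csF (initCfg F x₀)

  queriesF-short : ∀ O → All (λ v → length v ≤ T) (queriesF O)
  queriesF-short O = All.map (λ h → ≤-trans h csF-short) (initQueries-short O F csF x₀)

  output-agree : ∀ {O O′ u} → Agree O O′ (queriesF O) → Output O′ u → Output O u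
  output-agree ag (r , c , eq , h) = r , c , trans (exec-agree F csF _ ag) eq , h

  output-functional : ∀ {O u u′} → Output O u → Output O u′ → u ≡ u′
  output-functional (_ , _ , eq , refl) (_ , _ , eq′ , refl) with trans (sym eq) eq′
  ... | refl = refl

  output? : ∀ O → Dec (∃ (Output O))
  output? O with exec O F csF (initCfg F x₀)
  ... | inj₁ _       = no λ ()
  ... | inj₂ (r , c) = yes (_ , r , c , refl , refl)

  -- A clean second oracle has no violated words in range, so the condition of `closed-agree` on
  -- free values is vacuous and only slot words count.
  clean-agree : ∀ {S d S′ d′ K} → All (λ v → length v ≤ T) K → Closed (ext S d) K → Clean H (ext S′ d′)
    → (∀ {w} → w ∈ K → S w ≡ S′ w) → ∀ {w} → w ∈ K → ext S d w ≡ ext S′ d′ w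
  clean-agree short cl clean slots = closed-agree cl (λ m _ → slots m)
    λ m v → ⊥-elim (clean _ (≤-trans (All.lookup short m) T≤H) v)

  B : ℕ
  B = T * suc T

  pathClosure : ∀ {S d} → Clean H (ext S d) → ∀ O N u cs → length cs ≤ T
    → Σ (List Word) λ K → All (_∈ K) (queries O N cs (initCfg N u)) × length K ≤ B
      × All (λ v → length v ≤ T) K × Closed (ext S d) K
  pathClosure clean O N u cs l with closure clean T (queries O N cs (initCfg N u)) T≤H
    (All.map (λ h → ≤-trans h l) (initQueries-short O N cs u))
  ... | K , sub , len , short , cl =
    K , sub , ≤-trans len (*-monoˡ-≤ (suc T) (≤-trans (length-queries O N cs _) l)) , short , cl

  module DisjointPairs (clean₀ : Clean H O₀) where

    -- Stated for arbitrary S and d so that one argument serves both words of a pair: `merged w w′`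
    -- satisfies the condition on d seen from w and also seen from w′.
    Survives : Word → NOTM → Word → List Bool → List Word → Set
    Survives w N u cs Q = ∀ {w′} → w′ ∉ Q → Clean H (O₁ w′) → ∀ S d
      → (∀ v → v ≢ w′ → S v ≡ single w v) → (∀ v → O₁ w′ v ≡ O₀ v → d v ≡ O₁ w v)
      → AcceptingPath (ext S d) N u cs

    -- K certifies the path under {w}, and K₀ certifies the words of K under the empty choice. If w′
    -- avoids K₀, then {w′} and the empty choice agree on K, so d returns the value under {w} there;
    -- if w′ also avoids K, the slot words in K are unchanged. Then `closed-agree` applies even
    -- where words are violated.
    survives : ∀ w → Clean H (O₁ w) → ∀ N u cs → length cs ≤ T → AcceptingPath (O₁ w) N u cs
      → Σ (List Word) λ Q → length Q ≤ B + B * suc T × Survives w N u cs Q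
    survives w clean N u cs l p with pathClosure clean (O₁ w) N u cs l
    ... | K , sub , len , short , cl with closure clean₀ T K T≤H short
    ... | K₀ , sub₀ , len₀ , short₀ , cl₀ =
      K ++ K₀ ,
      ≤-trans (≤-reflexive (length-++ K)) (+-mono-≤ len (≤-trans len₀ (*-monoˡ-≤ (suc T) len))) ,
      λ {w′} w′∉ clean′ S d hS hd →
        let agree₀ : ∀ {v} → v ∈ K₀ → O₀ v ≡ O₁ w′ v
            agree₀ = clean-agree short₀ cl₀ clean′
              λ m → sym (single-other (member-≢ m (w′∉ ∘ ∈-++⁺ʳ K)))
            agree : ∀ {v} → v ∈ K → O₁ w v ≡ ext S d v
            agree = closed-agree cl (λ {v} m _ → sym (hS v (member-≢ m (w′∉ ∘ ∈-++⁺ˡ))))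
              λ {v} m _ → hd v (sym (agree₀ (All.lookup sub₀ m)))
        in subst (λ A → A) (path-agree N cs _ true (All.map agree sub)) p

    survives-both : ∀ {w w′ N N′ u u′ cs cs′ Q Q′} → Clean H (O₁ w) → Clean H (O₁ w′)
      → Survives w N u cs Q → Survives w′ N′ u′ cs′ Q′ → w′ ∉ Q → w ∉ Q′
      → AcceptingPath (O₂ w w′) N u cs × AcceptingPath (O₂ w w′) N′ u′ cs′
    survives-both {w} {w′} clean clean′ sv sv′ n n′ =
      sv n clean′ (pair w w′) (merged w w′) (λ v → pair-otherʳ)
        (λ v e → trans (cong (λ b → O₁ w v xor (b xor O₀ v)) e) (xor-cancelʳ _ (O₀ v))) ,
      sv′ n′ clean (pair w w′) (merged w w′) (λ v → pair-otherˡ)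
        (λ v e → trans (cong (λ b → b xor (O₁ w′ v xor O₀ v)) e) (xor-swap _ (O₀ v)))

    opaque
      KF : Σ (List Word) λ K → All (_∈ K) (queriesF O₀) × length K ≤ B
           × All (λ v → length v ≤ T) K × Closed O₀ K
      KF = pathClosure clean₀ O₀ F x₀ csF csF-short

    agree-KF : ∀ {w} → Clean H (O₁ w) → w ∉ proj₁ KF → Agree O₀ (O₁ w) (queriesF O₀)
    agree-KF clean w∉ = let _ , sub , _ , short , cl = KF in
      All.map (clean-agree short cl clean λ m → sym (single-other (member-≢ m w∉))) sub

    -- Makes all accepting paths speak about the same input u, whichever w outside `KF` they belong
    -- to; otherwise two of them would not break a promise together.
    output-avoid : ∀ {w u u′} → Clean H (O₁ w) → w ∉ proj₁ KF → Output O₀ u → Output (O₁ w) u′ → u ≡ u′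
    output-avoid clean w∉ out out′ = output-functional out (output-agree (agree-KF clean w∉) out′)

    output-none : ∀ {w} → Clean H (O₁ w) → w ∉ proj₁ KF → ¬ ∃ (Output O₀) → ¬ ∃ (Output (O₁ w))
    output-none clean w∉ no-out (u , out) = no-out (u , output-agree (agree-KF clean w∉) out)

    Rejects : NOTM → Word → Set
    Rejects N w = ∀ u → Output (O₁ w) u → ¬ AcceptsWithin (O₁ w) N (clock u) u

    -- For w in `KF` the reducer may give another output, so nothing is recorded. The closure E of
    -- the same choices under the empty choice serves to tell two paths of a UP machine apart.
    data Info (N : NOTM) (u w : Word) : Set where
      inKF  : w ∈ proj₁ KF → Info N u w
      path : (cs : List Bool) → length cs ≤ clock u → AcceptingPath (O₁ w) N u cs
            → Σ (List Word) (λ Q → length Q ≤ B + B * suc T × Survives w N u cs Q)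
            → (E : List Word) → All (_∈ E) (queries O₀ N cs (initCfg N u)) → length E ≤ B
            → All (λ v → length v ≤ T) E → Closed O₀ E → Info N u w

    -- `KF` belongs to the list in either case, so a word that avoids the list of its partner cannot
    -- itself be `inKF`.
    infoList : ∀ {N u w} → Info N u w → List Word
    infoList (inKF _)                    = proj₁ KF
    infoList (path _ _ _ (Q , _) E _ _ _ _) = proj₁ KF ++ (Q ++ E)

    infoList-KF : ∀ {N u w v} (i : Info N u w) → v ∉ infoList i → v ∉ proj₁ KF
    infoList-KF (inKF _)               n = n
    infoList-KF (path _ _ _ _ _ _ _ _ _) n = n ∘ ∈-++⁺ˡ

    infoList-bound : ∀ {N u w} (i : Info N u w) → length (infoList i) ≤ infoBound T
    infoList-bound (inKF _) = ≤-trans (proj₁ (proj₂ (proj₂ KF))) (m≤m+n B _)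
    infoList-bound (path _ _ _ (Q , q≤ , _) E _ e≤ _ _) = ≤-trans (≤-reflexive (length-++ (proj₁ KF)))
      (+-mono-≤ (proj₁ (proj₂ (proj₂ KF))) (≤-trans (≤-reflexive (length-++ Q)) (+-mono-≤ q≤ e≤)))

    inform : ∀ N {u} → clock u ≤ T → Output O₀ u → ∀ w → Clean H (O₁ w) → Rejects N w ⊎ Info N u w
    inform N {u} cl out w clean with w ∈ʷ? proj₁ KF
    ... | yes m = inj₂ (inKF m)
    ... | no w∉ with acceptsWithin? (O₁ w) N (clock u) u
    ... | no ¬a = inj₁ λ u′ out′ → subst (λ u → ¬ AcceptsWithin (O₁ w) N (clock u) u)
                    (output-avoid clean w∉ out out′) ¬a
    ... | yes (cs , l , p) with pathClosure clean₀ O₀ N u cs (≤-trans l cl)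
    ... | E , sub , len , short , clE =
      inj₂ (path cs l p (survives w clean N u cs (≤-trans l cl) p) E sub len short clE)

    XA-pair : suc (infoBound T) * infoBound T < length XA
    XA-pair = ≤-trans (m≤m+n _ _) XA-large

    XB-pair : suc (infoBound T) * infoBound T < length XB
    XB-pair = ≤-trans (m≤m+n _ _) XB-large

    outsideKF : ∃ λ w → w ∈ XA × w ∉ proj₁ KF
    outsideKF = pigeonhole XA (proj₁ KF) XA-unique
      (≤-<-trans (≤-trans (proj₁ (proj₂ (proj₂ KF))) (m≤m+n B _)) (≤-<-trans (m≤m+n _ _) XA-pair))

    module _ (cleanA : ∀ w → w ∈ XA → Clean H (O₁ w)) where

      -- Without an output under the empty choice, any w outside `KF` defeats the reducer vacuously.
      -- Otherwise, if no single word wins, an independent pair lets a path of `N₁` and a path of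
      -- `N₂` on the common output survive together.
      diagonalNP : (∀ w → w ∈ XB → Clean H (O₁ w)) → (∀ {u} → Output O₀ u → clock u ≤ T)
        → (∃ λ w → w ∈ XA × Rejects N₁ w) ⊎ (∃ λ w → w ∈ XB × Rejects N₂ w)
        ⊎ (∃₂ λ w w′ → ∃ λ u → clock u ≤ T
             × AcceptsWithin (O₂ w w′) N₁ (clock u) u × AcceptsWithin (O₂ w w′) N₂ (clock u) u)
      diagonalNP cleanB bound with output? O₀
      ... | no ¬out = let w , w∈ , w∉ = outsideKF in
        inj₁ (w , w∈ , λ u out → ⊥-elim (output-none (cleanA w w∈) w∉ ¬out (u , out)))
      ... | yes (u , out)
        with findOrAll XA (λ w m → [ (λ r → inj₁ (w , m , r)) , inj₂ ]′ (inform N₁ (bound out) out w (cleanA w m)))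
      ... | inj₁ win = inj₁ win
      ... | inj₂ infoA
        with findOrAll XB (λ w m → [ (λ r → inj₁ (w , m , r)) , inj₂ ]′ (inform N₂ (bound out) out w (cleanB w m)))
      ... | inj₁ win = inj₂ (inj₁ win)
      ... | inj₂ infoB
        with independentPair XA XB (infoBound T) infoList infoList XA-unique XB-unique
               infoList-bound infoList-bound XA-pair XB-pair infoA infoB
      ... | w , w′ , _ , _ , inKF m , b , _ , n′ = ⊥-elim (infoList-KF b n′ m)
      ... | w , w′ , _ , _ , a , inKF m , n , _ = ⊥-elim (infoList-KF a n m)
      ... | w , w′ , w∈ , w′∈ , path cs l p (Q , _ , sv) _ _ _ _ _ , path cs′ l′ p′ (Q′ , _ , sv′) _ _ _ _ _ , n , n′
        with survives-both {w} {w′} {N₁} {N₂} {u} {u} {cs} {cs′} (cleanA w w∈) (cleanB w′ w′∈) sv sv′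
               (n ∘ ∈-++⁺ʳ (proj₁ KF) ∘ ∈-++⁺ˡ) (n′ ∘ ∈-++⁺ʳ (proj₁ KF) ∘ ∈-++⁺ˡ)
      ... | a , a′ = inj₂ (inj₂ (w , w′ , u , bound out , (cs , l , a) , (cs′ , l′ , a′)))

      -- Here the empty choice is a possible win too: it wins if `N₁` accepts without a witness. Its
      -- rejection is also what makes the two surviving paths different.
      diagonalUP : (∀ {u} → Output O₀ u → clock u ≤ T)
        → (∀ u → Output O₀ u → AcceptsWithin O₀ N₁ (clock u) u) ⊎ (∃ λ w → w ∈ XA × Rejects N₁ w)
        ⊎ (∃₂ λ w w′ → ∃ λ u → clock u ≤ T × ∃₂ λ cs cs′ → cs ≢ cs′
             × (length cs ≤ clock u × AcceptingPath (O₂ w w′) N₁ u cs)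
             × (length cs′ ≤ clock u × AcceptingPath (O₂ w w′) N₁ u cs′))
      diagonalUP bound with output? O₀
      ... | no ¬out = inj₁ λ u out → ⊥-elim (¬out (u , out))
      ... | yes (u , out) with acceptsWithin? O₀ N₁ (clock u) u
      ... | yes a = inj₁ λ u′ out′ → subst (λ u → AcceptsWithin O₀ N₁ (clock u) u) (output-functional out out′) a
      ... | no ¬a
        with findOrAll XA (λ w m → [ (λ r → inj₁ (w , m , r)) , inj₂ ]′ (inform N₁ (bound out) out w (cleanA w m)))
      ... | inj₁ win = inj₂ (inj₁ win)
      ... | inj₂ infoA
        with independentPair XA XA (infoBound T) infoList infoList XA-unique XA-unique
               infoList-bound infoList-bound XA-pair XA-pair infoA infoA
      ... | w , w′ , _ , _ , inKF m , b , _ , n′ = ⊥-elim (infoList-KF b n′ m)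
      ... | w , w′ , _ , _ , a , inKF m , n , _ = ⊥-elim (infoList-KF a n m)
      ... | w , w′ , w∈ , w′∈ , path cs l p (Q , _ , sv) E sub _ short clE , path cs′ l′ p′ (Q′ , _ , sv′) _ _ _ _ _ , n , n′
        with survives-both {w} {w′} {N₁} {N₁} {u} {u} {cs} {cs′} (cleanA w w∈) (cleanA w′ w′∈) sv sv′
               (n ∘ ∈-++⁺ʳ (proj₁ KF) ∘ ∈-++⁺ˡ) (n′ ∘ ∈-++⁺ʳ (proj₁ KF) ∘ ∈-++⁺ˡ)
      ... | a , a′ = inj₂ (inj₂ (w , w′ , u , bound out , cs , cs′ , distinct , (l , a) , (l′ , a′)))
        where
        -- cs rejects under O₀, hence under O₁ w′, whereas cs′ accepts there.
        distinct : cs ≢ cs′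
        distinct refl = ¬a (cs , l , subst (λ A → A) (sym (path-agree N₁ cs _ true (All.map
          (clean-agree short clE (cleanA w′ w′∈)
            λ m → sym (single-other (member-≢ m (n ∘ ∈-++⁺ʳ (proj₁ KF) ∘ ∈-++⁺ʳ Q)))) sub))) p′)

  module DisjointCoPairs
    (cleanA : ∀ w → w ∈ XA → Clean H (O₁ w)) (cleanB : ∀ w → w ∈ XB → Clean H (O₁ w))
    (cleanAB : ∀ w w′ → w ∈ XA → w′ ∈ XB → Clean H (ext (pair w w′) none))
    where

    -- A single word of length at most T has a closure of at most `suc T` words, so m slot words on
    -- each side are enough for `independentPair`.
    m : ℕ
    m = pairBound (suc T)

    having : Word → Bool → List Word → List Word
    having z v = filter (λ w → O₁ w z ≟ᵇ v)

    having-value : ∀ {z v w} X → w ∈ having z v X → O₁ w z ≡ v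
    having-value {z} {v} X i = proj₂ (∈-filter⁻ (λ w → O₁ w z ≟ᵇ v) {xs = X} i)

    having-member : ∀ {z v w} X → w ∈ having z v X → w ∈ X
    having-member {z} {v} X i = proj₁ (∈-filter⁻ (λ w → O₁ w z ≟ᵇ v) {xs = X} i)

    having-other : ∀ {z v w} X → w ∈ X → w ∉ having z (not v) X → O₁ w z ≡ v
    having-other {z} {v} {w} X i n with O₁ w z ≟ᵇ v
    ... | yes e = e
    ... | no ¬e = ⊥-elim (n (∈-filter⁺ (λ w → O₁ w z ≟ᵇ not v) i (≢⇒≡not ¬e)))

    -- z has one value under {w} for a large part of XA, the other under {w′} for a large part of XB:
    -- an independent pair then has both values under {w , w′}.
    cross : ∀ {z} v → length z ≤ T → m ≤ length (having z v XA) → m ≤ length (having z (not v) XB) → ⊥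
    cross {z} v zT a b
      with independentPair (having z v XA) (having z (not v) XB) (suc T)
             (λ {w} (i : Cl XA w) → proj₁ (proj₂ i)) (λ {w} (i : Cl XB w) → proj₁ (proj₂ i))
             (Unique.filter⁺ _ XA-unique) (Unique.filter⁺ _ XB-unique)
             (λ i → proj₁ (proj₂ (proj₂ (proj₂ i)))) (λ i → proj₁ (proj₂ (proj₂ (proj₂ i)))) a b
             (λ w i → cl XA cleanA (having-member XA i)) (λ w i → cl XB cleanB (having-member XB i))
      where
      Cl : List Word → Word → Set
      Cl X w = w ∈ X × Σ (List Word) λ K → z ∈ K × length K ≤ suc T × All (λ v → length v ≤ T) K × Closed (O₁ w) K
      cl : ∀ X → (∀ w → w ∈ X → Clean H (O₁ w)) → ∀ {w} → w ∈ X → Cl X w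
      cl X clean {w} i with closureWord (clean w i) (length z) z ≤-refl (≤-trans zT T≤H)
      ... | K , z∈ , len , short , c =
        i , K , z∈ , ≤-trans len (s≤s zT) , All.map (λ h → ≤-trans h zT) short , c
    ... | w , w′ , i , i′ , (w∈ , K , z∈ , _ , short , c) , (w′∈ , K′ , z∈′ , _ , short′ , c′) , n , n′ =
      not≢ (trans (sym (having-value XB i′)) (trans (trans eq′ (sym eq)) (having-value XA i)))
      where
      eq : O₁ w z ≡ ext (pair w w′) none z
      eq = clean-agree short c (cleanAB w w′ w∈ w′∈) (λ k → sym (pair-otherʳ (member-≢ k n))) z∈
      eq′ : O₁ w′ z ≡ ext (pair w w′) none z
      eq′ = clean-agree short′ c′ (cleanAB w w′ w∈ w′∈) (λ k → sym (pair-otherˡ (member-≢ k n′))) z∈′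

    opaque
      large? : ∀ z → Dec (m ≤ length (having z true XB))
      large? z = m ≤? length (having z true XB)

    -- It suffices to count over `XB`: by `cross` a value frequent there leaves few words of `XA`
    -- with the opposite value.
    majority : Lang
    majority z = does (large? z)

    O⊘ : Lang
    O⊘ = ext none majority

    Most : Word → Bool → Set
    Most z v = length (having z (not v) XA) < m × length (having z (not v) XB) < m

    XA-avoid : (suc T + suc T) * m < length XA
    XA-avoid = ≤-trans (m≤n+m _ (pairBound (infoBound T))) XA-large

    XB-avoid : (suc T + suc T) * m < length XB
    XB-avoid = ≤-trans (m≤n+m _ (pairBound (infoBound T))) XB-large

    2m≤ : m + m ≤ (suc T + suc T) * m
    2m≤ = ≤-trans (≤-reflexive (cong (m +_) (sym (+-identityʳ m)))) (*-monoˡ-≤ m (s≤s (≤-trans (s≤s z≤n) (m≤n+m (suc T) T))))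

    other-large : ∀ {z} v X → m + m ≤ length X → length (having z v X) < m → m ≤ length (having z (not v) X)
    other-large {z} v X large small with m ≤? length (having z (not v) X)
    ... | yes h = h
    ... | no ¬h = ⊥-elim (<-irrefl refl (≤-<-trans large
      (≤-<-trans (≤-reflexive (sym (filter-≟-split (λ w → O₁ w z) v X))) (+-mono-< small (≰⇒> ¬h)))))

    -- A value that is rare in one set has a frequent opposite there, and `cross` then makes the
    -- same value rare in the other set.
    most-majority : ∀ z → length z ≤ T → Most z (majority z)
    most-majority z zT with large? z
    ... | yes h = A-small , B-small
      where
      A-small : length (having z false XA) < m
      A-small = ≰⇒> λ a → cross false zT a h
      B-small : length (having z false XB) < m
      B-small = ≰⇒> λ b → cross true zT (other-large false XA (≤-trans 2m≤ (<⇒≤ XA-avoid)) A-small) b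
    ... | no ¬h = A-small , ≰⇒> ¬h
      where
      A-small : length (having z true XA) < m
      A-small = ≰⇒> λ a → cross true zT a (other-large true XB (≤-trans 2m≤ (<⇒≤ XB-avoid)) (≰⇒> ¬h))

    decided : ∀ {S d w e x} b → class w ≡ coded e x → ¬ Violated (ext S d) w
            → acc (ext S d) b e x ≡ true → ext S d w ≡ b
    decided {S} {d} {w} {e} {x} b eq clean a with acc (ext S d) true e x in eq₁ | acc (ext S d) false e x in eq₂ | ext-coded {S} {d} eq
    decided true  eq clean a | true  | false | v = v
    decided false eq clean a | false | true  | v = v
    decided {e = e} {x} b eq clean a | true  | true  | v = ⊥-elim (clean (e , x , eq , trans eq₁ (sym eq₂)))
    decided {e = e} {x} b eq clean a | false | false | v = ⊥-elim (clean (e , x , eq , trans eq₁ (sym eq₂)))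
    decided true  eq clean a | false | true  | v with trans (sym a) eq₁
    ... | ()
    decided false eq clean a | true  | false | v with trans (sym a) eq₂
    ... | ()

    disagreeing : List Word → List Word → List Word
    disagreeing X = concatMap (λ z → having z (not (O⊘ z)) X)

    disagreeing-bound : ∀ X zs → (∀ {z} → z ∈ zs → length (having z (not (O⊘ z)) X) < m)
                      → length (disagreeing X zs) ≤ length zs * m
    disagreeing-bound X zs h = length-concatMap (λ z → having z (not (O⊘ z)) X) m zs (λ i → <⇒≤ (h i))

    agreeing : ∀ X zs {w} → w ∈ X → w ∉ disagreeing X zs → Agree O⊘ (O₁ w) zs
    agreeing X zs i n = All.tabulate λ z∈ →
      sym (having-other X i (λ k → n (∈-concatMap (λ z → having z (not (O⊘ z)) X) zs z∈ k)))

    having-none : ∀ {z v} X → (∀ w → O₁ w z ≡ v) → length (having z (not v) X) < m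
    having-none {z} {v} X h = subst (_< m) (sym (cong length
      (filter-none (λ w → O₁ w z ≟ᵇ not v) (All.tabulate {xs = X} λ {w} _ e → not≢ (trans (sym e) (h w)))))) (s≤s z≤n)

    having-one : ∀ {z} X → Unique X → class z ≡ slot → length (having z true X) < m
    having-one {z} X uX eq = ≰⇒> λ large →
      let w , w∈ , w∉ = pigeonhole (having z true X) (z ∷ []) (Unique.filter⁺ _ uX) (≤-trans (s≤s (s≤s z≤n)) large)
      in true≢false (trans (sym (having-value X w∈)) (trans (ext-slot eq) (single-other (λ e → w∉ (here (sym e))))))
      where
      true≢false : true ≢ false
      true≢false ()

    -- Few words of `XB` disagree with `O⊘` on some query of the accepting path, and few give z a
    -- value other than the majority. A remaining w sees the same accepting path; since {w} is
    -- clean, z has value b under it.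
    majority-forced : ∀ {z e x} b → class z ≡ coded e x → length z ≤ T
      → (∀ {v} → length v < length z → Most v (O⊘ v)) → acc O⊘ b e x ≡ true → majority z ≡ b
    majority-forced {z} {e} {x} b eq zT most a with accepts-sound {O⊘} a
    ... | cs , l , p
      with pigeonhole XB (having z (not (majority z)) XB ++ disagreeing XB qs) XB-unique (≤-<-trans len XB-avoid)
      where
      qs = queries O⊘ (mach e b) cs (initCfg (mach e b) x)
      small : ∀ {v} → v ∈ qs → length (having v (not (O⊘ v)) XB) < m
      small i = proj₂ (most (≤-<-trans (≤-trans (All.lookup (initQueries-short O⊘ (mach e b) cs x) i) l) (time< eq)))
      len : length (having z (not (majority z)) XB ++ disagreeing XB qs) ≤ (suc T + suc T) * m
      len = ≤-trans (≤-reflexive (length-++ (having z (not (majority z)) XB)))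
        (≤-trans (+-mono-≤ (<⇒≤ (proj₂ (most-majority z zT)))
                           (≤-trans (disagreeing-bound XB qs small) (*-monoˡ-≤ m
                             (≤-trans (length-queries O⊘ (mach e b) cs _) (≤-trans l (≤-trans (<⇒≤ (time< eq)) zT))))))
                 (*-monoˡ-≤ m (m≤m+n (suc T) (suc T))))
    ... | w , w∈ , w∉ = trans
      (sym (having-other {z} {majority z} XB w∈ (w∉ ∘ ∈-++⁺ˡ)))
      (decided b eq (cleanB w w∈ z (≤-trans zT T≤H))
        (accepts-complete {O₁ w} (cs , l , subst (λ A → A) (path-agree (mach e b) cs _ true
          (agreeing XB _ w∈ (w∉ ∘ ∈-++⁺ʳ _))) p)))

    O⊘-majority : ∀ {z e x} → class z ≡ coded e x → length z ≤ T
      → (∀ {v} → length v < length z → Most v (O⊘ v)) → O⊘ z ≡ majority z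
    O⊘-majority {z} {e} {x} eq zT most
      with acc O⊘ true e x in eq₁ | acc O⊘ false e x in eq₂ | ext-coded {none} {majority} eq
    ... | true  | true  | v = v
    ... | false | false | v = v
    ... | true  | false | v = trans v (sym (majority-forced true eq zT most eq₁))
    ... | false | true  | v = trans v (sym (majority-forced false eq zT most eq₂))

    -- Induction on the length, because `majority-forced` needs the claim for the queries of z. A
    -- slot word has at most one exception, namely the choice of that word itself.
    most-O⊘ : ∀ f {z} → length z ≤ f → length z ≤ T → Most z (O⊘ z)
    most-O⊘ f {z} zf zT with class z in eq
    ... | fixed b = subst (Most z) (sym (ext-fixed eq))
                      (having-none XA (λ _ → ext-fixed eq) , having-none XB (λ _ → ext-fixed eq))
    ... | slot    = subst (Most z) (sym (ext-slot eq)) (having-one XA XA-unique eq , having-one XB XB-unique eq)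
    most-O⊘ zero    {z} zf zT | coded e x = ⊥-elim (n≮0 (<-≤-trans (time< eq) zf))
    most-O⊘ (suc f) {z} zf zT | coded e x = subst (Most z)
      (sym (O⊘-majority eq zT λ l → most-O⊘ f (≤-pred (<-≤-trans l zf)) (≤-trans (<⇒≤ l) zT)))
      (most-majority z zT)

    -- The `T + T` words are the queries of the reducer and those of one path on its output; every
    -- one of them excludes fewer than m words of X.
    typical : ∀ X → Unique X → (suc T + suc T) * m < length X
      → (∀ {z} → length z ≤ T → length (having z (not (O⊘ z)) X) < m)
      → ∀ zs → All (λ z → length z ≤ T) zs → length zs ≤ T + T → ∃ λ w → w ∈ X × Agree O⊘ (O₁ w) zs
    typical X uX large small zs short len =
      let w , w∈ , w∉ = pigeonhole X (disagreeing X zs) uX (≤-<-trans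
            (≤-trans (disagreeing-bound X zs (λ i → small (All.lookup short i)))
                     (*-monoˡ-≤ m (≤-trans len (+-mono-≤ (n≤1+n T) (n≤1+n T))))) large)
      in w , w∈ , agreeing X zs w∈ w∉

    typicalA : ∀ zs → All (λ z → length z ≤ T) zs → length zs ≤ T + T → ∃ λ w → w ∈ XA × Agree O⊘ (O₁ w) zs
    typicalA = typical XA XA-unique XA-avoid (λ l → proj₁ (most-O⊘ T l l))

    typicalB : ∀ zs → All (λ z → length z ≤ T) zs → length zs ≤ T + T → ∃ λ w → w ∈ XB × Agree O⊘ (O₁ w) zs
    typicalB = typical XB XB-unique XB-avoid (λ l → proj₂ (most-O⊘ T l l))

    Accepts : NOTM → Word → Set
    Accepts N w = ∀ u → Output (O₁ w) u → AcceptsWithin (O₁ w) N (clock u) u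

    queriesF-length : length (queriesF O⊘) ≤ T
    queriesF-length = ≤-trans (length-queries O⊘ F csF _) csF-short

    accept-typically : ∀ X
      → (∀ zs → All (λ z → length z ≤ T) zs → length zs ≤ T + T → ∃ λ w → w ∈ X × Agree O⊘ (O₁ w) zs)
      → ∀ N {u} → Output O⊘ u → clock u ≤ T → AcceptsWithin O⊘ N (clock u) u → ∃ λ w → w ∈ X × Accepts N w
    accept-typically X choose N {u} out cl (cs , l , p)
      with choose (queriesF O⊘ ++ queries O⊘ N cs (initCfg N u))
             (++⁺ (queriesF-short O⊘) (All.map (λ h → ≤-trans h (≤-trans l cl)) (initQueries-short O⊘ N cs u)))
             (≤-trans (≤-reflexive (length-++ (queriesF O⊘)))
                (+-mono-≤ queriesF-length (≤-trans (length-queries O⊘ N cs _) (≤-trans l cl))))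
    ... | w , w∈ , ag = w , w∈ , λ u′ out′ →
      subst (λ u → AcceptsWithin (O₁ w) N (clock u) u)
        (output-functional out (output-agree (++⁻ˡ (queriesF O⊘) ag) out′))
        (cs , l , subst (λ A → A) (path-agree N cs _ true (++⁻ʳ (queriesF O⊘) ag)) p)

    -- The tags cross over: the machines accept the complements of the pair, so an accepting `N₁`
    -- refutes the reduction where no witness of the first tag exists, that is, under a single word
    -- of `XB`. If neither machine accepts, the empty choice puts the output into both sets of the
    -- pair.
    diagonalCoNP : (∀ {u} → Output O⊘ u → clock u ≤ T)
      → (∃ λ w → w ∈ XB × Accepts N₁ w) ⊎ (∃ λ w → w ∈ XA × Accepts N₂ w)
      ⊎ (∃ λ u → clock u ≤ T × ¬ AcceptsWithin O⊘ N₁ (clock u) u × ¬ AcceptsWithin O⊘ N₂ (clock u) u)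
    diagonalCoNP bound with output? O⊘
    ... | no ¬out =
      let w , w∈ , ag = typicalB (queriesF O⊘) (queriesF-short O⊘) (≤-trans queriesF-length (m≤m+n T T))
      in inj₁ (w , w∈ , λ u out → ⊥-elim (¬out (u , output-agree ag out)))
    ... | yes (u , out) with acceptsWithin? O⊘ N₁ (clock u) u | acceptsWithin? O⊘ N₂ (clock u) u
    ... | yes a | _     = inj₁ (accept-typically XB typicalB N₁ out (bound out) a)
    ... | no _  | yes a = inj₂ (inj₁ (accept-typically XA typicalA N₂ out (bound out) a))
    ... | no ¬a | no ¬b = inj₂ (inj₂ (u , bound out , ¬a , ¬b))

-- Polynomial bounds

evalP-mono : ∀ p {m n} → m ≤ n → evalP p m ≤ evalP p n
evalP-mono (poly c k) le = +-monoˡ-≤ c (*-monoʳ-≤ c (^-monoˡ-≤ k le))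

PolyBounded : (ℕ → ℕ) → Set
PolyBounded f = Σ Poly λ p → ∀ n → f n ≤ evalP p n

-- The summand 1 is for n = 0, where `0 ^ 0` is 1 but a positive power vanishes.
^≤^+1 : ∀ n i j → n ^ i ≤ n ^ (i + j) + 1
^≤^+1 zero    zero    j = m≤n+m 1 _
^≤^+1 zero    (suc i) j = z≤n
^≤^+1 (suc n) i       j = ≤-trans (^-monoʳ-≤ (suc n) (m≤m+n i j)) (m≤m+n _ 1)

polyBounded-const : ∀ c → PolyBounded (λ _ → c)
polyBounded-const c = poly c 0 , λ n → m≤n+m c (c * 1)

polyBounded-id : PolyBounded (λ n → n)
polyBounded-id = poly 1 1 , λ n → ≤-trans (≤-reflexive (solve 1 (λ n → n := con 1 :* (n :* con 1)) refl n)) (m≤m+n _ 1)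
  where open +-*-Solver

module _ {f g : ℕ → ℕ} where

  polyBounded-+ : PolyBounded f → PolyBounded g → PolyBounded (λ n → f n + g n)
  polyBounded-+ (poly c k , hf) (poly d l , hg) = poly (2 * (c + d)) (k + l) , λ n →
    let N = n ^ (k + l)
        l≤ : n ^ l ≤ N + 1
        l≤ = subst (λ j → n ^ l ≤ n ^ j + 1) (+-comm l k) (^≤^+1 n l k)
    in begin
      f n + g n ≤⟨ +-mono-≤ (hf n) (hg n) ⟩
      (c * n ^ k + c) + (d * n ^ l + d)
        ≤⟨ +-mono-≤ (+-monoˡ-≤ c (*-monoʳ-≤ c (^≤^+1 n k l))) (+-monoˡ-≤ d (*-monoʳ-≤ d l≤)) ⟩
      (c * (N + 1) + c) + (d * (N + 1) + d) ≤⟨ m≤m+n _ ((c + d) * N) ⟩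
      (c * (N + 1) + c) + (d * (N + 1) + d) + (c + d) * N
        ≡⟨ solve 3 (λ c d N → (c :* (N :+ con 1) :+ c) :+ (d :* (N :+ con 1) :+ d) :+ (c :+ d) :* N
                   := (con 2 :* (c :+ d)) :* N :+ con 2 :* (c :+ d)) refl c d N ⟩
      2 * (c + d) * N + 2 * (c + d) ∎
    where open ≤-Reasoning
          open +-*-Solver

  polyBounded-* : PolyBounded f → PolyBounded g → PolyBounded (λ n → f n * g n)
  polyBounded-* (poly c k , hf) (poly d l , hg) = poly (3 * (c * d)) (k + l) , λ n →
    let N = n ^ (k + l)
        l≤ : n ^ l ≤ N + 1
        l≤ = subst (λ j → n ^ l ≤ n ^ j + 1) (+-comm l k) (^≤^+1 n l k)
    in begin
      f n * g n ≤⟨ *-mono-≤ (hf n) (hg n) ⟩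
      (c * n ^ k + c) * (d * n ^ l + d)
        ≡⟨ solve 4 (λ c d a b → (c :* a :+ c) :* (d :* b :+ d) := (c :* d) :* (a :* b :+ a :+ b :+ con 1)) refl c d (n ^ k) (n ^ l) ⟩
      c * d * (n ^ k * n ^ l + n ^ k + n ^ l + 1)
        ≤⟨ *-monoʳ-≤ (c * d) (+-monoˡ-≤ 1 (+-mono-≤ (+-mono-≤ (≤-reflexive (sym (^-distribˡ-+-* n k l))) (^≤^+1 n k l)) l≤)) ⟩
      c * d * (N + (N + 1) + (N + 1) + 1)
        ≡⟨ solve 2 (λ e N → e :* (N :+ (N :+ con 1) :+ (N :+ con 1) :+ con 1)
                          := (con 3 :* e) :* N :+ con 3 :* e) refl (c * d) N ⟩
      3 * (c * d) * N + 3 * (c * d) ∎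
    where open ≤-Reasoning
          open +-*-Solver

polyBounded-^ : ∀ {f} k → PolyBounded f → PolyBounded (λ n → f n ^ k)
polyBounded-^ zero    h = polyBounded-const 1
polyBounded-^ (suc k) h = polyBounded-* h (polyBounded-^ k h)

polyBounded-evalP : ∀ {f} p → PolyBounded f → PolyBounded (λ n → evalP p (f n))
polyBounded-evalP (poly c k) h =
  polyBounded-+ (polyBounded-* (polyBounded-const c) (polyBounded-^ k h)) (polyBounded-const c)

n<2^n : ∀ n → n < 2 ^ n
n<2^n zero    = s≤s z≤n
n<2^n (suc n) = ≤-trans (+-mono-≤ (m^n>0 2 n) (n<2^n n)) (≤-reflexive (cong (2 ^ n +_) (sym (+-identityʳ _))))

-- At n = 2^(2K) a polynomial bound c·n^k + c ≤ 2^(c + 1 + 2Kk) stays below 2^n as soon as k + c < K.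
polyBounded-<2^ : ∀ {f} → PolyBounded f → ∀ L → ∃ λ n → L ≤ n × f n ≤ 2 ^ n
polyBounded-<2^ {f} (poly c k , h) L = n , L≤n , ≤-trans (h n) fn
  where
  open ≤-Reasoning
  open +-*-Solver
  K j s n : ℕ
  j = k + c + L
  K = suc j
  s = K + K
  n = 2 ^ s
  K≤ : K ≤ 2 ^ K
  K≤ = <⇒≤ (n<2^n K)
  L≤n : L ≤ n
  L≤n = ≤-trans (m≤n+m L (k + c)) (≤-trans (n≤1+n j) (≤-trans (m≤m+n K K) (<⇒≤ (n<2^n s))))
  2K≤ : s ≤ 2 ^ K
  2K≤ = ≤-trans (+-mono-≤ (n<2^n j) (n<2^n j)) (≤-reflexive (cong (2 ^ j +_) (sym (+-identityʳ _))))
  exponent : c + (s * k + 1) ≤ n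
  exponent = begin
    c + (s * k + 1) ≡⟨ solve 2 (λ c a → c :+ (a :+ con 1) := (con 1 :+ c) :+ a) refl c (s * k) ⟩
    suc c + s * k ≤⟨ +-monoˡ-≤ (s * k) (≤-trans (s≤s (m≤m+n c L)) (m≤n*m (suc (c + L)) s)) ⟩
    s * suc (c + L) + s * k ≡⟨ solve 4 (λ s k c L → s :* (con 1 :+ (c :+ L)) :+ s :* k := s :* (con 1 :+ (k :+ c :+ L))) refl s k c L ⟩
    s * K ≤⟨ *-mono-≤ 2K≤ K≤ ⟩
    2 ^ K * 2 ^ K ≡⟨ sym (^-distribˡ-+-* 2 K K) ⟩
    n ∎
  fn : c * n ^ k + c ≤ 2 ^ n
  fn = begin
    c * n ^ k + c ≡⟨ solve 2 (λ c a → c :* a :+ c := c :* (a :+ con 1)) refl c (n ^ k) ⟩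
    c * (n ^ k + 1) ≤⟨ *-mono-≤ (<⇒≤ (n<2^n c)) (+-monoʳ-≤ (n ^ k) (m^n>0 n {{m^n≢0 2 s}} k)) ⟩
    2 ^ c * (n ^ k + n ^ k) ≡⟨ cong (2 ^ c *_) (cong (λ a → a + a) (^-*-assoc 2 s k)) ⟩
    2 ^ c * (2 ^ (s * k) + 2 ^ (s * k)) ≡⟨ cong (2 ^ c *_) (solve 1 (λ a → a :+ a := a :* con 2) refl (2 ^ (s * k))) ⟩
    2 ^ c * (2 ^ (s * k) * 2 ^ 1) ≡⟨ cong (2 ^ c *_) (sym (^-distribˡ-+-* 2 (s * k) 1)) ⟩
    2 ^ c * 2 ^ (s * k + 1) ≡⟨ sym (^-distribˡ-+-* 2 c (s * k + 1)) ⟩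
    2 ^ (c + (s * k + 1)) ≤⟨ ^-monoʳ-≤ 2 exponent ⟩
    2 ^ n ∎

-- Enumerating machines

-- One step of Cantor's walk along the antidiagonals.
next : ℕ × ℕ → ℕ × ℕ
next (zero  , b) = suc b , zero
next (suc a , b) = a , suc b

unpair : ℕ → ℕ × ℕ
unpair zero    = zero , zero
unpair (suc n) = next (unpair n)

unpair-surjective : ∀ s b a → a + b ≡ s → ∃ λ n → unpair n ≡ (a , b)
unpair-surjective s       (suc b) a       eq with unpair-surjective s b (suc a) (trans (sym (+-suc a b)) eq)
... | n , e = suc n , cong next e
unpair-surjective s       zero    zero    eq = zero , refl
unpair-surjective (suc s) zero    (suc a) eq with unpair-surjective s a zero (suc-injective (trans (cong suc (sym (+-identityʳ a))) eq))
... | n , e = suc n , cong next e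

π₁ π₂ : ℕ → ℕ
π₁ n = proj₁ (unpair n)
π₂ n = proj₂ (unpair n)

opaque
  code : ℕ → ℕ → ℕ
  code a b = proj₁ (unpair-surjective (a + b) b a refl)

  π₁-code : ∀ a b → π₁ (code a b) ≡ a
  π₁-code a b = cong proj₁ (proj₂ (unpair-surjective (a + b) b a refl))

  π₂-code : ∀ a b → π₂ (code a b) ≡ b
  π₂-code a b = cong proj₂ (proj₂ (unpair-surjective (a + b) b a refl))

-- Relative to a relation because, without function extensionality, a decoded transition table
-- matches a given one only pointwise.
Surjective : {A : Set} → (A → A → Set) → (ℕ → A) → Set
Surjective _≈_ dec = ∀ a → ∃ λ n → dec n ≈ a

decFin : ∀ s → ℕ → Fin (suc s)
decFin zero    _       = zero
decFin (suc s) zero    = zero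
decFin (suc s) (suc n) = suc (decFin s n)

decFin-surjective : ∀ s → Surjective _≡_ (decFin s)
decFin-surjective s i = toℕ i , invert s i
  where
  invert : ∀ s (i : Fin (suc s)) → decFin s (toℕ i) ≡ i
  invert zero    zero    = refl
  invert (suc s) zero    = refl
  invert (suc s) (suc i) = cong suc (invert s i)

decBool : ℕ → Bool
decBool zero    = false
decBool (suc _) = true

decBool-surjective : Surjective _≡_ decBool
decBool-surjective false = 0 , refl
decBool-surjective true  = 1 , refl

decSym : ℕ → Sym
decSym 0 = s0
decSym 1 = s1
decSym _ = blank

decSym-surjective : Surjective _≡_ decSym
decSym-surjective s0    = 0 , refl
decSym-surjective s1    = 1 , refl
decSym-surjective blank = 2 , refl

decMove : ℕ → Move
decMove 0 = left
decMove 1 = right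
decMove _ = stay

decMove-surjective : Surjective _≡_ decMove
decMove-surjective left  = 0 , refl
decMove-surjective right = 1 , refl
decMove-surjective stay  = 2 , refl

decPair : ∀ {A B : Set} → (ℕ → A) → (ℕ → B) → ℕ → A × B
decPair f g n = f (π₁ n) , g (π₂ n)

decPair-surjective : ∀ {A B : Set} {f : ℕ → A} {g : ℕ → B} → Surjective _≡_ f → Surjective _≡_ g
                   → Surjective _≡_ (decPair f g)
decPair-surjective {f = f} {g} hf hg (a , b) with hf a | hg b
... | m , refl | n , refl = code m n , cong₂ _,_ (cong f (π₁-code m n)) (cong g (π₂-code m n))

mkAction : ∀ {Q : Set} → ℕ → (Q × Q) × (Sym × Move) × (Sym × Move) × Bool → Action Q
mkAction 0 ((q , _) , (a , m) , (a′ , m′) , _) = go q a m a′ m′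
mkAction 1 ((q , q′) , _)                      = ask q q′
mkAction _ (_ , _ , _ , b)                     = halt b

decFields : ∀ s → ℕ → (Fin (suc s) × Fin (suc s)) × (Sym × Move) × (Sym × Move) × Bool
decFields s = decPair (decPair (decFin s) (decFin s))
  (decPair (decPair decSym decMove) (decPair (decPair decSym decMove) decBool))

decAction : ∀ s → ℕ → Action (Fin (suc s))
decAction s n = mkAction (π₁ n) (decFields s (π₂ n))

decAction-surjective : ∀ s → Surjective _≡_ (decAction s)
decAction-surjective s a = let t , v , eq = encode a ; n , e = fields v in
  code t n , trans (cong₂ (λ i j → mkAction i (decFields s j)) (π₁-code t n) (π₂-code t n))
                   (trans (cong (mkAction t) e) eq)
  where
  fields = decPair-surjective (decPair-surjective (decFin-surjective s) (decFin-surjective s))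
    (decPair-surjective (decPair-surjective decSym-surjective decMove-surjective)
      (decPair-surjective (decPair-surjective decSym-surjective decMove-surjective) decBool-surjective))
  encode : (a : Action (Fin (suc s))) → ∃₂ λ t v → mkAction t v ≡ a
  encode (go q a m a′ m′) = 0 , ((q , q) , (a , m) , (a′ , m′) , false) , refl
  encode (ask q q′)       = 1 , ((q , q′) , (s0 , stay) , (s0 , stay) , false) , refl
  encode (halt b)         = 2 , ((zero , zero) , (s0 , stay) , (s0 , stay) , b) , refl

module _ {A : Set} (dec : ℕ → A) where

  decFun : ∀ k → ℕ → Fin k → A
  decFun (suc k) n zero    = dec (π₁ n)
  decFun (suc k) n (suc i) = decFun k (π₂ n) i

  decFun-surjective : (_≈_ : A → A → Set) → Surjective _≈_ dec → ∀ k → Surjective (λ f g → ∀ i → f i ≈ g i) (decFun k)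
  decFun-surjective _≈_ surj zero    f = 0 , λ ()
  decFun-surjective _≈_ surj (suc k) f with surj (f zero) | decFun-surjective _≈_ surj k (λ i → f (suc i))
  ... | m , e | n , h = code m n , λ
    { zero    → subst (λ j → dec j ≈ f zero) (sym (π₁-code m n)) e
    ; (suc i) → subst (λ j → decFun k j i ≈ f (suc i)) (sym (π₂-code m n)) (h i) }

  decBoolFun : ℕ → Bool → A
  decBoolFun n false = dec (π₁ n)
  decBoolFun n true  = dec (π₂ n)

  decBoolFun-surjective : (_≈_ : A → A → Set) → Surjective _≈_ dec → Surjective (λ f g → ∀ i → f i ≈ g i) decBoolFun
  decBoolFun-surjective _≈_ surj f with surj (f false) | surj (f true)
  ... | m , e | n , e′ = code m n , λ
    { false → subst (λ j → dec j ≈ f false) (sym (π₁-code m n)) e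
    ; true  → subst (λ j → dec j ≈ f true) (sym (π₂-code m n)) e′ }

  decSymFun : ℕ → Sym → A
  decSymFun n s0    = dec (π₁ n)
  decSymFun n s1    = dec (π₁ (π₂ n))
  decSymFun n blank = dec (π₂ (π₂ n))

  decSymFun-surjective : (_≈_ : A → A → Set) → Surjective _≈_ dec → Surjective (λ f g → ∀ i → f i ≈ g i) decSymFun
  decSymFun-surjective _≈_ surj f with surj (f s0) | surj (f s1) | surj (f blank)
  ... | l , e | m , e′ | n , e″ = code l (code m n) , λ
    { s0    → subst (λ j → dec j ≈ f s0) (sym (π₁-code l _)) e
    ; s1    → subst (λ j → dec j ≈ f s1) (sym (trans (cong π₁ (π₂-code l _)) (π₁-code m n))) e′
    ; blank → subst (λ j → dec j ≈ f blank) (sym (trans (cong π₂ (π₂-code l _)) (π₂-code m n))) e″ }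

data _≈ᴺ_ : NOTM → NOTM → Set where
  pointwise : ∀ {s q δ δ′} → (∀ p a b c → δ p a b c ≡ δ′ p a b c)
       → record { states = s ; start = q ; δ = δ } ≈ᴺ record { states = s ; start = q ; δ = δ′ }

data _≈ᴰ_ : DOTM → DOTM → Set where
  pointwise : ∀ {s q δ δ′} → (∀ p a b → δ p a b ≡ δ′ p a b)
       → record { states = s ; start = q ; δ = δ } ≈ᴰ record { states = s ; start = q ; δ = δ′ }

module _ (s : ℕ) where

  decRowᴺ : ℕ → Sym → Sym → Bool → Action (Fin (suc s))
  decRowᴺ = decSymFun (decSymFun (decBoolFun (decAction s)))

  decδᴺ : ℕ → Fin (suc s) → Sym → Sym → Bool → Action (Fin (suc s))
  decδᴺ = decFun decRowᴺ (suc s)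

  decδᴺ-surjective : ∀ δ → ∃ λ n → ∀ p a b c → decδᴺ n p a b c ≡ δ p a b c
  decδᴺ-surjective = decFun-surjective decRowᴺ (λ f g → ∀ a b c → f a b c ≡ g a b c)
    (decSymFun-surjective _ (λ f g → ∀ b c → f b c ≡ g b c)
      (decSymFun-surjective _ (λ f g → ∀ c → f c ≡ g c)
        (decBoolFun-surjective _ _≡_ (decAction-surjective s)))) (suc s)

  decRowᴰ : ℕ → Sym → Sym → Action (Fin (suc s))
  decRowᴰ = decSymFun (decSymFun (decAction s))

  decδᴰ : ℕ → Fin (suc s) → Sym → Sym → Action (Fin (suc s))
  decδᴰ = decFun decRowᴰ (suc s)

  decδᴰ-surjective : ∀ δ → ∃ λ n → ∀ p a b → decδᴰ n p a b ≡ δ p a b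
  decδᴰ-surjective = decFun-surjective decRowᴰ (λ f g → ∀ a b → f a b ≡ g a b)
    (decSymFun-surjective _ (λ f g → ∀ b → f b ≡ g b)
      (decSymFun-surjective _ _≡_ (decAction-surjective s))) (suc s)

mkNOTM : ℕ → ℕ → ℕ → NOTM
mkNOTM s q d = record { states = suc s ; start = decFin s q ; δ = decδᴺ s d }

mkDOTM : ℕ → ℕ → ℕ → DOTM
mkDOTM s q d = record { states = suc s ; start = decFin s q ; δ = decδᴰ s d }

decNOTM : ℕ → NOTM
decNOTM n = mkNOTM (π₁ n) (π₁ (π₂ n)) (π₂ (π₂ n))

decDOTM : ℕ → DOTM
decDOTM n = mkDOTM (π₁ n) (π₁ (π₂ n)) (π₂ (π₂ n))

module _ (P : ℕ → ℕ → ℕ → Set) where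

  code₃ : ∀ {a b c} → P a b c → ∃ λ n → P (π₁ n) (π₁ (π₂ n)) (π₂ (π₂ n))
  code₃ {a} {b} {c} p = code a (code b c) , subst (λ { (i , j , k) → P i j k })
    (sym (cong₂ _,_ (π₁-code a _) (cong₂ _,_ (trans (cong π₁ (π₂-code a _)) (π₁-code b c))
                                             (trans (cong π₂ (π₂-code a _)) (π₂-code b c))))) p

decNOTM-surjective : Surjective _≈ᴺ_ decNOTM
decNOTM-surjective M@(record { states = suc s ; start = q ; δ = δ }) =
  let d , h = decδᴺ-surjective s δ in
  code₃ (λ i j k → mkNOTM i j k ≈ᴺ M) (subst (λ q′ → record { states = suc s ; start = q′ ; δ = decδᴺ s d } ≈ᴺ M)
    (sym (proj₂ (decFin-surjective s q))) (pointwise h))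

decDOTM-surjective : Surjective _≈ᴰ_ decDOTM
decDOTM-surjective M@(record { states = suc s ; start = q ; δ = δ }) =
  let d , h = decδᴰ-surjective s δ in
  code₃ (λ i j k → mkDOTM i j k ≈ᴰ M) (subst (λ q′ → record { states = suc s ; start = q′ ; δ = decδᴰ s d } ≈ᴰ M)
    (sym (proj₂ (decFin-surjective s q))) (pointwise h))

decPoly : ℕ → Poly
decPoly n = poly (π₁ n) (π₂ n)

decPoly-surjective : Surjective _≡_ decPoly
decPoly-surjective (poly c k) = code c k , cong₂ poly (π₁-code c k) (π₂-code c k)

step-≗ : ∀ O {s q δ δ′} → (∀ p a b c → δ p a b c ≡ δ′ p a b c) → ∀ b c
       → step O (record { states = s ; start = q ; δ = δ }) b c ≡ step O (record { states = s ; start = q ; δ = δ′ }) b c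
step-≗ O {δ = δ} {δ′} h b (cfg p w t)
  with δ p (Tape.hd w) (Tape.hd t) b | δ′ p (Tape.hd w) (Tape.hd t) b | h p (Tape.hd w) (Tape.hd t) b
... | go _ _ _ _ _ | _ | refl = refl
... | ask _ _      | _ | refl = refl
... | halt _       | _ | refl = refl

path-≗     : ∀ O {s q δ δ′} → (∀ p a b c → δ p a b c ≡ δ′ p a b c) → ∀ cs c r
           → pathResult O (record { states = s ; start = q ; δ = δ }) cs c r
           ≡ pathResult O (record { states = s ; start = q ; δ = δ′ }) cs c r
pathStep-≗ : ∀ O {s q δ δ′} → (∀ p a b c → δ p a b c ≡ δ′ p a b c) → ∀ cs x r
           → pathResultStep O (record { states = s ; start = q ; δ = δ }) cs x r
           ≡ pathResultStep O (record { states = s ; start = q ; δ = δ′ }) cs x r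
path-≗ O h []       c r = refl
path-≗ O {s} {q} {δ} {δ′} h (b ∷ bs) c r = trans (pathStep-≗ O h bs _ r)
  (cong (λ x → pathResultStep O (record { states = s ; start = q ; δ = δ′ }) bs x r) (step-≗ O {s} {q} h b c))
pathStep-≗ O h []       (inj₁ _) r = refl
pathStep-≗ O h []       (inj₂ _) r = refl
pathStep-≗ O h (b ∷ bs) (inj₁ c) r = path-≗ O h (b ∷ bs) c r
pathStep-≗ O h (b ∷ bs) (inj₂ _) r = refl

acceptingPath-≈ : ∀ {O M M′} → M ≈ᴺ M′ → ∀ x cs → AcceptingPath O M x cs ≡ AcceptingPath O M′ x cs
acceptingPath-≈ {O} (pointwise h) x cs = path-≗ O h cs _ true

exec-≗ : ∀ O {s q δ δ′} → (∀ p a b c → δ p a b c ≡ δ′ p a b c) → ∀ cs c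
       → exec O (record { states = s ; start = q ; δ = δ }) cs c ≡ exec O (record { states = s ; start = q ; δ = δ′ }) cs c
exec-≗ O h []       c = refl
exec-≗ O {s} {q} {δ} {δ′} h (b ∷ bs) c
  with step O (record { states = s ; start = q ; δ = δ }) b c
     | step O (record { states = s ; start = q ; δ = δ′ }) b c | step-≗ O {s} {q} {δ} {δ′} h b c
... | inj₁ c′ | _ | refl = exec-≗ O h bs c′
... | inj₂ _  | _ | refl = refl

dexec-≈ : ∀ {O M M′} → M ≈ᴰ M′ → ∀ t x u
  → (∃₂ λ r c → dexec O M′ t x ≡ inj₂ (r , c) × readWord (Config.work c) ≡ u)
  → ∃₂ λ r c → dexec O M t x ≡ inj₂ (r , c) × readWord (Config.work c) ≡ u
dexec-≈ {O} (pointwise h) t x u (r , c , eq , e) = r , c , trans (exec-≗ O (λ p a b _ → h p a b) (replicate t false) _) eq , e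

-- The stages of the construction

-- Diagonalisation against disjoint NP pairs, UP languages and disjoint coNP pairs.
data Kind : Set where
  np up conp : Kind

record Task : Set where
  constructor mkTask
  field
    kind  : Kind
    N₁ N₂ : NOTM
    clock : Poly

-- Formats of slot words and code words

unary : ℕ → Word → Word
unary k w = replicate k true ++ false ∷ w

unUnary : Word → Maybe (ℕ × Word)
unUnary []          = nothing
unUnary (false ∷ w) = just (0 , w)
unUnary (true ∷ w) with unUnary w
... | nothing      = nothing
... | just (k , v) = just (suc k , v)

unUnary-unary : ∀ k w → unUnary (unary k w) ≡ just (k , w)
unUnary-unary zero    w = refl
unUnary-unary (suc k) w rewrite unUnary-unary k w = refl

length-unary : ∀ k w → length (unary k w) ≡ k + suc (length w)
length-unary zero    w = refl
length-unary (suc k) w = cong suc (length-unary k w)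

data Parsed : Set where
  free      : Bool → ℕ → Word → Parsed
  pad query : ℕ → Word → Parsed
  junk      : Parsed

parseFree : Bool → Maybe (ℕ × Word) → Parsed
parseFree t nothing        = junk
parseFree t (just (e , y)) = free t e y

parseInput : Bool → Maybe (ℕ × Word) → Parsed
parseInput b     nothing        = junk
parseInput false (just (e , v)) = pad e (reverse v)
parseInput true  (just (e , v)) = query e (reverse v)

parsePadded : Bool → Maybe (ℕ × Word) → Parsed
parsePadded b nothing        = junk
parsePadded b (just (_ , v)) = parseInput b (unUnary v)

parse : Word → Parsed
parse []              = junk
parse (_ ∷ [])        = junk
parse (true ∷ t ∷ v)  = parseFree t (unUnary v)
parse (false ∷ b ∷ v) = parsePadded b (unUnary v)

freeWord : Bool → ℕ → Word → Word
freeWord t e y = true ∷ t ∷ unary e y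

-- With b = false it asks whether the padding p is insufficient, with b = true whether x is accepted.
-- The input is reversed because the machine asking copies it backwards.
codeWord : Bool → ℕ → ℕ → Word → Word
codeWord b p e x = false ∷ b ∷ unary p (unary e (reverse x))

parse-freeWord : ∀ t e y → parse (freeWord t e y) ≡ free t e y
parse-freeWord t e y rewrite unUnary-unary e y = refl

parse-pad : ∀ p e x → parse (codeWord false p e x) ≡ pad e x
parse-pad p e x rewrite unUnary-unary p (unary e (reverse x)) | unUnary-unary e (reverse x) | reverse-involutive x = refl

parse-query : ∀ p e x → parse (codeWord true p e x) ≡ query e x
parse-query p e x rewrite unUnary-unary p (unary e (reverse x)) | unUnary-unary e (reverse x) | reverse-involutive x = refl

length-freeWord : ∀ t e y → length (freeWord t e y) ≡ 2 + (e + suc (length y))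
length-freeWord t e y = cong (2 +_) (length-unary e y)

freeWord-injective : ∀ t e {y y′} → freeWord t e y ≡ freeWord t e y′ → y ≡ y′
freeWord-injective t e eq = ∷-injectiveʳ (++-cancelˡ (replicate e true) _ _ (∷-injectiveʳ (∷-injectiveʳ eq)))

freeWord-tag : ∀ e t t′ {y y′} → freeWord t e y ≡ freeWord t′ e y′ → t ≡ t′
freeWord-tag e t t′ eq = ∷-injectiveˡ (∷-injectiveʳ eq)

and-unique : ∀ {y y′} → and y ≡ true → and y′ ≡ true → length y ≡ length y′ → y ≡ y′
and-unique {[]}       {[]}        _ _ _ = refl
and-unique {true ∷ y} {true ∷ y′} p q l = cong (true ∷_) (and-unique p q (suc-injective l))

and-replicate : ∀ n → and (replicate n true) ≡ true
and-replicate zero    = refl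
and-replicate (suc n) = and-replicate n

-- Away from the diagonalisation lengths a conp task keeps the witness 1ⁿ with tag true,
-- so that its two diagonal languages have complements covering all words.
default : Kind → Bool → Word → Bool
default conp true y = and y
default _    _    _ = false

single-true : ∀ v w → single w v ≡ true → v ≡ w
single-true v w h with v ≟ʷ w
... | yes e = e

pair-true : ∀ v w w′ → pair w w′ v ≡ true → v ≡ w ⊎ v ≡ w′
pair-true v w w′ h with v ≟ʷ w | v ≟ʷ w′
... | yes e | _     = inj₁ e
... | no _  | yes e = inj₂ e

pair-left : ∀ w w′ → pair w w′ w ≡ true
pair-left w w′ rewrite single-self w = refl

codeValue-distinct : ∀ {a b d} → a ≢ b → codeValue a b d ≡ a
codeValue-distinct {true}  {false} _  = refl
codeValue-distinct {false} {true}  _  = refl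
codeValue-distinct {true}  {true}  ne = ⊥-elim (ne refl)
codeValue-distinct {false} {false} ne = ⊥-elim (ne refl)

-- The requirements and the invariants of a stage

module Construction
  (task : ℕ → Task) (target : ℕ → ℕ) (reducer : ℕ → DOTM) (budget : ℕ → Poly) where

  mach : ℕ → Bool → NOTM
  mach e true  = Task.N₁ (task e)
  mach e false = Task.N₂ (task e)

  kind : ℕ → Kind
  kind e = Task.kind (task e)

  time : ℕ → Word → ℕ
  time e x = evalP (Task.clock (task e)) (length x)

  required : ℕ → Word → ℕ
  required e x = suc (time e x * suc (time e x))

  Accepts : Lang → Bool → ℕ → Word → Set
  Accepts O b e x = AcceptsWithin O (mach e b) (time e x) x

  Has : Lang → Bool → ℕ → ℕ → Set
  Has O t e n = ∃ λ y → length y ≡ n × O (freeWord t e y) ≡ true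

  UniqueAt : Lang → ℕ → ℕ → Set
  UniqueAt O e n = ∀ t {y y′} → length y ≡ n → length y′ ≡ n
    → O (freeWord t e y) ≡ true → O (freeWord t e y′) ≡ true → y ≡ y′

  LegalFor : Kind → Lang → ℕ → ℕ → Set
  LegalFor np   O e n = ¬ (Has O true e n × Has O false e n)
  LegalFor up   O e n = ⊤
  LegalFor conp O e n = Has O true e n ⊎ Has O false e n

  LegalAt : Lang → ℕ → ℕ → Set
  LegalAt O e n = UniqueAt O e n × LegalFor (kind e) O e n

  BrokenFor : Kind → Lang → ℕ → Word → Set
  BrokenFor np   O e u = Accepts O true e u × Accepts O false e u
  BrokenFor up   O e u = ∃₂ λ cs cs′ → cs ≢ cs′
    × (length cs ≤ time e u × AcceptingPath O (mach e true) u cs)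
    × (length cs′ ≤ time e u × AcceptingPath O (mach e true) u cs′)
  BrokenFor conp O e u = ¬ Accepts O true e u × ¬ Accepts O false e u

  Broken : Lang → ℕ → Set
  Broken O e = ∃ (BrokenFor (kind e) O e)

  -- Here u is the image of an input of length n. Each clause contradicts what a reduction promises;
  -- for `conp` the machines accept complements, so the input lies in the set with tag t while u
  -- lies outside its counterpart.
  FailsFor : Kind → Lang → ℕ → ℕ → Word → Set
  FailsFor np   O e n u = ∃ λ t → Has O t e n × ¬ Accepts O t e u
  FailsFor up   O e n u = (Has O true e n × ¬ Accepts O true e u) ⊎ (¬ Has O true e n × Accepts O true e u)
  FailsFor conp O e n u = ∃ λ t → ¬ Has O t e n × Accepts O t e u

  Reduces : Lang → ℕ → ℕ → Word → Set
  Reduces O r n u = ∃₂ λ b c → dexec O (reducer r) (evalP (budget r) n) (replicate n false) ≡ inj₂ (b , c)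
    × readWord (Config.work c) ≡ u

  Met : Lang → ℕ → Set
  Met O r = Broken O (target r) ⊎ (∃ λ n → ∀ u → Reduces O r n u → FailsFor (kind (target r)) O (target r) n u)

  -- What a stage achieves is stated for every oracle with the same words up to H, so later stages
  -- cannot undo it and it passes to the limit.
  Robust : ℕ → Lang → (Lang → Set) → Set
  Robust H O P = ∀ O′ → AgreeUpTo H O O′ → P O′

  accepts-transfer : ∀ {H O O′} → AgreeUpTo H O O′ → ∀ b {e u} → time e u ≤ H → Accepts O b e u → Accepts O′ b e u
  accepts-transfer ag b {e} {u} l = acceptsWithin-agree (mach e b) u λ w h → ag w (≤-trans h l)

  has-transfer : ∀ {H O O′} → AgreeUpTo H O O′ → ∀ {t e n} → 2 + (e + suc n) ≤ H → Has O t e n → Has O′ t e n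
  has-transfer ag {t} {e} l (y , refl , h) =
    y , refl , trans (sym (ag _ (≤-trans (≤-reflexive (length-freeWord t e y)) l))) h

  broken-transfer : ∀ {H O O′} → AgreeUpTo H O O′ → ∀ k {e u} → time e u ≤ H → BrokenFor k O e u → BrokenFor k O′ e u
  broken-transfer ag np   l (a , b) = accepts-transfer ag true l a , accepts-transfer ag false l b
  broken-transfer ag up {e} {u} l (cs , cs′ , ne , (h , p) , (h′ , p′)) = cs , cs′ , ne ,
    (h , acceptingPath-agree (mach e true) u cs ag (≤-trans h l) p) ,
    (h′ , acceptingPath-agree (mach e true) u cs′ ag (≤-trans h′ l) p′)
  broken-transfer ag conp l (a , b) =
    a ∘ accepts-transfer (agreeUpTo-sym ag) true l , b ∘ accepts-transfer (agreeUpTo-sym ag) false l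

  fails-transfer : ∀ {H O O′} → AgreeUpTo H O O′ → ∀ k {e n u} → 2 + (e + suc n) ≤ H → time e u ≤ H
                 → FailsFor k O e n u → FailsFor k O′ e n u
  fails-transfer ag np   l l′ (t , h , a) = t , has-transfer ag l h , a ∘ accepts-transfer (agreeUpTo-sym ag) t l′
  fails-transfer ag up   l l′ (inj₁ (h , a)) = inj₁ (has-transfer ag l h , a ∘ accepts-transfer (agreeUpTo-sym ag) true l′)
  fails-transfer ag up   l l′ (inj₂ (h , a)) = inj₂ (h ∘ has-transfer (agreeUpTo-sym ag) l , accepts-transfer ag true l′ a)
  fails-transfer ag conp l l′ (t , h , a) = t , h ∘ has-transfer (agreeUpTo-sym ag) l , accepts-transfer ag t l′ a

  reduces-transfer : ∀ {H O O′} → AgreeUpTo H O O′ → ∀ {r n u} → evalP (budget r) n ≤ H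
                   → Reduces O′ r n u → Reduces O r n u
  reduces-transfer {O = O} ag {r} {n} l (b , c , eq , h) = b , c , trans (exec-agree (toN (reducer r)) cs _
    (All.map (λ {w} q → ag w (≤-trans q (≤-trans (≤-reflexive (length-replicate (evalP (budget r) n))) l)))
      (initQueries-short O (toN (reducer r)) cs (replicate n false)))) eq , h
    where cs = replicate (evalP (budget r) n) false

  -- base is final on words shorter than lo; killed lists the tasks that are provably not complementary.
  record State : Set where
    constructor state
    field
      base   : Lang
      lo     : ℕ
      stage  : ℕ
      killed : List ℕ

  open State

  -- A kill leaves the requirement pending: it is tried again at a larger length with one active
  -- task fewer.
  data Progress (H : ℕ) (st st′ : State) : Set where
    kills : ∀ {e x} → stage st′ ≡ stage st → killed st′ ≡ e ∷ killed st → e ≤ stage st → e ∉ killed st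
          → Robust H (base st′) (λ O → (Accepts O true e x → Accepts O false e x)
                                       × (Accepts O false e x → Accepts O true e x))
          → Progress H st st′
    meets : stage st′ ≡ suc (stage st) → killed st′ ≡ killed st
          → Robust H (base st′) (λ O → Met O (stage st)) → Progress H st st′

  -- The claims on code words concern only the band of lengths from `lo st` to H, within which the
  -- set of active tasks is constant; `answered` binds the oracle only where the two verdicts
  -- differ.
  record Step (st st′ : State) : Set where
    field
      H        : ℕ
      lo′≡     : lo st′ ≡ suc H
      lo≤H     : lo st ≤ H
      extends  : ∀ w → length w < lo st → base st′ w ≡ base st w
      padded   : ∀ {w e x} → lo st ≤ length w → length w ≤ H → parse w ≡ pad e x
               → base st′ w ≡ does (length w <? required e x) ∨ does (stage st <? e)
      answered : ∀ {w e x} → lo st ≤ length w → length w ≤ H → parse w ≡ query e x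
               → required e x ≤ length w → e ≤ stage st → e ∉ killed st
               → accepts (base st′) (mach e true) (time e x) x ≢ accepts (base st′) (mach e false) (time e x) x
               → base st′ w ≡ accepts (base st′) (mach e true) (time e x) x
      legal    : ∀ {e n} → lo st ≤ 2 + (e + suc n) → 2 + (e + suc n) ≤ H
               → Robust H (base st′) (λ O → LegalAt O e n ⊎ Broken O e)
      progress : Progress H st st′

  -- A single stage

  module Level (st : State) where

    e₀ : ℕ
    e₀ = target (stage st)

    tF : ℕ → ℕ
    tF = evalP (budget (stage st))

    -- The work tape starts with at most `suc n` counted cells and grows by at most one per step, so
    -- `suc n + tF n` bounds the length of the output on which the target machines are run.
    T-of : ℕ → ℕ
    T-of n = tF n + evalP (Task.clock (task e₀)) (suc n + tF n)

    slotBound-poly : PolyBounded (λ n → slotBound (T-of n))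
    slotBound-poly = pb+ (pbPair pbRatio) (pb+ one (pb* (pb+ pbS pbS) (pbPair pbS)))
      where
      pb+ : ∀ {f g} → PolyBounded f → PolyBounded g → PolyBounded (λ n → f n + g n)
      pb+ = polyBounded-+
      pb* : ∀ {f g} → PolyBounded f → PolyBounded g → PolyBounded (λ n → f n * g n)
      pb* = polyBounded-*
      one : PolyBounded (λ _ → 1)
      one = polyBounded-const 1
      pbF : PolyBounded tF
      pbF = budget (stage st) , λ _ → ≤-refl
      pbT : PolyBounded T-of
      pbT = pb+ pbF (polyBounded-evalP (Task.clock (task e₀)) (pb+ (pb+ one polyBounded-id) pbF))
      pbS : PolyBounded (λ n → suc (T-of n))
      pbS = pb+ one pbT
      pbB : PolyBounded (λ n → T-of n * suc (T-of n))
      pbB = pb* pbT pbS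
      pbRatio : PolyBounded (λ n → infoBound (T-of n))
      pbRatio = pb+ pbB (pb+ (pb+ pbB (pb* pbB pbS)) pbB)
      pbPair : ∀ {f} → PolyBounded f → PolyBounded (λ n → pairBound (f n))
      pbPair h = pb+ one (pb* (pb+ one h) h)

    opaque
      chosen : ∃ λ n → lo st ≤ n × slotBound (T-of n) ≤ 2 ^ n
      chosen = polyBounded-<2^ slotBound-poly (lo st)

    n : ℕ
    n = proj₁ chosen

    T H : ℕ
    T = T-of n
    -- The second summand is the length of the slot words, so a stage also commits these.
    H = T + (2 + (e₀ + suc n))

    T≤H : T ≤ H
    T≤H = m≤m+n T _

    slot≤H : 2 + (e₀ + suc n) ≤ H
    slot≤H = m≤n+m _ T

    tF≤H : tF n ≤ H
    tF≤H = ≤-trans (m≤m+n (tF n) _) T≤H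

    lo≤slot : lo st ≤ 2 + (e₀ + suc n)
    lo≤slot = ≤-trans (proj₁ (proj₂ chosen)) (≤-trans (n≤1+n n) (≤-trans (m≤n+m (suc n) e₀) (m≤n+m _ 2)))

    active? : ∀ e x ℓ → Dec (required e x ≤ ℓ × e ≤ stage st × e ∉ killed st)
    active? e x ℓ = (required e x ≤? ℓ) ×-dec ((e ≤? stage st) ×-dec ¬? (e ∈? killed st))

    -- A padding answer is negative exactly when the padding is long enough and the task is already
    -- under consideration. A killed task keeps these answers, but its queries become constant,
    -- which is harmless because its machines are not complementary.
    classParsed : ℕ → Parsed → Class
    classParsed ℓ (free t e y) with (e ≟ e₀) ×-dec (length y ≟ n)
    ... | yes _ = slot
    ... | no _  = fixed (default (kind e) t y)
    classParsed ℓ (pad e x) = fixed (does (ℓ <? required e x) ∨ does (stage st <? e))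
    classParsed ℓ (query e x) with active? e x ℓ
    ... | yes _ = coded e x
    ... | no _  = fixed false
    classParsed ℓ junk = fixed false

    -- Words beyond the horizon receive a class too; the next stage classifies them anew.
    class : Word → Class
    class w with length w <? lo st
    ... | yes _ = fixed (base st w)
    ... | no _  = classParsed (length w) (parse w)

    class-below : ∀ w → length w < lo st → class w ≡ fixed (base st w)
    class-below w l with length w <? lo st
    ... | yes _ = refl
    ... | no ¬l = ⊥-elim (¬l l)

    class-above : ∀ w → lo st ≤ length w → class w ≡ classParsed (length w) (parse w)
    class-above w l with length w <? lo st
    ... | yes l′ = ⊥-elim (<⇒≱ l′ l)
    ... | no _   = refl

    class-slot : ∀ t {y} → length y ≡ n → class (freeWord t e₀ y) ≡ slot
    class-slot t {y} len = trans
      (class-above (freeWord t e₀ y) (subst (lo st ≤_) (sym (trans (length-freeWord t e₀ y) (cong (λ i → 2 + (e₀ + suc i)) len))) lo≤slot))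
      (trans (cong (classParsed _) (parse-freeWord t e₀ y)) (at (length (freeWord t e₀ y))))
      where
      at : ∀ ℓ → classParsed ℓ (free t e₀ y) ≡ slot
      at ℓ with (e₀ ≟ e₀) ×-dec (length y ≟ n)
      ... | yes _ = refl
      ... | no ¬p = ⊥-elim (¬p (refl , len))

    class-default : ∀ t e {y} → lo st ≤ 2 + (e + suc (length y)) → ¬ (e ≡ e₀ × length y ≡ n)
                  → class (freeWord t e y) ≡ fixed (default (kind e) t y)
    class-default t e {y} l ne = trans (class-above (freeWord t e y) (subst (lo st ≤_) (sym (length-freeWord t e y)) l))
      (trans (cong (classParsed _) (parse-freeWord t e y)) (at (length (freeWord t e y))))
      where
      at : ∀ ℓ → classParsed ℓ (free t e y) ≡ fixed (default (kind e) t y)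
      at ℓ with (e ≟ e₀) ×-dec (length y ≟ n)
      ... | yes p = ⊥-elim (ne p)
      ... | no _  = refl

    class-query : ∀ {w e x} → lo st ≤ length w → parse w ≡ query e x
      → required e x ≤ length w → e ≤ stage st → e ∉ killed st → class w ≡ coded e x
    class-query {w} {e} {x} l eq r s k = trans (class-above w l) (trans (cong (classParsed _) eq) at)
      where
      at : classParsed (length w) (query e x) ≡ coded e x
      at with active? e x (length w)
      ... | yes _ = refl
      ... | no ¬p = ⊥-elim (¬p (r , s , k))

    class-active : ∀ {w e x} → class w ≡ coded e x → required e x ≤ length w × e ≤ stage st × e ∉ killed st
    class-active {w} eq with length w <? lo st
    class-active {w} () | yes _
    ... | no _ = parsed (parse w) eq
      where
      parsed : ∀ p {e x} → classParsed (length w) p ≡ coded e x → required e x ≤ length w × e ≤ stage st × e ∉ killed st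
      parsed (free t e y) h with (e ≟ e₀) ×-dec (length y ≟ n)
      parsed (free t e y) () | yes _
      parsed (free t e y) () | no _
      parsed (query e x) h with active? e x (length w)
      parsed (query e x) refl | yes a = a
      parsed (query e x) () | no _

    class-bound : ∀ {w e x} → class w ≡ coded e x → suc (time e x * suc (time e x)) ≤ length w
    class-bound {w} eq = proj₁ (class-active {w} eq)

    XA XB : List Word
    XA = map (freeWord true e₀) (allWords n)
    XB = map (freeWord false e₀) (allWords n)

    X-unique : ∀ t → Unique (map (freeWord t e₀) (allWords n))
    X-unique t = Unique.map⁺ (freeWord-injective t e₀) (allWords-unique n)

    X-large : ∀ t → slotBound T ≤ length (map (freeWord t e₀) (allWords n))
    X-large t = subst (slotBound T ≤_) (sym (trans (length-map _ (allWords n)) (length-allWords n))) (proj₂ (proj₂ chosen))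

    csF-short : length (replicate (tF n) false) ≤ T
    csF-short = subst (_≤ T) (sym (length-replicate (tF n))) (m≤m+n (tF n) _)

    open Extension mach time class class-bound public
    open Diagonalise mach time class class-bound XA XB (X-unique true) (X-unique false) T H T≤H
      (X-large true) (X-large false) (toN (reducer (stage st))) (mach e₀ true) (mach e₀ false)
      (replicate n false) (replicate (tF n) false) csF-short (time e₀) public

    output-time : ∀ {O u} → Output O u → time e₀ u ≤ T
    output-time {O} (b , c , eq , refl) = ≤-trans (evalP-mono (Task.clock (task e₀)) (≤-trans
      (output-short O (toN (reducer (stage st))) (replicate (tF n) false) (replicate n false) eq)
      (≤-reflexive (cong₂ (λ i j → suc i + j) (length-replicate n) (length-replicate (tF n))))))
      (m≤n+m _ (tF n))

    default-legal : ∀ {O e n} → (∀ t {y} → length y ≡ n → O (freeWord t e y) ≡ default (kind e) t y) → LegalAt O e n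
    default-legal {O} {e} {ℓ} h = unique , legal (kind e) h
      where
      value-unique : ∀ k t {y y′} → length y ≡ length y′ → default k t y ≡ true → default k t y′ ≡ true → y ≡ y′
      value-unique conp true l p q = and-unique p q l
      unique : UniqueAt O e ℓ
      unique t l l′ p p′ = value-unique (kind e) t (trans l (sym l′)) (trans (sym (h t l)) p) (trans (sym (h t l′)) p′)
      legal : ∀ k → (∀ t {y} → length y ≡ ℓ → O (freeWord t e y) ≡ default k t y) → LegalFor k O e ℓ
      legal np   h ((y , l , p) , _) with trans (sym (h true l)) p
      ... | ()
      legal up   h = tt
      legal conp h = inj₁ (replicate ℓ true , length-replicate ℓ , trans (h true (length-replicate ℓ)) (and-replicate ℓ))

    record InSlots (S O : Lang) : Set where
      constructor inSlots
      field
        at : ∀ t {y} → length y ≡ n → O (freeWord t e₀ y) ≡ S (freeWord t e₀ y)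

      member : ∀ t {y} → length y ≡ n → O (freeWord t e₀ y) ≡ true → S (freeWord t e₀ y) ≡ true
      member t l p = trans (sym (at t l)) p

    open InSlots

    ext-slots : ∀ {S d O} → AgreeUpTo H (ext S d) O → InSlots S O
    ext-slots ag = inSlots λ t {y} l → trans (sym (ag _ (≤-trans (≤-reflexive (trans (length-freeWord t e₀ y)
      (cong (λ i → 2 + (e₀ + suc i)) l))) slot≤H))) (ext-slot (class-slot t l))

    slotWord : ∀ t {w} → w ∈ map (freeWord t e₀) (allWords n) → ∃ λ y → length y ≡ n × w ≡ freeWord t e₀ y
    slotWord t w∈ with ∈-map⁻ (freeWord t e₀) w∈
    ... | y , y∈ , eq = y , allWords-length n y∈ , eq

    slotWord-any : ∀ {w} → w ∈ XA ++ XB → ∃₂ λ t y → length y ≡ n × w ≡ freeWord t e₀ y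
    slotWord-any w∈ with ∈-++⁻ XA w∈
    ... | inj₁ a = true , slotWord true a
    ... | inj₂ b = false , slotWord false b

    none-has : ∀ {O} t → InSlots none O → ¬ Has O t e₀ n
    none-has t h (y , l , p) with member h t l p
    ... | ()

    single-has : ∀ {O} t {y} → length y ≡ n → InSlots (single (freeWord t e₀ y)) O → Has O t e₀ n
    single-has t {y} l h = y , l , trans (at h t l) (single-self (freeWord t e₀ y))

    single-hasNot : ∀ {O} t t′ {y} → t ≢ t′ → InSlots (single (freeWord t e₀ y)) O → ¬ Has O t′ e₀ n
    single-hasNot t t′ ne h (y′ , l , p) = ne (sym (freeWord-tag e₀ t′ t (single-true _ _ (member h t′ l p))))

    none-unique : ∀ {O} → InSlots none O → UniqueAt O e₀ n
    none-unique h t {y} l _ p _ = ⊥-elim (none-has t h (y , l , p))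

    single-unique : ∀ {O w} → InSlots (single w) O → UniqueAt O e₀ n
    single-unique {w = w} h t l l′ p p′ = freeWord-injective t e₀
      (trans (single-true _ w (member h t l p)) (sym (single-true _ w (member h t l′ p′))))

    pair-unique : ∀ {O a b} → InSlots (pair (freeWord true e₀ a) (freeWord false e₀ b)) O → UniqueAt O e₀ n
    pair-unique {a = a} {b} h t {y} {y′} l l′ p p′
      with pair-true (freeWord t e₀ y) (freeWord true e₀ a) (freeWord false e₀ b) (member h t l p)
         | pair-true (freeWord t e₀ y′) (freeWord true e₀ a) (freeWord false e₀ b) (member h t l′ p′)
    ... | inj₁ q | inj₁ q′ = freeWord-injective t e₀ (trans q (sym q′))
    ... | inj₂ q | inj₂ q′ = freeWord-injective t e₀ (trans q (sym q′))
    ... | inj₁ q | inj₂ q′ with trans (sym (freeWord-tag e₀ t true q)) (freeWord-tag e₀ t false q′)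
    ... | ()
    pair-unique h t l l′ p p′ | inj₂ q | inj₁ q′
      with trans (sym (freeWord-tag e₀ t false q)) (freeWord-tag e₀ t true q′)
    ... | ()

    -- The legal choices among which a kill is sought. For `conp` the empty choice is illegal, as
    -- some tag must have a witness; the pairs of one word of each tag are legal and are what
    -- `cross` needs to be clean.
    family : Kind → List Lang
    family np   = none ∷ map single (XA ++ XB)
    family up   = none ∷ map single (XA ++ XB)
    family conp = map single (XA ++ XB) ++ cartesianProductWith pair XA XB

    single-legal : ∀ k {O w} → w ∈ XA ++ XB → InSlots (single w) O → LegalFor k O e₀ n
    single-legal k w∈ h with slotWord-any w∈
    single-legal np   w∈ h | true  , y , l , refl = λ (_ , b) → single-hasNot true false {y} (λ ()) h b
    single-legal np   w∈ h | false , y , l , refl = λ (a , _) → single-hasNot false true {y} (λ ()) h a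
    single-legal up   w∈ h | _ = tt
    single-legal conp w∈ h | true  , y , l , refl = inj₁ (single-has true l h)
    single-legal conp w∈ h | false , y , l , refl = inj₂ (single-has false l h)

    family-legal : ∀ k {S O} → S ∈ family k → InSlots S O → UniqueAt O e₀ n × LegalFor k O e₀ n
    family-legal np (here refl) h = none-unique h , λ (a , _) → none-has true h a
    family-legal np (there m)   h with ∈-map⁻ single m
    ... | w , w∈ , refl = single-unique h , single-legal np w∈ h
    family-legal up (here refl) h = none-unique h , tt
    family-legal up (there m)   h with ∈-map⁻ single m
    ... | w , w∈ , refl = single-unique h , tt
    family-legal conp m h with ∈-++⁻ (map single (XA ++ XB)) m
    ... | inj₁ m′ with ∈-map⁻ single m′
    ... | w , w∈ , refl = single-unique h , single-legal conp w∈ h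
    family-legal conp m h | inj₂ m′ with ∈-cartesianProductWith⁻ pair XA XB m′
    ... | w , w′ , w∈ , w′∈ , refl with slotWord true w∈ | slotWord false w′∈
    ... | y , l , refl | y′ , l′ , refl =
      pair-unique h , inj₁ (y , l , trans (at h true l) (pair-left (freeWord true e₀ y) (freeWord false e₀ y′)))

    -- Whatever S and d are, the conditions on padding, answers and earlier words hold by the
    -- classification alone. Only legality at the diagonalisation length and progress depend on the
    -- choice.
    extend : ∀ S d stage′ killed′ → Robust H (ext S d) (λ O → LegalAt O e₀ n ⊎ Broken O e₀)
           → Progress H st (state (ext S d) (suc H) stage′ killed′) → Step st (state (ext S d) (suc H) stage′ killed′)
    extend S d stage′ killed′ legal₀ prog = record
      { H        = H
      ; lo′≡     = refl
      ; lo≤H     = ≤-trans lo≤slot slot≤H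
      ; extends  = λ w l → ext-fixed (class-below w l)
      ; padded   = λ {w} l _ eq → ext-fixed (trans (class-above w l) (cong (classParsed _) eq))
      ; answered = λ {w} {e} {x} l _ eq r s k ne → trans (ext-coded {S} {d} (class-query {w} {e} {x} l eq r s k)) (codeValue-distinct ne)
      ; legal    = legal
      ; progress = prog
      }
      where
      legal : ∀ {e ℓ} → lo st ≤ 2 + (e + suc ℓ) → 2 + (e + suc ℓ) ≤ H
            → Robust H (ext S d) (λ O → LegalAt O e ℓ ⊎ Broken O e)
      legal {e} {ℓ} l h O ag with (e ≟ e₀) ×-dec (ℓ ≟ n)
      ... | yes (refl , refl) = legal₀ O ag
      ... | no ¬p = inj₁ (default-legal λ t {y} len → trans
        (sym (ag _ (≤-trans (≤-reflexive (trans (length-freeWord t e y) (cong (λ i → 2 + (e + suc i)) len))) h)))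
        (ext-fixed (class-default t e (subst (λ i → lo st ≤ 2 + (e + suc i)) (sym len) l)
          λ (p , q) → ¬p (p , trans (sym len) q))))

    Outcome : Kind → Set
    Outcome k = ∃₂ λ S d
      → Robust H (ext S d) (λ O → (UniqueAt O e₀ n × LegalFor k O e₀ n) ⊎ ∃ (BrokenFor k O e₀))
      × Robust H (ext S d) (λ O → ∃ (BrokenFor k O e₀) ⊎ (∃ λ n → ∀ u → Reduces O (stage st) n u → FailsFor k O e₀ n u))

    -- The broken promise discharges both duties at once: it excuses the illegal choice and meets
    -- the requirement.
    breaks : ∀ k S d u → time e₀ u ≤ T → BrokenFor k (ext S d) e₀ u → Outcome k
    breaks k S d u l b = S , d ,
      (λ O ag → inj₂ (u , broken-transfer ag k (≤-trans l T≤H) b)) ,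
      (λ O ag → inj₁ (u , broken-transfer ag k (≤-trans l T≤H) b))

    wins : ∀ k S → S ∈ family k
         → (∀ u → Output (ext S none) u → FailsFor k (ext S none) e₀ n u) → Outcome k
    wins k S S∈ f = S , none ,
      (λ O ag → inj₁ (family-legal k S∈ (ext-slots ag))) ,
      (λ O ag → inj₂ (n , λ u red → let out = reduces-transfer ag {stage st} {n} tF≤H red in
        fails-transfer ag k slot≤H (≤-trans (output-time {ext S none} out) T≤H) (f u out)))

    ext-inSlots : ∀ {S d} → InSlots S (ext S d)
    ext-inSlots = ext-slots λ _ _ → refl

    single-hasA : ∀ {w} t → w ∈ map (freeWord t e₀) (allWords n) → Has (ext (single w) none) t e₀ n
    single-hasA t w∈ with slotWord t w∈
    ... | y , l , refl = single-has t l ext-inSlots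

    single-hasNotA : ∀ {w} t t′ → t ≢ t′ → w ∈ map (freeWord t e₀) (allWords n) → ¬ Has (ext (single w) none) t′ e₀ n
    single-hasNotA t t′ ne w∈ with slotWord t w∈
    ... | y , l , refl = single-hasNot t t′ {y} ne ext-inSlots

    diagonal : ∀ k → (∀ {S} → S ∈ family k → Clean H (ext S none)) → Outcome k
    diagonal np clean =
      [ (λ (w , m , rej) → wins np (single w) (there (∈-map⁺ single (∈-++⁺ˡ m)))
          λ u out → true , single-hasA true m , rej u out)
      , [ (λ (w , m , rej) → wins np (single w) (there (∈-map⁺ single (∈-++⁺ʳ XA m)))
            λ u out → false , single-hasA false m , rej u out)
        , (λ (w , w′ , u , l , a , b) → breaks np (pair w w′) (merged w w′) u l (a , b)) ]′ ]′
      (DisjointPairs.diagonalNP (clean (here refl))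
        (λ w m → clean (there (∈-map⁺ single (∈-++⁺ˡ m)))) (λ w m → clean (there (∈-map⁺ single (∈-++⁺ʳ XA m))))
        (output-time {ext none none}))
    diagonal up clean =
      [ (λ acc → wins up none (here refl) λ u out → inj₂ (none-has true ext-inSlots , acc u out))
      , [ (λ (w , m , rej) → wins up (single w) (there (∈-map⁺ single (∈-++⁺ˡ m)))
            λ u out → inj₁ (single-hasA true m , rej u out))
        , (λ (w , w′ , u , l , b) → breaks up (pair w w′) (merged w w′) u l b) ]′ ]′
      (DisjointPairs.diagonalUP (clean (here refl))
        (λ w m → clean (there (∈-map⁺ single (∈-++⁺ˡ m)))) (output-time {ext none none}))
    diagonal conp clean =
      [ (λ (w , m , acc) → wins conp (single w) (∈-++⁺ˡ (∈-map⁺ single (∈-++⁺ʳ XA m)))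
          λ u out → true , single-hasNotA false true (λ ()) m , acc u out)
      , [ (λ (w , m , acc) → wins conp (single w) (∈-++⁺ˡ (∈-map⁺ single (∈-++⁺ˡ m)))
            λ u out → false , single-hasNotA true false (λ ()) m , acc u out)
        , (λ (u , l , b) → breaks conp none majority u l b) ]′ ]′
      (diagonalCoNP output-time)
      where
      open DisjointCoPairs
        (λ w m → clean (∈-++⁺ˡ (∈-map⁺ single (∈-++⁺ˡ m)))) (λ w m → clean (∈-++⁺ˡ (∈-map⁺ single (∈-++⁺ʳ XA m))))
        (λ w w′ m m′ → clean (∈-++⁺ʳ (map single (XA ++ XB)) (∈-cartesianProductWith⁺ pair m m′)))

    Killable : Lang → Set
    Killable S = ∃ λ w → length w ≤ H × Violated (ext S none) w

    -- The clock of the killed task on x is below the length of the violated word, hence below H, so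
    -- the equal verdicts persist in every oracle that agrees up to H.
    kill : ∀ {S} → S ∈ family (kind e₀) → Killable S → Σ State (Step st)
    kill {S} S∈ (w , l , e , x , eq , a) =
      _ , extend S none (stage st) (e ∷ killed st)
        (λ O ag → inj₁ (family-legal (kind e₀) S∈ (ext-slots ag)))
        (kills {e = e} {x} refl refl (proj₁ (proj₂ (class-active {w} eq))) (proj₂ (proj₂ (class-active {w} eq)))
          λ O ag → transfer ag true false a , transfer ag false true (sym a))
      where
      transfer : ∀ {O} → AgreeUpTo H (ext S none) O → ∀ b b′ → acc (ext S none) b e x ≡ acc (ext S none) b′ e x
               → Accepts O b e x → Accepts O b′ e x
      transfer ag b b′ a′ p = accepts-transfer ag b′ short (accepts-sound {ext S none} {mach e b′}
        (trans (sym a′) (accepts-complete {ext S none} {mach e b} (accepts-transfer (agreeUpTo-sym ag) b short p))))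
        where
        short : time e x ≤ H
        short = ≤-trans (<⇒≤ (time< {w} eq)) l

    killable? : Dec (Any Killable (family (kind e₀)))
    killable? = any? (λ S → wordUpTo? H (violated? (ext S none))) (family (kind e₀))

    meet : Outcome (kind e₀) → Σ State (Step st)
    meet (S , d , legal , met) = _ , extend S d (suc (stage st)) (killed st) legal (meets refl refl met)

    advanceBy : Dec (Any Killable (family (kind e₀))) → Σ State (Step st)
    advanceBy (yes found) = kill (proj₁ (proj₂ (find found))) (proj₂ (proj₂ (find found)))
    advanceBy (no ¬found) = meet (diagonal (kind e₀) λ S∈ w l v → ¬found (lose S∈ (w , l , v)))

    opaque
      advance : Σ State (Step st)
      advance = advanceBy killable?

  -- The oracle as the limit of the stages

  states : ℕ → State
  states zero    = state (λ _ → false) 0 0 []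
  states (suc m) = proj₁ (Level.advance (states m))

  stepAt : ∀ m → Step (states m) (states (suc m))
  stepAt m = proj₂ (Level.advance (states m))

  module _ (m : ℕ) where
    open Step (stepAt m) public using () renaming (H to horizon; lo≤H to lo≤horizon; lo′≡ to lo-suc)

  lo-< : ∀ m → lo (states m) < lo (states (suc m))
  lo-< m = subst (lo (states m) <_) (sym (lo-suc m)) (s≤s (lo≤horizon m))

  lo-mono : ∀ k m → lo (states m) ≤ lo (states (k + m))
  lo-mono zero    m = ≤-refl
  lo-mono (suc k) m = ≤-trans (lo-mono k m) (<⇒≤ (lo-< (k + m)))

  m≤lo : ∀ m → m ≤ lo (states m)
  m≤lo zero    = z≤n
  m≤lo (suc m) = ≤-<-trans (m≤lo m) (lo-< m)

  base-stable : ∀ k m w → length w < lo (states m) → base (states (k + m)) w ≡ base (states m) w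
  base-stable zero    m w l = refl
  base-stable (suc k) m w l =
    trans (Step.extends (stepAt (k + m)) w (<-≤-trans l (lo-mono k m))) (base-stable k m w l)

  opaque
    oracle : Lang
    -- By `m≤lo` this state has settled all words as long as w.
    oracle w = base (states (suc (length w))) w

    base-oracle : ∀ m w → length w < lo (states m) → base (states m) w ≡ oracle w
    base-oracle m w l with ≤-total m (suc (length w))
    ... | inj₁ le = trans (sym (base-stable (suc (length w) ∸ m) m w l)) (cong (λ i → base (states i) w) (m∸n+n≡m le))
    ... | inj₂ le = trans (cong (λ i → base (states i) w) (sym (m∸n+n≡m le)))
                          (base-stable (m ∸ suc (length w)) (suc (length w)) w (m≤lo (suc (length w))))

  agree-horizon : ∀ m → AgreeUpTo (horizon m) (base (states (suc m))) oracle
  agree-horizon m w l = base-oracle (suc m) w (subst (length w <_) (sym (lo-suc m)) (s≤s l))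

  levelOf : ∀ L → ∃ λ m → lo (states m) ≤ L × L ≤ horizon m
  levelOf L = search (suc L) (m≤lo (suc L))
    where
    search : ∀ k → L < lo (states k) → ∃ λ m → lo (states m) ≤ L × L ≤ horizon m
    search (suc k) l with L <? lo (states k)
    ... | yes l′ = search k l′
    ... | no ¬l  = k , ≮⇒≥ ¬l , ≤-pred (subst (L <_) (lo-suc k) l)

  oracle-legal : ∀ e n → LegalAt oracle e n ⊎ Broken oracle e
  oracle-legal e n = let m , l , h = levelOf (2 + (e + suc n)) in
    Step.legal (stepAt m) l h oracle (agree-horizon m)

  progressAt : ∀ m → Progress (horizon m) (states m) (states (suc m))
  progressAt m = Step.progress (stepAt m)

  Tidy : State → Set
  Tidy st = Unique (killed st) × All (_≤ stage st) (killed st)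

  tidy : ∀ m → Tidy (states m)
  tidy zero = [] , []
  tidy (suc m) with progressAt m | tidy m
  ... | kills s≡ k≡ e≤ e∉ _ | u , b rewrite s≡ | k≡ =
    All.tabulate (λ { i refl → e∉ i }) ∷ u , e≤ ∷ b
  ... | meets s≡ k≡ _ | u , b rewrite s≡ | k≡ = u , All.map m≤n⇒m≤1+n b

  killed-bound : ∀ m → length (killed (states m)) ≤ suc (stage (states m))
  killed-bound m = ≮⇒≥ λ lt →
    let u , b = tidy m
        e , e∈ , e∉ = pigeonholeᴬ _≟_ (killed (states m)) (upTo (suc (stage (states m)))) u
                        (subst (_< length (killed (states m))) (sym (length-upTo (suc (stage (states m))))) lt)
    in e∉ (∈-upTo⁺ (s≤s (All.lookup b e∈)))

  MeetsAt : ℕ → Set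
  MeetsAt m = stage (states (suc m)) ≡ suc (stage (states m))
    × Robust (horizon m) (base (states (suc m))) (λ O → Met O (stage (states m)))

  -- A kill trades one unit of fuel for one killed task and leaves the stage as it is. When the fuel
  -- is used up, more tasks would be killed than `killed-bound` allows.
  untilMeets : ∀ fuel m → suc (stage (states m)) < fuel + length (killed (states m))
             → ∃ λ m′ → stage (states m′) ≡ stage (states m) × MeetsAt m′
  untilMeets zero m lt = ⊥-elim (<⇒≱ lt (killed-bound m))
  untilMeets (suc fuel) m lt with progressAt m
  ... | meets s≡ _ met = m , refl , s≡ , met
  ... | kills s≡ k≡ _ _ _ =
    let m′ , eq , met = untilMeets fuel (suc m) (subst₂ (λ s k → suc s < fuel + length k) (sym s≡) (sym k≡)
                          (subst (suc (stage (states m)) <_) (sym (+-suc fuel _)) lt))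
    in m′ , trans eq s≡ , met

  meetsStage : ∀ r → ∃ λ m → stage (states m) ≡ r × MeetsAt m
  meetsFrom  : ∀ {r} m → stage (states m) ≡ r → ∃ λ m → stage (states m) ≡ r × MeetsAt m
  meetsFrom m refl = untilMeets (2 + stage (states m)) m (m≤m+n (2 + stage (states m)) _)
  meetsStage zero    = meetsFrom 0 refl
  meetsStage (suc r) = let m , s≡ , next≡ , _ = meetsStage r in meetsFrom (suc m) (trans next≡ (cong suc s≡))

  oracle-met : ∀ r → Met oracle r
  oracle-met r = let m , s≡ , _ , met = meetsStage r in subst (Met oracle) s≡ (met oracle (agree-horizon m))

  stage-mono : ∀ k m → stage (states m) ≤ stage (states (k + m))
  stage-mono zero    m = ≤-refl
  stage-mono (suc k) m with progressAt (k + m)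
  ... | kills s≡ _ _ _ _ = subst (stage (states m) ≤_) (sym s≡) (stage-mono k m)
  ... | meets s≡ _ _     = subst (stage (states m) ≤_) (sym s≡) (m≤n⇒m≤1+n (stage-mono k m))

  -- On every input, the negation of what a kill establishes; hence such a task is never killed.
  Complementary : ℕ → Set
  Complementary e = ∀ x → ¬ ((Accepts oracle true e x → Accepts oracle false e x)
                            × (Accepts oracle false e x → Accepts oracle true e x))

  never-killed : ∀ {e} → Complementary e → ∀ m → e ∉ killed (states m)
  never-killed compl zero    = λ ()
  never-killed {e} compl (suc m) with progressAt m
  ... | kills {x = x} _ k≡ _ _ same = λ i → spared (subst (e ∈_) k≡ i)
    where
    spared : e ∉ _ ∷ killed (states m)
    spared (here refl) = compl x (same oracle (agree-horizon m))
    spared (there i)   = never-killed compl m i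
  ... | meets _ k≡ _ = λ i → never-killed compl m (subst (e ∈_) k≡ i)

  opaque
    -- From this length on, all stages consider task e. For fixed e it is a constant, so it may
    -- enter a polynomial time bound.
    threshold : ℕ → ℕ
    threshold e = lo (states (proj₁ (meetsStage e)))

    threshold-stage : ∀ e m L → threshold e ≤ L → L ≤ horizon m → e ≤ stage (states m)
    threshold-stage e m L t h with meetsStage e
    ... | mₑ , s≡ , _ with mₑ ≤? m
    ... | yes le = subst₂ (λ a b → a ≤ stage (states b)) s≡ (m∸n+n≡m le) (stage-mono (m ∸ mₑ) mₑ)
    ... | no ¬le = ⊥-elim (<⇒≱ (≤-trans (s≤s h) (subst (_≤ _) (lo-suc m)
                     (subst (λ i → lo (states (suc m)) ≤ lo (states i)) (m∸n+n≡m (≰⇒> ¬le)) (lo-mono (mₑ ∸ suc m) (suc m))))) t)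

  pad-sufficient : ∀ {w e x} → parse w ≡ pad e x → required e x ≤ length w → threshold e ≤ length w → oracle w ≡ false
  pad-sufficient {w} {e} {x} eq r t with levelOf (length w)
  ... | m , l , h = trans (sym (agree-horizon m w h)) (trans (Step.padded (stepAt m) l h eq)
    (cong₂ _∨_ (dec-false (length w <? required e x) (≤⇒≯ r))
               (dec-false (stage (states m) <? e) (≤⇒≯ (threshold-stage e m (length w) t h)))))

  -- Two words of the same length are treated by the same stage, so the negative padding answer
  -- certifies the very conditions under which that stage answers the query.
  query-correct : ∀ {w w′ e x} → Complementary e → parse w ≡ pad e x → oracle w ≡ false
    → parse w′ ≡ query e x → length w′ ≡ length w → oracle w′ ≡ accepts oracle (mach e true) (time e x) x
  query-correct {w} {w′} {e} {x} compl eq no-pad eq′ len with levelOf (length w)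
  ... | m , l , h = trans (sym (agree-horizon m w′ h′)) (trans
      (Step.answered (stepAt m) (subst (lo (states m) ≤_) (sym len) l) h′ eq′ (subst (required e x ≤_) (sym len) enough) staged
        (never-killed compl m) distinct)
      (same true))
    where
    O′ : Lang
    O′ = base (states (suc m))
    h′ : length w′ ≤ horizon m
    h′ = subst (_≤ horizon m) (sym len) h
    no-pad′ : does (length w <? required e x) ∨ does (stage (states m) <? e) ≡ false
    no-pad′ = trans (sym (Step.padded (stepAt m) l h eq)) (trans (agree-horizon m w h) no-pad)
    split : ∀ {A B : Set} (a : Dec A) (b : Dec B) → does a ∨ does b ≡ false → ¬ A × ¬ B
    split (no ¬a) (no ¬b) _ = ¬a , ¬b
    enough : required e x ≤ length w
    enough = ≮⇒≥ (proj₁ (split (length w <? required e x) (stage (states m) <? e) no-pad′))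
    staged : e ≤ stage (states m)
    staged = ≮⇒≥ (proj₂ (split (length w <? required e x) (stage (states m) <? e) no-pad′))
    short : time e x ≤ horizon m
    short = ≤-trans (≤-trans (n≤n*suc (time e x)) (≤-trans (n≤1+n _) enough)) h
    same : ∀ b → accepts O′ (mach e b) (time e x) x ≡ accepts oracle (mach e b) (time e x) x
    same b = accepts-agree (mach e b) x λ v s → agree-horizon m v (≤-trans s short)
    distinct : accepts O′ (mach e true) (time e x) x ≢ accepts O′ (mach e false) (time e x) x
    distinct a = compl x (move true false a , move false true (sym a))
      where
      move : ∀ b b′ → accepts O′ (mach e b) (time e x) x ≡ accepts O′ (mach e b′) (time e x) x
           → Accepts oracle b e x → Accepts oracle b′ e x
      move b b′ a p = accepts-sound {oracle} {mach e b′}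
        (trans (sym (same b′)) (trans (sym a) (trans (same b) (accepts-complete {oracle} {mach e b} p))))

-- Machines

readBits-map : ∀ v → readBits (map bit v) ≡ v
readBits-map []          = refl
readBits-map (false ∷ v) = cong (false ∷_) (readBits-map v)
readBits-map (true ∷ v)  = cong (true ∷_) (readBits-map v)

replicate-∷ : ∀ {A : Set} k (a : A) v → replicate k a ++ a ∷ v ≡ a ∷ replicate k a ++ v
replicate-∷ zero    a v = refl
replicate-∷ (suc k) a v = cong (a ∷_) (replicate-∷ k a v)

-- The head stands on the first bit of w; bs lies behind w.
tapeAt : List Sym → Word → List Sym → Tape
tapeAt l []      []       = tape l blank []
tapeAt l []      (b ∷ bs) = tape l b bs
tapeAt l (b ∷ w) bs       = tape l (bit b) (map bit w ++ bs)

moveT-tapeAt : ∀ l b w bs → moveT right (tapeAt l (b ∷ w) bs) ≡ tapeAt (bit b ∷ l) w bs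
moveT-tapeAt l b []      []       = refl
moveT-tapeAt l b []      (_ ∷ bs) = refl
moveT-tapeAt l b (_ ∷ w) bs       = refl

moveT-blank : ∀ w bs → moveT right (tape [] blank (map bit w ++ bs)) ≡ tapeAt (blank ∷ []) w bs
moveT-blank []      []       = refl
moveT-blank []      (_ ∷ _)  = refl
moveT-blank (_ ∷ w) bs       = refl

inputTape-tapeAt : ∀ x → inputTape x ≡ tapeAt [] x []
inputTape-tapeAt []      = refl
inputTape-tapeAt (b ∷ w) = cong (tape [] (bit b)) (sym (++-identityʳ (map bit w)))

module _ {O : Lang} {M : NOTM} where

  private
    C : Set
    C = Config (NOTM.states M)

  path-cons : ∀ {b c c′ cs r} → step O M b c ≡ inj₁ c′ → pathResult O M cs c′ r → pathResult O M (b ∷ cs) c r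
  path-cons {cs = []}    eq ()
  path-cons {cs = _ ∷ _} eq p rewrite eq = p

  path-uncons : ∀ {b c c′ cs r} → step O M b c ≡ inj₁ c′ → pathResult O M (b ∷ cs) c r → pathResult O M cs c′ r
  path-uncons {cs = []}    eq p rewrite eq = p
  path-uncons {cs = _ ∷ _} eq p rewrite eq = p

  path-halt : ∀ {b c c′ cs r r′} → step O M b c ≡ inj₂ (r′ , c′) → pathResult O M (b ∷ cs) c r → r′ ≡ r × cs ≡ []
  path-halt {cs = []}    eq p rewrite eq = p , refl
  path-halt {cs = _ ∷ _} eq p rewrite eq = ⊥-elim p

  -- Machines with unambiguous accepting paths reject on the choice true wherever they do not guess.
  record Forced (c c′ : C) : Set where
    constructor forced
    field
      continues : step O M false c ≡ inj₁ c′
      rejects   : ∃ λ c″ → step O M true c ≡ inj₂ (false , c″)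

  path-forced : ∀ {c c′ cs} → Forced c c′ → pathResult O M cs c true
              → ∃ λ cs′ → cs ≡ false ∷ cs′ × pathResult O M cs′ c′ true
  path-forced {cs = false ∷ cs} (forced eq _) p = cs , refl , path-uncons {cs = cs} eq p
  path-forced {cs = true ∷ cs} (forced _ (_ , eq)) p with path-halt {cs = cs} eq p
  ... | () , _

  path-force : ∀ {c c′ r} cs → Forced c c′ → pathResult O M cs c′ r → pathResult O M (false ∷ cs) c r
  path-force cs (forced eq _) = path-cons {cs = cs} eq

  HaltsIn : ℕ → C → Set
  HaltsIn k c = ∀ cs → k ≤ length cs → Halted (exec O M cs c)

  haltsIn-step : ∀ {k c} → (∀ b → (∃ λ h → step O M b c ≡ inj₂ h) ⊎ (∃ λ c′ → step O M b c ≡ inj₁ c′ × HaltsIn k c′))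
               → HaltsIn (suc k) c
  haltsIn-step f (b ∷ cs) (s≤s l) with f b
  ... | inj₁ (h , eq)       rewrite eq = tt
  ... | inj₂ (c′ , eq , h) rewrite eq = h cs l

  haltsIn-forced : ∀ {k c c′} → Forced c c′ → HaltsIn k c′ → HaltsIn (suc k) c
  haltsIn-forced (forced eq (c″ , eq′)) h = haltsIn-step λ { false → inj₂ (_ , eq , h) ; true → inj₁ (_ , eq′) }

  data _⟶[_]_ : C → ℕ → C → Set where
    done : ∀ {c} → c ⟶[ 0 ] c
    _◅_  : ∀ {c c′ c″ k} → step O M false c ≡ inj₁ c′ → c′ ⟶[ k ] c″ → c ⟶[ suc k ] c″

  infixr 5 _◅_

  ⟶-trans : ∀ {c c′ c″ k l} → c ⟶[ k ] c′ → c′ ⟶[ l ] c″ → c ⟶[ k + l ] c″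
  ⟶-trans done     s = s
  ⟶-trans (e ◅ r) s = e ◅ ⟶-trans r s

  Verdict : ℕ → C → Bool → Set
  Verdict k c r = ∀ t → k ≤ t → ∃ λ c′ → exec O M (replicate t false) c ≡ inj₂ (r , c′)

  verdict-halt : ∀ {c r c′} → step O M false c ≡ inj₂ (r , c′) → Verdict 1 c r
  verdict-halt eq (suc t) _ rewrite eq = _ , refl

  verdict-run : ∀ {c c′ k l r} → c ⟶[ k ] c′ → Verdict l c′ r → Verdict (k + l) c r
  verdict-run done     v = v
  verdict-run (e ◅ s) v (suc t) (s≤s le) rewrite e = verdict-run s v t le

  verdict-mono : ∀ {c k l r} → k ≤ l → Verdict k c r → Verdict l c r
  verdict-mono le v t h = v t (≤-trans le h)

-- The unambiguous machine for a witness language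

module Guess (O : Lang) (t : Bool) (e : ℕ) where

  pattern counter i = suc (suc (suc (suc (suc i))))

  δ : Fin (5 + suc e) → Sym → Sym → Bool → Action (Fin (5 + suc e))
  -- `readWord` reads from the head to the right, so the query is written from its last letter
  -- backwards: guessed bits, separator, e ones, tag, leading 1. The guessed witness therefore
  -- appears reversed.
  δ 0F                s0    _ b     = go 0F s0 right (bit b) left
  δ 0F                s1    _ b     = go 0F s1 right (bit b) left
  δ 0F                blank _ false = go (counter (fromℕ e)) blank stay s0 left
  δ 1F                a     _ false = go 2F a stay s1 stay
  δ 2F                _     _ false = ask 3F 4F
  δ 3F                _     _ false = halt true
  δ 4F                _     _ false = halt false
  δ (counter zero)    a     _ false = go 1F a stay (bit t) left
  δ (counter (suc i)) a     _ false = go (counter (inject₁ i)) a stay s1 left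
  δ _                 _     _ true  = halt false

  machine : NOTM
  machine = record { states = 5 + suc e ; start = 0F ; δ = δ }

  Cfg : Set
  Cfg = Config (5 + suc e)

  at : Fin (5 + suc e) → Tape → Word → Cfg
  at q w v = cfg q w (tape [] blank (map bit v))

  asking : Tape → Word → Cfg
  asking w v = cfg 2F w (tape [] s1 (map bit v))

  forced-counter-suc : ∀ i w v → Forced {O} {machine} (at (counter (suc i)) w v) (at (counter (inject₁ i)) w (true ∷ v))
  forced-counter-suc i w v = forced refl (_ , refl)

  forced-counter-zero : ∀ w v → Forced {O} {machine} (at (counter zero) w v) (at 1F w (t ∷ v))
  forced-counter-zero w v = forced refl (_ , refl)

  forced-mark : ∀ w v → Forced {O} {machine} (at 1F w v) (asking w v)
  forced-mark w v = forced refl (_ , refl)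

  forced-guess : ∀ l v → Forced {O} {machine} (at 0F (tapeAt l [] []) v) (at (counter (fromℕ e)) (tapeAt l [] []) (false ∷ v))
  forced-guess l v = forced refl (_ , refl)

  answered : Bool → Tape → Cfg
  answered b w = cfg (if b then 3F else 4F) w blankTape

  forced-ask : ∀ w v → Forced {O} {machine} (asking w v) (answered (O (true ∷ v)) w)
  forced-ask w v = forced (cong (λ q → inj₁ (answered (O (true ∷ q)) w)) (readBits-map v)) (_ , refl)

  guess-step : ∀ b l a x v → step O machine b (at 0F (tapeAt l (a ∷ x) []) v) ≡ inj₁ (at 0F (tapeAt (bit a ∷ l) x []) (b ∷ v))
  guess-step b l false x v = cong (λ w → inj₁ (at 0F w (b ∷ v))) (moveT-tapeAt l false x [])
  guess-step b l true  x v = cong (λ w → inj₁ (at 0F w (b ∷ v))) (moveT-tapeAt l true x [])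

  path-answered : ∀ b w cs → pathResult O machine cs (answered b w) true → b ≡ true × cs ≡ false ∷ []
  path-answered true  w (false ∷ [])    p  = refl , refl
  path-answered true  w (false ∷ _ ∷ _) ()
  path-answered true  w (true ∷ [])     ()
  path-answered true  w (true ∷ _ ∷ _)  ()
  path-answered false w (false ∷ [])    ()
  path-answered false w (false ∷ _ ∷ _) ()
  path-answered false w (true ∷ [])     ()
  path-answered false w (true ∷ _ ∷ _)  ()

  -- The four steps after the ones write the tag, write the leading 1, ask, and halt.
  tail : ℕ → List Bool
  tail k = replicate (k + 4) false

  path-counter : ∀ k i → toℕ i ≡ k → ∀ w v cs → pathResult O machine cs (at (counter i) w v) true
               → cs ≡ tail k × O (true ∷ t ∷ replicate k true ++ v) ≡ true
  path-counter zero zero _ w v cs p with path-forced {cs = cs} (forced-counter-zero w v) p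
  ... | cs₁ , refl , p₁ with path-forced {cs = cs₁} (forced-mark w (t ∷ v)) p₁
  ... | cs₂ , refl , p₂ with path-forced {cs = cs₂} (forced-ask w (t ∷ v)) p₂
  ... | cs₃ , refl , p₃ with path-answered (O (true ∷ t ∷ v)) w cs₃ p₃
  ... | yes! , refl = refl , yes!
  path-counter (suc k) (suc i) eq w v cs p with path-forced {cs = cs} (forced-counter-suc i w v) p
  ... | cs₁ , refl , p₁ with path-counter k (inject₁ i) (trans (toℕ-inject₁ i) (suc-injective eq)) w (true ∷ v) cs₁ p₁
  ... | refl , h = refl , subst (λ u → O (true ∷ t ∷ u) ≡ true) (replicate-∷ k true v) h

  -- All choices after the guessed bits are forced, so an accepting path is determined by its
  -- witness; unique witnesses thus give unique paths.
  path-guess : ∀ x l v cs → pathResult O machine cs (at 0F (tapeAt l x []) v) true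
             → ∃ λ ys → length ys ≡ length x × cs ≡ ys ++ false ∷ tail e × O (freeWord t e (ys ʳ++ v)) ≡ true
  path-guess [] l v cs p with path-forced {cs = cs} (forced-guess l v) p
  ... | cs₁ , refl , p₁ with path-counter e (fromℕ e) (toℕ-fromℕ e) (tapeAt l [] []) (false ∷ v) cs₁ p₁
  ... | refl , h = [] , refl , refl , h
  path-guess (a ∷ x) l v (b ∷ cs) p
    with path-guess x (bit a ∷ l) (b ∷ v) cs (path-uncons {O} {machine} {cs = cs} (guess-step b l a x v) p)
  ... | ys , len , refl , h = b ∷ ys , cong suc len , refl , h

  accept-counter : ∀ k i → toℕ i ≡ k → ∀ w v → O (true ∷ t ∷ replicate k true ++ v) ≡ true
                 → pathResult O machine (tail k) (at (counter i) w v) true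
  accept-counter zero zero _ w v h =
    path-force (false ∷ false ∷ false ∷ []) (forced-counter-zero w v)
      (path-force (false ∷ false ∷ []) (forced-mark w (t ∷ v))
        (path-force (false ∷ []) (forced-ask w (t ∷ v))
          (subst (λ b → pathResult O machine (false ∷ []) (answered b w) true) (sym h) refl)))
  accept-counter (suc k) (suc i) eq w v h = path-force (tail k) (forced-counter-suc i w v)
    (accept-counter k (inject₁ i) (trans (toℕ-inject₁ i) (suc-injective eq)) w (true ∷ v)
      (subst (λ u → O (true ∷ t ∷ u) ≡ true) (sym (replicate-∷ k true v)) h))

  accept-guess : ∀ x l v ys → length ys ≡ length x → O (freeWord t e (ys ʳ++ v)) ≡ true
               → pathResult O machine (ys ++ false ∷ tail e) (at 0F (tapeAt l x []) v) true
  accept-guess [] l v [] _ h = path-force (tail e) (forced-guess l v)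
    (accept-counter e (fromℕ e) (toℕ-fromℕ e) (tapeAt l [] []) (false ∷ v) h)
  accept-guess (a ∷ x) l v (b ∷ ys) len h = path-cons {O} {machine} {cs = ys ++ false ∷ tail e} (guess-step b l a x v)
    (accept-guess x (bit a ∷ l) (b ∷ v) ys (suc-injective len) h)

  halts-answered : ∀ b w → HaltsIn {O} {machine} 1 (answered b w)
  halts-answered true  w (false ∷ _) _ = tt
  halts-answered true  w (true ∷ _)  _ = tt
  halts-answered false w (false ∷ _) _ = tt
  halts-answered false w (true ∷ _)  _ = tt

  halts-counter : ∀ k i → toℕ i ≡ k → ∀ w v → HaltsIn {O} {machine} (k + 4) (at (counter i) w v)
  halts-counter zero zero _ w v = haltsIn-forced (forced-counter-zero w v) (haltsIn-forced (forced-mark w (t ∷ v))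
    (haltsIn-forced (forced-ask w (t ∷ v)) (halts-answered (O (true ∷ t ∷ v)) w)))
  halts-counter (suc k) (suc i) eq w v = haltsIn-forced (forced-counter-suc i w v)
    (halts-counter k (inject₁ i) (trans (toℕ-inject₁ i) (suc-injective eq)) w (true ∷ v))

  halts-guess : ∀ x l v → HaltsIn {O} {machine} (length x + suc (e + 4)) (at 0F (tapeAt l x []) v)
  halts-guess []      l v = haltsIn-forced (forced-guess l v) (halts-counter e (fromℕ e) (toℕ-fromℕ e) (tapeAt l [] []) (false ∷ v))
  halts-guess (a ∷ x) l v = haltsIn-step λ b → inj₂ (_ , guess-step b l a x v , halts-guess x (bit a ∷ l) (b ∷ v))

  clock : Poly
  clock = poly (suc (e + 4)) 1

  clock-enough : ∀ n → n + suc (e + 4) ≤ evalP clock n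
  clock-enough n = +-monoˡ-≤ _ (≤-trans (≤-reflexive (sym (*-identityʳ n))) (m≤n*m (n * 1) (suc (e + 4))))

  initial : ∀ x → initCfg machine x ≡ at 0F (tapeAt [] x []) []
  initial x = cong (λ w → cfg 0F w blankTape) (inputTape-tapeAt x)

  polyTime : PolyTime O machine clock
  polyTime x cs len = subst (λ c → Halted (exec O machine cs c)) (sym (initial x))
    (halts-guess x [] [] cs (≤-trans (clock-enough (length x)) (≤-reflexive (sym len))))

  accepting : ∀ x cs → AcceptingPath O machine x cs
            → ∃ λ ys → length ys ≡ length x × cs ≡ ys ++ false ∷ tail e × O (freeWord t e (reverse ys)) ≡ true
  accepting x cs p = path-guess x [] [] cs (subst (λ c → pathResult O machine cs c true) (initial x) p)

  acceptingPath : ∀ x ys → length ys ≡ length x → O (freeWord t e (reverse ys)) ≡ true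
                → AcceptingPath O machine x (ys ++ false ∷ tail e)
  acceptingPath x ys len h = subst (λ c → pathResult O machine (ys ++ false ∷ tail e) c true) (sym (initial x))
    (accept-guess x [] [] ys len h)

-- Each round copies the work tape, reversed, to the query tape and asks whether more padding is needed;
-- if so, a 1 is appended to the work tape.  States indexed by true belong to the final query.
module Decide (O : Lang) (e : ℕ) where

  pattern st10 = suc 9F
  pattern st11 = suc (suc 9F)
  pattern st12 = suc (suc (suc 9F))
  pattern counting i = suc (suc (suc (suc (suc (suc (suc (suc (suc (suc (suc (suc (suc i))))))))))))

  Q : Set
  Q = Fin (13 + suc e)

  returning copying tagging asking : Bool → Q
  returning false = 1F
  returning true  = 2F
  copying   false = 3F
  copying   true  = 4F
  tagging   false = 5F
  tagging   true  = 6F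
  asking    false = 7F
  asking    true  = 8F

  verdict : Bool → Q
  verdict b = if b then st11 else st12

  returnδ copyδ : Bool → Sym → Sym → Action Q
  returnδ b s0    q = go (returning b) s0 left q stay
  returnδ b s1    q = go (returning b) s1 left q stay
  returnδ b blank q = go (copying b) blank right q stay
  copyδ   b s0    q = go (copying b) s0 right s0 left
  copyδ   b s1    q = go (copying b) s1 right s1 left
  copyδ   b blank q = go (tagging b) blank stay (bit b) left

  δ : Q → Sym → Sym → Action Q
  δ 0F                 s0    q = go 0F s0 right q stay
  δ 0F                 s1    q = go 0F s1 right q stay
  -- Behind the input come 0, e ones and another 0. Read from the head to the left, this is an empty
  -- unary padding followed by `unary e (reverse x)`, and each 1 appended on the right lengthens the
  -- padding by one.
  δ 0F                 blank q = go (counting (fromℕ e)) s0 right q stay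
  δ 1F                 a     q = returnδ false a q
  δ 2F                 a     q = returnδ true a q
  δ 3F                 a     q = copyδ false a q
  δ 4F                 a     q = copyδ true a q
  δ 5F                 a     q = go (asking false) a stay s0 stay
  δ 6F                 a     q = go (asking true) a stay s0 stay
  δ 7F                 a     q = ask 9F st10
  δ 8F                 a     q = ask (verdict true) (verdict false)
  δ 9F                 a     q = go (returning false) s1 stay q stay
  δ st10               a     q = go (returning true) a left q stay
  δ st11               a     q = halt true
  δ st12               a     q = halt false
  δ (counting zero)    a     q = go (returning false) s0 stay q stay
  δ (counting (suc i)) a     q = go (counting (inject₁ i)) s1 right q stay

  machine : DOTM
  machine = record { states = 13 + suc e ; start = 0F ; δ = δ }

  M : NOTM
  M = toN machine

  infix 4 _⇒[_]_
  _⇒[_]_ : Config (13 + suc e) → ℕ → Config (13 + suc e) → Set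
  c ⇒[ k ] c′ = _⟶[_]_ {O} {M} c k c′

  -- The left margin gains a blank when the head first turns there, the right margin when the head
  -- leaves it for the final query. Neither grows further, as later passes reuse the cell.
  data Margin : List Sym → Set where
    empty : Margin []
    one   : Margin (blank ∷ [])

  tapeAt-margin : ∀ l {bs} → Margin bs → tapeAt l [] bs ≡ tape l blank []
  tapeAt-margin l empty = refl
  tapeAt-margin l one   = refl

  qtapeOf : Word → Tape
  qtapeOf v = tape [] blank (map bit v)

  step-return : ∀ b a l h r → step O M false (cfg (returning b) (tape l (bit a) (h ++ r)) blankTape)
              ≡ inj₁ (cfg (returning b) (moveT left (tape l (bit a) (h ++ r))) blankTape)
  step-return false false l h r = refl
  step-return false true  l h r = refl
  step-return true  false l h r = refl
  step-return true  true  l h r = refl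

  run-return : ∀ b v a {ls} → Margin ls → ∀ rs → cfg (returning b) (tape (map bit v ++ ls) (bit a) rs) blankTape
             ⇒[ suc (length v) ] cfg (returning b) (tape [] blank (map bit v ʳ++ (bit a ∷ rs))) blankTape
  run-return b []      a empty rs = step-return b a [] [] rs ◅ done
  run-return b []      a one   rs = step-return b a (blank ∷ []) [] rs ◅ done
  run-return b (x ∷ v) a m     rs = step-return b a (map bit (x ∷ v) ++ _) [] rs ◅ run-return b v x m (bit a ∷ rs)

  step-turn : ∀ b r → step O M false (cfg (returning b) (tape [] blank r) blankTape)
            ≡ inj₁ (cfg (copying b) (moveT right (tape [] blank r)) blankTape)
  step-turn false r = refl
  step-turn true  r = refl

  step-copy : ∀ b a l z bs v → step O M false (cfg (copying b) (tapeAt l (a ∷ z) bs) (qtapeOf v))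
            ≡ inj₁ (cfg (copying b) (moveT right (tapeAt l (a ∷ z) bs)) (qtapeOf (a ∷ v)))
  step-copy false false l z bs v = refl
  step-copy false true  l z bs v = refl
  step-copy true  false l z bs v = refl
  step-copy true  true  l z bs v = refl

  run-copy : ∀ b z l bs v → cfg (copying b) (tapeAt l z bs) (qtapeOf v)
           ⇒[ length z ] cfg (copying b) (tapeAt (map bit z ʳ++ l) [] bs) (qtapeOf (z ʳ++ v))
  run-copy b []      l bs v = done
  run-copy b (a ∷ z) l bs v = trans (step-copy b a l z bs v)
      (cong (λ w → inj₁ (cfg (copying b) w (qtapeOf (a ∷ v)))) (moveT-tapeAt l a z bs))
    ◅ run-copy b z (bit a ∷ l) bs (a ∷ v)

  step-tag : ∀ b l v → step O M false (cfg (copying b) (tape l blank []) (qtapeOf v))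
           ≡ inj₁ (cfg (tagging b) (tape l blank []) (qtapeOf (b ∷ v)))
  step-tag false l v = refl
  step-tag true  l v = refl

  asks : Bool → List Sym → Word → Config (13 + suc e)
  asks b l v = cfg (asking b) (tape l blank []) (tape [] s0 (map bit v))

  step-mark : ∀ b l v → step O M false (cfg (tagging b) (tape l blank []) (qtapeOf v)) ≡ inj₁ (asks b l v)
  step-mark false l v = refl
  step-mark true  l v = refl

  -- v is the content of the work tape, read from the head to the left.
  ready : Bool → Word → List Sym → List Sym → Config (13 + suc e)
  ready b []      ls rs = cfg (returning b) (tape ls blank rs) blankTape
  ready b (a ∷ v) ls rs = cfg (returning b) (tape (map bit v ++ ls) (bit a) rs) blankTape

  -- The way back, the turn, the copying, and two steps for the leading letters of the query.
  passTime : Word → ℕ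
  passTime v = length v + (1 + (length v + 2))

  run-pass : ∀ b a v {ls rs} → Margin ls → Margin rs
    → ready b (a ∷ v) ls rs ⇒[ passTime (a ∷ v) ] asks b (map bit (a ∷ v) ++ blank ∷ []) (b ∷ a ∷ v)
  run-pass b a v {ls} {rs} ml mr =
    ⟶-trans (run-return b v a ml rs)
      (trans (step-turn b _) (cong (λ w → inj₁ (cfg (copying b) w blankTape)) turned)
       ◅ subst (λ k → cfg (copying b) (tapeAt (blank ∷ []) z rs) blankTape ⇒[ k + 2 ] asks b L (b ∷ a ∷ v))
           (length-reverse (a ∷ v))
           (⟶-trans (run-copy b z (blank ∷ []) rs [])
             (trans (cong₂ (λ w u → step O M false (cfg (copying b) w (qtapeOf u))) copied unread) (step-tag b L (a ∷ v))
              ◅ step-mark b L (b ∷ a ∷ v) ◅ done)))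
    where
    z : Word
    z = reverse (a ∷ v)
    L : List Sym
    L = map bit (a ∷ v) ++ blank ∷ []
    turned : moveT right (tape [] blank (map bit v ʳ++ (bit a ∷ rs))) ≡ tapeAt (blank ∷ []) z rs
    turned = trans (cong (λ r → moveT right (tape [] blank r)) (begin
        map bit v ʳ++ (bit a ∷ rs)      ≡⟨ ʳ++-defn (map bit (a ∷ v)) ⟩
        reverse (map bit (a ∷ v)) ++ rs ≡⟨ cong (_++ rs) (sym (map-ʳ++ bit (a ∷ v) {[]})) ⟩
        map bit z ++ rs                 ∎)) (moveT-blank z rs)
      where open ≡-Reasoning
    copied : tapeAt (map bit z ʳ++ (blank ∷ [])) [] rs ≡ tape L blank []
    copied = trans (tapeAt-margin _ mr) (cong (λ l → tape l blank []) (begin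
        map bit z ʳ++ (blank ∷ [])        ≡⟨ ʳ++-defn (map bit z) ⟩
        reverse (map bit z) ++ blank ∷ [] ≡⟨ cong (_++ blank ∷ []) (sym (map-ʳ++ bit z {[]})) ⟩
        map bit (reverse z) ++ blank ∷ [] ≡⟨ cong (λ u → map bit u ++ blank ∷ []) (reverse-involutive (a ∷ v)) ⟩
        L ∎))
      where open ≡-Reasoning
    unread : z ʳ++ [] ≡ a ∷ v
    unread = reverse-involutive (a ∷ v)

  step-asks-pad : ∀ l v → step O M false (asks false l v) ≡ inj₁ (cfg (if O (false ∷ v) then 9F else st10) (tape l blank []) blankTape)
  step-asks-pad l v = cong (λ u → inj₁ (cfg (if O (false ∷ u) then 9F else st10) (tape l blank []) blankTape)) (readBits-map v)

  step-asks-query : ∀ l v → step O M false (asks true l v) ≡ inj₁ (cfg (verdict (O (false ∷ v))) (tape l blank []) blankTape)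
  step-asks-query l v = cong (λ u → inj₁ (cfg (verdict (O (false ∷ u))) (tape l blank []) blankTape)) (readBits-map v)

  verdict-final : ∀ r w → Verdict {O} {M} 1 (cfg (verdict r) w blankTape) r
  verdict-final true  w = verdict-halt refl
  verdict-final false w = verdict-halt refl

  queryTime : Word → ℕ
  queryTime v = passTime v + 2

  query-verdict : ∀ a v {ls rs} → Margin ls → Margin rs
    → Verdict {O} {M} (queryTime (a ∷ v)) (ready true (a ∷ v) ls rs) (O (false ∷ true ∷ a ∷ v))
  query-verdict a v ml mr = verdict-run (run-pass true a v ml mr)
    (verdict-run (step-asks-query _ (true ∷ a ∷ v) ◅ done) (verdict-final _ _))

  -- Each round is also charged with a final query, since the oracle may declare the padding
  -- sufficient before j rounds are over.
  loopTime : ℕ → Word → ℕ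
  loopTime zero    v = passTime v + (2 + queryTime v)
  loopTime (suc j) v = passTime v + (2 + queryTime v) + (passTime v + (2 + loopTime j (true ∷ v)))

  -- The loop stops at the first negative answer, at some i that may be smaller than j, so the
  -- padding answers need not be monotone.
  loop-verdict : ∀ j a v {ls} → Margin ls → O (false ∷ false ∷ replicate j true ++ a ∷ v) ≡ false
    → ∃ λ i → O (false ∷ false ∷ replicate i true ++ a ∷ v) ≡ false
        × Verdict {O} {M} (loopTime j (a ∷ v)) (ready false (a ∷ v) ls []) (O (false ∷ true ∷ replicate i true ++ a ∷ v))
  loop-verdict j a v ml stop with O (false ∷ false ∷ a ∷ v) in eq
  ... | false = 0 , eq , verdict-mono (bound j) (verdict-run (run-pass false a v ml empty)
          (verdict-run {l = queryTime (a ∷ v)} (trans (step-asks-pad _ (false ∷ a ∷ v)) (cong (λ b → inj₁ (cfg (if b then 9F else st10) _ blankTape)) eq)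
                        ◅ refl ◅ done)
            (query-verdict a v one one)))
    where
    bound : ∀ j → passTime (a ∷ v) + (2 + queryTime (a ∷ v)) ≤ loopTime j (a ∷ v)
    bound zero    = ≤-refl
    bound (suc j) = m≤m+n _ _
  loop-verdict zero a v ml stop | true with trans (sym eq) stop
  ... | ()
  loop-verdict (suc j) a v ml stop | true
    with loop-verdict j true (a ∷ v) one (subst (λ u → O (false ∷ false ∷ u) ≡ false) (sym (replicate-∷ j true (a ∷ v))) stop)
  ... | i , h , vd = suc i ,
    subst (λ u → O (false ∷ false ∷ u) ≡ false) (replicate-∷ i true (a ∷ v)) h ,
    subst (λ u → Verdict {O} {M} (loopTime (suc j) (a ∷ v)) (ready false (a ∷ v) _ []) (O (false ∷ true ∷ u))) (replicate-∷ i true (a ∷ v))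
      (verdict-mono (m≤n+m _ (passTime (a ∷ v) + (2 + queryTime (a ∷ v)))) (verdict-run (run-pass false a v ml empty)
        (verdict-run {l = loopTime j (true ∷ a ∷ v)} (trans (step-asks-pad _ (false ∷ a ∷ v)) (cong (λ b → inj₁ (cfg (if b then 9F else st10) _ blankTape)) eq)
                      ◅ refl ◅ done) vd)))

  step-scan : ∀ a l x → step O M false (cfg 0F (tapeAt l (a ∷ x) []) blankTape)
            ≡ inj₁ (cfg 0F (moveT right (tapeAt l (a ∷ x) [])) blankTape)
  step-scan false l x = refl
  step-scan true  l x = refl

  run-scan : ∀ x l → cfg 0F (tapeAt l x []) blankTape ⇒[ length x ] cfg 0F (tape (map bit x ʳ++ l) blank []) blankTape
  run-scan []      l = done
  run-scan (a ∷ x) l = trans (step-scan a l x) (cong (λ w → inj₁ (cfg 0F w blankTape)) (moveT-tapeAt l a x []))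
    ◅ run-scan x (bit a ∷ l)

  run-count : ∀ k i → toℕ i ≡ k → ∀ v → cfg (counting i) (tape (map bit v) blank []) blankTape
            ⇒[ suc k ] cfg (returning false) (tape (map bit (replicate k true ++ v)) s0 []) blankTape
  run-count zero    zero    _  v = refl ◅ done
  run-count (suc k) (suc i) eq v = refl ◅ subst (λ u → cfg (counting (inject₁ i)) (tape (map bit (true ∷ v)) blank []) blankTape
      ⇒[ suc k ] cfg (returning false) (tape (map bit u) s0 []) blankTape) (replicate-∷ k true v)
    (run-count k (inject₁ i) (trans (toℕ-inject₁ i) (suc-injective eq)) (true ∷ v))

  contents : Word → Word
  contents x = unary e (reverse x)

  run-start : ∀ x → initCfg M x ⇒[ length x + suc (suc e) ] ready false (false ∷ contents x) [] []
  run-start x = subst₂ (λ c c′ → c ⇒[ length x + suc (suc e) ] c′)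
    (cong (λ w → cfg 0F w blankTape) (sym (inputTape-tapeAt x)))
    (cong (λ l → cfg (returning false) (tape l s0 []) blankTape) (sym (++-identityʳ (map bit (contents x)))))
    (⟶-trans (subst (λ l → cfg 0F (tapeAt [] x []) blankTape ⇒[ length x ] cfg 0F (tape l blank []) blankTape)
                (sym (map-ʳ++ bit x {[]})) (run-scan x []))
      (refl ◅ run-count e (fromℕ e) (toℕ-fromℕ e) (false ∷ reverse x)))

  decides : ∀ x j → O (codeWord false j e x) ≡ false
    → ∃ λ i → O (codeWord false i e x) ≡ false
        × Verdict {O} {M} (length x + suc (suc e) + loopTime j (false ∷ contents x)) (initCfg M x) (O (codeWord true i e x))
  decides x j stop with loop-verdict j false (contents x) empty stop
  ... | i , h , vd = i , h , verdict-run (run-start x) vd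

  -- The sum `length v + j` is the same in every round, so N bounds the tape contents throughout; a
  -- round with its surplus query costs `6 * length v + 15` steps.
  loopTime-bound : ∀ j v N → length v + j ≤ N → loopTime j v ≤ suc j * (6 * N + 16)
  loopTime-bound zero v N le = begin
      loopTime zero v
        ≡⟨ solve 1 (λ l → (l :+ (con 1 :+ (l :+ con 2))) :+ (con 2 :+ (l :+ (con 1 :+ (l :+ con 2)) :+ con 2))
                       := con 4 :* l :+ con 10) refl (length v) ⟩
      4 * length v + 10 ≤⟨ +-mono-≤ (*-mono-≤ {4} {6} (m≤m+n 4 2) (≤-trans (m≤m+n _ 0) le)) (m≤m+n 10 6) ⟩
      6 * N + 16 ≡⟨ sym (*-identityˡ _) ⟩
      1 * (6 * N + 16) ∎
    where open ≤-Reasoning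
          open +-*-Solver
  loopTime-bound (suc j) v N le = begin
      loopTime (suc j) v
        ≡⟨ solve 2 (λ l r → (l :+ (con 1 :+ (l :+ con 2))) :+ (con 2 :+ (l :+ (con 1 :+ (l :+ con 2)) :+ con 2))
                          :+ ((l :+ (con 1 :+ (l :+ con 2))) :+ (con 2 :+ r))
                       := (con 6 :* l :+ con 15) :+ r) refl (length v) (loopTime j (true ∷ v)) ⟩
      6 * length v + 15 + loopTime j (true ∷ v)
        ≤⟨ +-mono-≤ (+-mono-≤ (*-monoʳ-≤ 6 (≤-trans (m≤m+n _ (suc j)) le)) (m≤m+n 15 1))
             (loopTime-bound j (true ∷ v) N (≤-trans (≤-reflexive (sym (+-suc (length v) j))) le)) ⟩
      (6 * N + 16) + suc j * (6 * N + 16) ∎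
    where open ≤-Reasoning
          open +-*-Solver

-- Complexity classes relative to the oracle

module _ (O : Lang) where

  exec-choices : ∀ D cs c → exec O (toN D) cs c ≡ exec O (toN D) (replicate (length cs) false) c
  exec-choices D []       c = refl
  exec-choices D (b ∷ bs) (cfg q w t) with DOTM.δ D q (Tape.hd w) (Tape.hd t)
  ... | go _ _ _ _ _ = exec-choices D bs _
  ... | ask _ _      = exec-choices D bs _
  ... | halt _       = refl

  exec-path : ∀ M cs c {r c′} → exec O M cs c ≡ inj₂ (r , c′) → ∃ λ cs′ → pathResult O M cs′ c r
  exec-path M (b ∷ bs) c eq with step O M b c in eq′
  exec-path M (b ∷ bs) c refl | inj₂ _ = b ∷ [] , halted eq′
    where
    halted : ∀ {r c′} → step O M b c ≡ inj₂ (r , c′) → pathResult O M (b ∷ []) c r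
    halted h rewrite h = refl
  ... | inj₁ c₁ with exec-path M bs c₁ eq
  ... | cs′ , p = b ∷ cs′ , path-cons {O} {M} {cs = cs′} eq′ p

  InP⇒InNP : ∀ {L} → InP O L → InNP O L
  InP⇒InNP {L} (D , p , run) = toN D , p , polyTime , λ x → accept x , correct x
    where
    polyTime : PolyTime O (toN D) p
    polyTime x cs len with run x
    ... | r , c , eq , _ = subst Halted (sym (trans (exec-choices D cs (initCfg (toN D) x))
      (trans (cong (λ t → dexec O D t x) len) eq))) tt
    accept : ∀ x → x ∈L L → ∃ λ cs → AcceptingPath O (toN D) x cs
    accept x x∈ with run x
    ... | r , c , eq , r≡ = exec-path (toN D) (replicate (evalP p (length x)) false) (initCfg (toN D) x) (trans eq (cong (λ b → inj₂ (b , c)) (trans r≡ x∈)))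
    correct : ∀ x → (∃ λ cs → AcceptingPath O (toN D) x cs) → x ∈L L
    correct x (cs , a) with run x
    ... | r , c , eq , r≡
      with path-exec O (toN D) cs (initCfg (toN D) x) a (replicate (evalP p (length x) ∸ length cs) false)
    ... | c′ , eq′ = trans (sym r≡) (verdict-≡ (trans (sym eq) (trans (sym (trans (exec-choices D (cs ++ replicate (evalP p (length x) ∸ length cs) false) (initCfg (toN D) x))
            (cong (λ t → dexec O D t x) full))) eq′)))
      where
      verdict-≡ : ∀ {r r′ : Bool} {c c′ : Config (DOTM.states D)}
                → _≡_ {A = Config (DOTM.states D) ⊎ (Bool × Config (DOTM.states D))} (inj₂ (r , c)) (inj₂ (r′ , c′)) → r ≡ r′
      verdict-≡ refl = refl
      full : length (cs ++ replicate (evalP p (length x) ∸ length cs) false) ≡ evalP p (length x)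
      full = trans (length-++ cs) (trans (cong (length cs +_) (length-replicate _))
        (m+[n∸m]≡n (path-length O (toN D) (evalP p (length x)) (initCfg (toN D) x) (polyTime x) cs a)))

  flipA : ∀ {Q} → Action Q → Action Q
  flipA (halt r) = halt (not r)
  flipA a        = a

  flipD : DOTM → DOTM
  flipD D = record { states = DOTM.states D ; start = DOTM.start D ; δ = λ q a b → flipA (DOTM.δ D q a b) }

  exec-flip : ∀ D cs c {r c′} → exec O (toN D) cs c ≡ inj₂ (r , c′) → exec O (toN (flipD D)) cs c ≡ inj₂ (not r , c′)
  exec-flip D (b ∷ bs) (cfg q w t) eq with DOTM.δ D q (Tape.hd w) (Tape.hd t)
  ... | go _ _ _ _ _ = exec-flip D bs _ eq
  ... | ask _ _      = exec-flip D bs _ eq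
  exec-flip D (b ∷ bs) (cfg q w t) refl | halt _ = refl

  InP-complement : ∀ {L} → InP O L → InP O (complement L)
  InP-complement (D , p , run) = flipD D , p , λ x →
    let r , c , eq , r≡ = run x in not r , c , exec-flip D (replicate (evalP p (length x)) false) (initCfg (toN D) x) eq , cong not r≡

-- Enumeration of all tasks and requirements

decKind : ℕ → Kind
decKind 0 = np
decKind 1 = up
decKind _ = conp

decKind-surjective : Surjective _≡_ decKind
decKind-surjective np   = 0 , refl
decKind-surjective up   = 1 , refl
decKind-surjective conp = 2 , refl

opaque
  task : ℕ → Task
  task n = mkTask (decKind (π₁ n)) (decNOTM (π₁ (π₂ n))) (decNOTM (π₁ (π₂ (π₂ n)))) (decPoly (π₂ (π₂ (π₂ n))))

  task-surjective : ∀ k N₁ N₂ p → ∃ λ e → Task.kind (task e) ≡ k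
    × Task.N₁ (task e) ≈ᴺ N₁ × Task.N₂ (task e) ≈ᴺ N₂ × Task.clock (task e) ≡ p
  task-surjective k N₁ N₂ p with decKind-surjective k | decNOTM-surjective N₁ | decNOTM-surjective N₂ | decPoly-surjective p
  ... | a , ha | b , hb | c , hc | d , hd = n ,
    trans (cong decKind (π₁-code a _)) ha ,
    subst (λ i → decNOTM i ≈ᴺ N₁) (sym (trans (cong π₁ (π₂-code a _)) (π₁-code b _))) hb ,
    subst (λ i → decNOTM i ≈ᴺ N₂) (sym (trans (cong π₁ rest) (π₁-code c d))) hc ,
    trans (cong decPoly (trans (cong π₂ rest) (π₂-code c d))) hd
    where
    n : ℕ
    n = code a (code b (code c d))
    rest : π₂ (π₂ n) ≡ code c d
    rest = trans (cong π₂ (π₂-code a _)) (π₂-code b _)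

  -- A requirement codes a task, a reducer and a time bound, so every task is diagonalised against
  -- every clocked reducer.
  target : ℕ → ℕ
  target = π₁

  reducer : ℕ → DOTM
  reducer r = decDOTM (π₁ (π₂ r))

  budget : ℕ → Poly
  budget r = decPoly (π₂ (π₂ r))

  requirement-surjective : ∀ e F q → ∃ λ r → target r ≡ e × reducer r ≈ᴰ F × budget r ≡ q
  requirement-surjective e F q with decDOTM-surjective F | decPoly-surjective q
  ... | a , ha | b , hb = code e (code a b) , π₁-code e _ ,
    subst (λ i → decDOTM i ≈ᴰ F) (sym (trans (cong π₁ (π₂-code e _)) (π₁-code a b))) ha ,
    trans (cong decPoly (trans (cong π₂ (π₂-code e _)) (π₂-code a b))) hb

-- The properties of the oracle

open Construction task target reducer budget

Represents : ℕ → Bool → Lang → Set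
Represents e b L = ∀ x → (x ∈L L → Accepts oracle b e x) × (Accepts oracle b e x → x ∈L L)

Computes : NOTM → Lang → Set
Computes M L = ∀ x → (x ∈L L → ∃ λ cs → AcceptingPath oracle M x cs) × ((∃ λ cs → AcceptingPath oracle M x cs) → x ∈L L)

represents : ∀ {e M p L} b → mach e b ≈ᴺ M → (∀ n → evalP p n ≤ evalP (Task.clock (task e)) n)
           → PolyTime oracle M p → Computes M L → Represents e b L
represents {M = M} {p} b eq le poly-time comp x =
  (λ x∈ → let cs , a = proj₁ (comp x) x∈ in
     cs , ≤-trans (path-length oracle M (evalP p (length x)) _ (poly-time x) cs a) (le (length x)) ,
     subst (λ A → A) (sym (acceptingPath-≈ eq x cs)) a) ,
  (λ (cs , _ , a) → proj₂ (comp x) (cs , subst (λ A → A) (acceptingPath-≈ eq x cs) a))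

opaque
  representPair : ∀ k {L₁ L₂} → InNP oracle L₁ → InNP oracle L₂
    → ∃ λ e → kind e ≡ k × Represents e true L₁ × Represents e false L₂
  representPair k (M₁ , p₁ , t₁ , c₁) (M₂ , p₂ , t₂ , c₂)
    -- A task has one clock for both machines, so a polynomial above the sum of the two bounds is
    -- taken.
    with polyBounded-+ {evalP p₁} {evalP p₂} (p₁ , λ _ → ≤-refl) (p₂ , λ _ → ≤-refl)
  ... | p , le with task-surjective k M₁ M₂ p
  ... | e , k≡ , e₁ , e₂ , p≡ = e , k≡ ,
    represents {e} {p = p₁} true e₁ (λ n → ≤-trans (≤-trans (m≤m+n _ _) (le n)) (≤-reflexive (cong (λ p → evalP p n) (sym p≡)))) t₁ c₁ ,
    represents {e} {p = p₂} false e₂ (λ n → ≤-trans (≤-trans (m≤n+m _ (evalP p₁ n)) (le n)) (≤-reflexive (cong (λ p → evalP p n) (sym p≡)))) t₂ c₂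

true≢false : true ≢ false
true≢false ()

codeWord-length : ∀ b p e x → length (codeWord b p e x) ≡ 2 + (p + suc (length (unary e (reverse x))))
codeWord-length b p e x = cong (2 +_) (length-unary p _)

module _ (e : ℕ) where

  -- `padding` bounds the number of rounds of the deciding machine, and `size` the tape contents
  -- after them, starting from `suc (e + suc n)` cells for 0, `unary e` and the input.
  padding size total : ℕ → ℕ
  padding n = suc (evalP (Task.clock (task e)) n * suc (evalP (Task.clock (task e)) n)) + threshold e
  size n    = suc (e + suc n) + padding n
  total n   = n + suc (suc e) + suc (padding n) * (6 * size n + 16)

  opaque
    total-bounded : PolyBounded total
    total-bounded = polyBounded-+ (polyBounded-+ polyBounded-id (polyBounded-const (suc (suc e))))
      (polyBounded-* (polyBounded-+ (polyBounded-const 1) pad-bounded)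
        (polyBounded-+ (polyBounded-* (polyBounded-const 6)
            (polyBounded-+ (polyBounded-+ (polyBounded-const (suc e)) (polyBounded-+ (polyBounded-const 1) polyBounded-id)) pad-bounded))
          (polyBounded-const 16)))
      where
      clock-bounded : PolyBounded (evalP (Task.clock (task e)))
      clock-bounded = Task.clock (task e) , λ _ → ≤-refl
      pad-bounded : PolyBounded padding
      pad-bounded = polyBounded-+ (polyBounded-+ (polyBounded-const 1)
        (polyBounded-* clock-bounded (polyBounded-+ (polyBounded-const 1) clock-bounded))) (polyBounded-const (threshold e))

  padding-sufficient : ∀ x → oracle (codeWord false (padding (length x)) e x) ≡ false
  padding-sufficient x = pad-sufficient (parse-pad (padding (length x)) e x) (≤-trans (m≤m+n _ (threshold e)) long)
                                        (≤-trans (m≤n+m (threshold e) (required e x)) long)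
    where
    long : padding (length x) ≤ length (codeWord false (padding (length x)) e x)
    long = ≤-trans (≤-trans (m≤m+n _ _) (m≤n+m _ 2)) (≤-reflexive (sym (codeWord-length false (padding (length x)) e x)))

  open Decide oracle e

  decide-time : ∀ x → length x + suc (suc e) + loopTime (padding (length x)) (false ∷ contents x) ≤ total (length x)
  decide-time x = +-monoʳ-≤ (length x + suc (suc e)) (loopTime-bound (padding (length x)) (false ∷ contents x) (size (length x))
    (≤-reflexive (cong (λ i → suc i + padding (length x)) (trans (length-unary e (reverse x)) (cong (λ i → e + suc i) (length-reverse x))))))

  -- The machine computes neither the clock nor the threshold; it learns from the oracle when to
  -- stop, and both numbers enter only the analysis of its running time.
  complementary⇒InP : ∀ {L} → Complementary e → Represents e true L → InP oracle L
  complementary⇒InP {L} compl rep = machine , proj₁ total-bounded , λ x →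
    let i , h , vd = decides x (padding (length x)) (padding-sufficient x)
        c , eq = vd (evalP (proj₁ total-bounded) (length x)) (≤-trans (decide-time x) (proj₂ total-bounded (length x)))
    in _ , c , eq , answer x i h
    where
    answer : ∀ x i → oracle (codeWord false i e x) ≡ false → oracle (codeWord true i e x) ≡ L x
    answer x i h = trans (query-correct compl (parse-pad i e x) h (parse-query i e x) refl)
      (bool-iff (λ a → proj₂ (rep x) (accepts-sound {oracle} a)) (λ l → accepts-complete {oracle} (proj₁ (rep x) l)))

InNP∩coNP⇒InP : ∀ L → InNP oracle L × InCoNP oracle L → InP oracle L
-- Code words exist for tasks of every kind, so `np` is an arbitrary choice here.
InNP∩coNP⇒InP L (inNP , inCoNP) with representPair np inNP inCoNP
... | e , _ , rep₁ , rep₂ = complementary⇒InP e complementary rep₁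
  where
  complementary : Complementary e
  complementary x (f , g) with L x in eq
  ... | true  = true≢false (trans (sym (proj₂ (rep₂ x) (f (proj₁ (rep₁ x) eq)))) (cong not eq))
  ... | false = true≢false (trans (sym (proj₂ (rep₁ x) (g (proj₁ (rep₂ x) (cong not eq))))) eq)

opaque
  has? : ∀ t e n → Dec (Has oracle t e n)
  has? t e n = map′ (λ (y , _ , h) → y , h) (λ (y , l , h) → y , ≤-reflexive l , l , h)
    (wordUpTo? n λ y → (length y ≟ n) ×-dec (oracle (freeWord t e y) ≟ᵇ true))

witnessLang : Bool → ℕ → Lang
witnessLang t e x = does (has? t e (length x))

witnessLang-complete : ∀ t e x → Has oracle t e (length x) → x ∈L witnessLang t e
witnessLang-complete t e x = dec-true (has? t e (length x))

witnessLang-sound : ∀ t e x → x ∈L witnessLang t e → Has oracle t e (length x)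
witnessLang-sound t e x h with has? t e (length x)
... | yes p = p

witnessLang-UP : ∀ t e → (∀ n → UniqueAt oracle e n) → InUP oracle (witnessLang t e)
witnessLang-UP t e unique = machine , clock , polyTime , (λ x → accept x , correct x) , unambiguous
  where
  open Guess oracle t e
  accept : ∀ x → x ∈L witnessLang t e → ∃ λ cs → AcceptingPath oracle machine x cs
  accept x x∈ with witnessLang-sound t e x x∈
  ... | y , len , h = reverse y ++ false ∷ tail e , acceptingPath x (reverse y) (trans (length-reverse y) len)
    (subst (λ y → oracle (freeWord t e y) ≡ true) (sym (reverse-involutive y)) h)
  correct : ∀ x → (∃ λ cs → AcceptingPath oracle machine x cs) → x ∈L witnessLang t e
  correct x (cs , a) with accepting x cs a
  ... | ys , len , _ , h = witnessLang-complete t e x (reverse ys , trans (length-reverse ys) len , h)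
  unambiguous : ∀ x cs cs′ → AcceptingPath oracle machine x cs → AcceptingPath oracle machine x cs′ → cs ≡ cs′
  unambiguous x cs cs′ a a′ with accepting x cs a | accepting x cs′ a′
  ... | ys , len , refl , h | ys′ , len′ , refl , h′ = cong (_++ false ∷ tail e)
    (trans (sym (reverse-involutive ys)) (trans (cong reverse
      (unique (length x) t (trans (length-reverse ys) len) (trans (length-reverse ys′) len′) h h′)) (reverse-involutive ys′)))

InUP-≗ : ∀ {L L′} → (∀ x → L x ≡ L′ x) → InUP oracle L → InUP oracle L′
InUP-≗ eq (M , p , t , comp , u) = M , p , t ,
  (λ x → (λ x∈ → proj₁ (comp x) (trans (eq x) x∈)) , (λ a → trans (sym (eq x)) (proj₂ (comp x) a))) , u

-- The machines of an assumed hard pair or complete language keep their promise, which excludes the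
-- broken alternative at all lengths; so the witness languages really lie in the class that is to be
-- reduced.
legality : ∀ {k e} → kind e ≡ k → ¬ ∃ (BrokenFor k oracle e) → ∀ n → UniqueAt oracle e n × LegalFor k oracle e n
legality {e = e} refl ¬broken n with oracle-legal e n
... | inj₁ legal  = legal
... | inj₂ broken = ⊥-elim (¬broken broken)

reductionFails : ∀ {k e} → kind e ≡ k → ¬ ∃ (BrokenFor k oracle e) → ∀ {f} → InFP oracle f
  → ∃ λ n → FailsFor k oracle e n (f (replicate n false))
reductionFails {e = e} refl ¬broken {f} (F , q , run) with requirement-surjective e F q
... | r , refl , F≈ , refl with oracle-met r
... | inj₁ broken = ⊥-elim (¬broken broken)
... | inj₂ (n , fails) = n , fails _ (dexec-≈ F≈ (evalP q n) (replicate n false) _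
  (subst (λ t → ∃₂ λ b c → dexec oracle F (evalP q t) (replicate n false) ≡ inj₂ (b , c)
                            × readWord (Config.work c) ≡ f (replicate n false))
         (length-replicate n) (run (replicate n false))))

atLength : ∀ {t e n} → Has oracle t e n → replicate n false ∈L witnessLang t e
atLength {t} {e} {n} h = witnessLang-complete t e (replicate n false) (subst (Has oracle t e) (sym (length-replicate n)) h)

fromLength : ∀ {t e n} → replicate n false ∈L witnessLang t e → Has oracle t e n
fromLength {t} {e} {n} h = subst (Has oracle t e) (length-replicate n) (witnessLang-sound t e (replicate n false) h)

noHardDisjNP : ∀ C D → DisjNP oracle C D → ¬ PairHard oracle (DisjUP oracle) C D
noHardDisjNP C D (inC , inD , disj) hard with representPair np inC inD
... | e , k≡ , repC , repD = refute (hard (witnessLang true e) (witnessLang false e)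
        (witnessLang-UP true e (proj₁ ∘ legal) , witnessLang-UP false e (proj₁ ∘ legal) ,
         λ x a b → proj₂ (legal (length x)) (witnessLang-sound true e x a , witnessLang-sound false e x b)))
  where
  intact : ¬ ∃ (BrokenFor np oracle e)
  intact (u , a , b) = disj u (proj₂ (repC u) a) (proj₂ (repD u) b)
  legal : ∀ n → UniqueAt oracle e n × LegalFor np oracle e n
  legal = legality k≡ intact
  refute : ¬ ppReduces oracle (witnessLang true e) (witnessLang false e) C D
  refute (h , hFP , maps) with reductionFails {e = e} k≡ intact hFP
  ... | n , true  , has , rej = rej (proj₁ (repC _) (proj₁ (maps (replicate n false)) (atLength has)))
  ... | n , false , has , rej = rej (proj₁ (repD _) (proj₂ (maps (replicate n false)) (atLength has)))

noCompleteUP : ∀ L → ¬ Complete oracle (InUP oracle) L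
-- A task has places for two machines; the `up` clauses speak of the first, and M fills the second
-- as well.
noCompleteUP L ((M , p , t , comp , unamb) , hard) with task-surjective up M M p
... | e , k≡ , M≈ , _ , p≡ =
  refute (hard (witnessLang true e) (witnessLang-UP true e (λ n → proj₁ (legality k≡ intact n))))
  where
  intact : ¬ ∃ (BrokenFor up oracle e)
  intact (u , cs , cs′ , ne , (_ , a) , (_ , a′)) = ne (unamb u cs cs′
    (subst (λ A → A) (acceptingPath-≈ M≈ u cs) a) (subst (λ A → A) (acceptingPath-≈ M≈ u cs′) a′))
  rep : Represents e true L
  rep = represents {e} {p = p} true M≈ (λ n → ≤-reflexive (cong (λ p → evalP p n) (sym p≡))) t comp
  refute : ¬ (witnessLang true e ≤m[ oracle ] L)
  refute (f , fFP , maps) with reductionFails {e = e} k≡ intact fFP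
  ... | n , inj₁ (has , rej)    = rej (proj₁ (rep _) (proj₁ (maps (replicate n false)) (atLength has)))
  ... | n , inj₂ (hasNot , acc) = hasNot (fromLength (proj₂ (maps (replicate n false)) (proj₂ (rep _) acc)))

not-both : ∀ {a} → not a ≡ true → a ≡ true → ⊥
not-both () refl

-- The task consists of machines for the complements of C and D, so an input that both reject would
-- be a common element. The complements of the two witness languages form the pair that does not
-- reduce to (C , D).
noHardDisjCoNP : ∀ C D → DisjCoNP oracle C D → ¬ PairHard oracle (DisjCoUP oracle) C D
noHardDisjCoNP C D (inC , inD , disj) hard with representPair conp inC inD
... | e , k≡ , repC , repD = refute (hard (complement (witnessLang true e)) (complement (witnessLang false e))
        (InUP-≗ (λ x → sym (not-involutive _)) (witnessLang-UP true e (proj₁ ∘ legal)) ,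
         InUP-≗ (λ x → sym (not-involutive _)) (witnessLang-UP false e (proj₁ ∘ legal)) ,
         λ x a b → [ (λ h → not-both a (witnessLang-complete true e x h))
                   , (λ h → not-both b (witnessLang-complete false e x h)) ]′ (proj₂ (legal (length x)))))
  where
  member : ∀ L b {u} → Represents e b (complement L) → ¬ Accepts oracle b e u → u ∈L L
  member L b {u} rep rej with L u in eq
  ... | true  = refl
  ... | false = ⊥-elim (rej (proj₁ (rep u) (cong not eq)))
  intact : ¬ ∃ (BrokenFor conp oracle e)
  intact (u , a , b) = disj u (member C true repC a) (member D false repD b)
  legal : ∀ n → UniqueAt oracle e n × LegalFor conp oracle e n
  legal = legality k≡ intact
  outside : ∀ t {n} → ¬ Has oracle t e n → replicate n false ∈L complement (witnessLang t e)
  outside t {n} hasNot with witnessLang t e (replicate n false) in eq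
  ... | true  = ⊥-elim (hasNot (fromLength eq))
  ... | false = refl
  refute : ¬ ppReduces oracle (complement (witnessLang true e)) (complement (witnessLang false e)) C D
  refute (h , hFP , maps) with reductionFails {e = e} k≡ intact hFP
  ... | n , true  , hasNot , acc = not-both (proj₂ (repC _) acc) (proj₁ (maps (replicate n false)) (outside true hasNot))
  ... | n , false , hasNot , acc = not-both (proj₂ (repD _) acc) (proj₂ (maps (replicate n false)) (outside false hasNot))

theorem4 : Σ Lang λ O →
    ((∀ L → InNP O L × InCoNP O L → InP O L) × (∀ L → InP O L → InNP O L × InCoNP O L))
    × (∀ C D → DisjNP O C D → ¬ PairHard O (DisjUP O) C D)
    × (∀ L → ¬ Complete O (InUP O) L)
    × (∀ C D → DisjCoNP O C D → ¬ PairHard O (DisjCoUP O) C D)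
theorem4 = oracle
  , (InNP∩coNP⇒InP , λ L inP → InP⇒InNP oracle inP , InP⇒InNP oracle (InP-complement oracle inP))
  , noHardDisjNP
  , noCompleteUP
  , noHardDisjCoNP
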